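{- Let $\lambda=(1^{a_1},2^{a_2},\ldots,m^{a_m})$ with all $a_i\ge1$ and $m\ge3$. Let $r_1$ be the number of indices $k\in\{1,\ldots,m-1\}$ with $a_k\ge2$ and $a_{k+1}\ge2$. Let $r_2=1$ if $a_i=a_{m+1-i}$ for all $1\le i\le m$, and $r_2=0$ otherwise. Then $$\mathrm{Aut}(\mathrm{GT}_\lambda)\cong\big(S_{a_2}^{\delta_{1,a_1}}\times S_{a_{m-1}}^{\delta_{1,a_m}}\times\mathbb{Z}_2^{r_1+1}\big)\ltimes_\varphi\mathbb{Z}_2^{r_2},$$ where, if $r_2=1$, the homomorphism $\varphi:\mathbb{Z}_2\to\mathrm{Aut}\big(S_{a_2}^{\delta_{1,a_1}}\times S_{a_{m-1}}^{\delta_{1,a_m}}\times\mathbb{Z}_2^{r_1+1}\big)$ sends the nonidentity element to the map $(\sigma_1,\sigma_2,z_1,\ldots,z_{r_1},z_{r_1+1})\mapsto(\sigma_2,\sigma_1,z_{r_1},\ldots,z_1,z_{r_1+1})$ (if $r_2=0$ the product is direct with nothing).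
   Context: For a partition $\lambda=(\lambda_1\le\cdots\le\lambda_n)$ of positive integers, the Gelfand–Tsetlin polytope $\mathrm{GT}_\lambda$ is the set of points $(x_{i,j})_{1\le j\le i\le n}\in\mathbb{R}^{n(n+1)/2}$ with $x_{i,i}=\lambda_i$ for all $i$ and $x_{i-1,j}\le x_{i,j}\le x_{i+1,j}$, $x_{i,j-1}\le x_{i,j}\le x_{i,j+1}$ whenever the indices lie in $\{(i,j):1\le j\le i\le n\}$. The notation $(1^{a_1},\ldots,m^{a_m})$ means $a_1$ copies of $1$, then $a_2$ copies of $2$, etc. $\mathrm{Aut}(\mathrm{GT}_\lambda)$ is the group of automorphisms of the face poset of $\mathrm{GT}_\lambda$ (faces ordered by inclusion). $S_a$ is the symmetric group on $a$ letters; $G^{0}$ denotes the trivial group and $G^1=G$; $\delta_{x,y}=1$ if $x=y$ and $0$ otherwise; $\mathbb{Z}_2$ is the cyclic group of order 2. Note that when $r_2=1$ one has $a_1=a_m$ and $a_2=a_{m-1}$, so the swap in $\varphi$ is well defined. -}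

module Defs where

open import Data.Nat as ℕ using (ℕ; zero; suc; _+_; _*_; _∸_; _<_; _≡ᵇ_)
open import Data.Bool using (Bool; true; false; if_then_else_; _xor_; _∧_)
open import Data.List using (List; []; _∷_; _++_; replicate; length; map; reverse; zipWith; upTo)
open import Data.List.Relation.Binary.Permutation.Propositional using (_↭_)
open import Data.Integer using (+_)
open import Data.Rational using (ℚ; _/_) renaming (_≤_ to _≤ℚ_)
open import Data.Product using (Σ; _×_; _,_)
open import Relation.Binary.PropositionalEquality using (_≡_)

lamFrom : ℕ → List ℕ → List ℕ
lamFrom k []       = []
lamFrom k (a ∷ as) = replicate a k ++ lamFrom (suc k) as

lam : List ℕ → List ℕ
lam as = lamFrom 1 as

at : List ℕ → ℕ → ℕ
at []       _       = 0
at (x ∷ xs) zero    = x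
at (x ∷ xs) (suc i) = at xs i

nOf : List ℕ → ℕ
nOf as = length (lam as)

lamℚ : List ℕ → ℕ → ℚ
lamℚ as i = (+ at (lam as) i) / 1

-- Gelfand–Tsetlin polytope (0-based indices: positions (i,j), j ≤ i < n).
-- Points are rational; coordinates outside the triangle are irrelevant.

Point : Set
Point = ℕ → ℕ → ℚ

InGT : List ℕ → Point → Set
InGT as x =
  (∀ i → i < nOf as → x i i ≡ lamℚ as i) ×
  (∀ i j → j ℕ.≤ i → suc i < nOf as → x i j ≤ℚ x (suc i) j) ×
  (∀ i j → suc j ℕ.≤ i → i < nOf as → x i j ≤ℚ x i (suc j))

-- A face is represented by any point of its relative interior; the face of
-- a point x is the smallest face containing x, i.e. it is determined by
-- the set of defining inequalities that are tight at x.
Face : List ℕ → Set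
Face as = Σ Point (InGT as)

-- F ⊆ G  iff  every inequality tight on G is tight on F.
FaceLe : (as : List ℕ) → Face as → Face as → Set
FaceLe as (x , _) (y , _) =
  (∀ i j → j ℕ.≤ i → suc i < nOf as → y i j ≡ y (suc i) j → x i j ≡ x (suc i) j) ×
  (∀ i j → suc j ℕ.≤ i → i < nOf as → y i j ≡ y i (suc j) → x i j ≡ x i (suc j))

FaceEq : (as : List ℕ) → Face as → Face as → Set
FaceEq as F G = FaceLe as F G × FaceLe as G F

record Aut (as : List ℕ) : Set where
  field
    to       : Face as → Face as
    from     : Face as → Face as
    to-from  : ∀ F → FaceEq as (to (from F)) F
    from-to  : ∀ F → FaceEq as (from (to F)) F
    mono     : ∀ F G → FaceLe as F G → FaceLe as (to F) (to G)
    reflect  : ∀ F G → FaceLe as (to F) (to G) → FaceLe as F G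
open Aut public

-- The target group
--   (S_{a_2}^{δ_{1,a_1}} × S_{a_{m-1}}^{δ_{1,a_m}} × Z_2^{r_1+1}) ⋊_φ Z_2^{r_2}.
-- A permutation of {0..k-1} is the list of its images; S_k^δ is realized as
-- S_{δ·k} (S_0 is the trivial group).  Z_2 = Bool with xor.

δ : ℕ → ℕ → ℕ
δ x y = if x ≡ᵇ y then 1 else 0

IsPerm : ℕ → List ℕ → Set
IsPerm k σ = σ ↭ upTo k

_∘ₚ_ : List ℕ → List ℕ → List ℕ
σ ∘ₚ τ = map (at σ) τ

r₁ : List ℕ → ℕ
r₁ (x ∷ y ∷ rest) = (if (2 ℕ.≤ᵇ x) ∧ (2 ℕ.≤ᵇ y) then 1 else 0) + r₁ (y ∷ rest)
r₁ _              = 0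

-- element ((σ₁, σ₂, zs ++ [z₀]), t) with zs = (z_1,...,z_{r_1}), z₀ = z_{r_1+1}
record GElt : Set where
  constructor gelt
  field
    σ₁ σ₂ : List ℕ
    zs    : List Bool
    z₀    : Bool
    t     : Bool
open GElt public

k₁ k₂ : List ℕ → ℕ
k₁ as = δ 1 (at as 0) * at as 1
k₂ as = δ 1 (at as (length as ∸ 1)) * at as (length as ∸ 2)

-- membership in the group; the Z_2^{r_2} coordinate t must be trivial
-- unless r_2 = 1, i.e. unless (a_1,...,a_m) is a palindrome.
Valid : List ℕ → GElt → Set
Valid as g =
  IsPerm (k₁ as) (σ₁ g) × IsPerm (k₂ as) (σ₂ g) × length (zs g) ≡ r₁ as ×
  (t g ≡ true → as ≡ reverse as)

twist : Bool → GElt → GElt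
twist false g = g
twist true (gelt s1 s2 z z0 t) = gelt s2 s1 (reverse z) z0 t

_·_ : GElt → GElt → GElt
g · h with twist (t g) h
... | gelt s1 s2 z z0 _ =
  gelt (σ₁ g ∘ₚ s1) (σ₂ g ∘ₚ s2) (zipWith _xor_ (zs g) z) (z₀ g xor z0) (t g xor t h)

-- The differences of neighbouring entries of a Gelfand–Tsetlin array form a flow in a planar graph
-- whose vertices are the cells (unit squares) of the array: what enters a cell through its left and
-- bottom sides leaves it through its top and right sides, and between the blocks k - 1 and k of λ a
-- sink absorbs one unit.  Facets are the edges of this graph, and a face is determined by the facets
-- containing it, so an automorphism is a permutation π of the edges.
--
-- Two closure properties pin π down.  Two facets force a third one only if they are the two in-edges
-- or the two out-edges of a cell, since otherwise a lattice path avoids them and crosses the third;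
-- hence π permutes the cells.  Two facets conflict (lie in a common minimal set of facets with empty
-- intersection) only if they are crossed by paths to a common sink.  The two ends A and B of the hook
-- formed by the first column and the bottom row are the edges in no cell; they are preserved or
-- exchanged, and the corner cell is the only one whose in-edges lie in no other cell and conflict with
-- both.  Starting from the corner, π is determined cell by cell: on all in-edges of cells it is the
-- identity or the transposition, and in the second case the conflicts on the hook make λ symmetric.
-- What remains are permutations of parallel edges: the in-edges of the corner cell, the out-edges of
-- the r₁ cells leading twice to the same sink, and the edges of A and of B.

module Submission where

open import Defs using (at; _∘ₚ_; GElt; gelt; _·_) renaming (σ₁ to g-σ₁; σ₂ to g-σ₂; zs to g-zs; z₀ to g-z₀; t to g-t)
open import Data.Nat as ℕ using (ℕ; zero; suc; _+_; _*_; _∸_; _≤_; _<_; z≤n; s≤s)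
import Data.Nat.Properties as ℕₚ
open import Data.Nat.Coprimality using (1-coprimeTo) renaming (sym to coprime-sym)
import Data.Integer as ℤ
import Data.Integer.Properties as ℤₚ
open import Data.Rational as ℚ using (ℚ; mkℚ; _/_; *≤*; *<*; _⊓_; _⊔_; 0ℚ; 1ℚ; ½)
import Data.Rational.Properties as ℚₚ
open import Data.Bool using (Bool; true; false; _xor_; if_then_else_)
import Data.Bool.Properties as Boolₚ
open import Data.List using (List; []; _∷_; _++_; length; map; reverse; replicate; zipWith; upTo; applyUpTo; cartesianProductWith)
import Data.List.Properties as Listₚ
open import Data.List.Membership.Propositional using (_∈_; lose)
open import Data.List.Membership.Propositional.Properties using (∈-++⁺ˡ; ∈-++⁺ʳ; ∈-cartesianProductWith⁺; ∈-upTo⁺; ∈-applyUpTo⁺; ∈-applyUpTo⁻; ∈-∃++)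
open import Data.List.Membership.Propositional.Properties.WithK using (unique∧set⇒bag)
import Data.List.Membership.DecPropositional as DecMembership
open import Data.List.Relation.Binary.BagAndSetEquality using (∼bag⇒↭)
open import Data.List.Relation.Binary.Permutation.Propositional as Perm using (_↭_; ↭-refl; ↭-reflexive; ↭-sym; ↭-trans)
open import Data.List.Relation.Binary.Permutation.Propositional.Properties using (↭-length; map⁺; All-resp-↭; ↭-reverse; shift; drop-∷; ∈-resp-↭)
open import Data.List.Relation.Unary.All using (All; []; _∷_)
open import Data.List.Relation.Unary.Any using (here; there; any?; satisfied)
open import Data.List.Relation.Unary.Unique.Propositional.Properties using (applyUpTo⁺₁; upTo⁺)
open import Data.Product using (Σ; ∃; ∃₂; _×_; _,_; proj₁; proj₂; uncurry)
open import Data.Product.Properties using (≡-dec)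
open import Data.Sum using (_⊎_; inj₁; inj₂)
open import Data.Empty using (⊥; ⊥-elim)
open import Function using (_∘_; mk⇔)
open import Relation.Nullary using (¬_; Dec; yes; no; does)
open import Relation.Nullary.Decidable using (_×-dec_; _⊎-dec_; _→-dec_; map′; dec-true; dec-false)
open import Relation.Binary.PropositionalEquality

-- Rational arithmetic

-- Everything has to be said in the language of the face poset, where a face is a point known only
-- up to its tight facets. Each incidence used by the combinatorics therefore needs points with
-- prescribed tight facets. They come from three operations: midpoints, tight exactly where both
-- points are; gluing two points at an integer level; and replacing what happens between the levels
-- `c` and `c + 1` by one unit along a lattice path. Redundant inequalities are dropped at the
-- outset, since their tightness follows from that of the facets.
--
-- The condition m ≥ 3 puts the sinks of A and B on different levels. The exchange of the in-edges
-- of the corner cell is always a symmetry, and the transposition exchanges these edges as well, so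
-- they alone do not reveal the transposition. Two bits are read off at the corner: the out-edges
-- `H 1 0` and `V 0 1` decide about the transposition, and then the in-edges about the separate
-- exchange. Composing with the corresponding generators leaves symmetries that fix these edges, and
-- only for those does the cell by cell argument run.

abstract
  ⟦_⟧ : ℕ → ℚ
  ⟦ n ⟧ = ℤ.+ n / 1

  -- The division normalises by a gcd. With the explicit fraction of denominator 1, comparisons
  -- become comparisons of integers.
  ⟦⟧-mkℚ : ∀ n → ⟦ n ⟧ ≡ mkℚ (ℤ.+ n) 0 (coprime-sym (1-coprimeTo n))
  ⟦⟧-mkℚ n = ℚₚ.normalize-coprime (coprime-sym (1-coprimeTo n))

  ⟦⟧-mono : ∀ {a b} → a ℕ.≤ b → ⟦ a ⟧ ℚ.≤ ⟦ b ⟧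
  ⟦⟧-mono {a} {b} a≤b rewrite ⟦⟧-mkℚ a | ⟦⟧-mkℚ b =
    *≤* (subst₂ ℤ._≤_ (sym (ℤₚ.*-identityʳ (ℤ.+ a))) (sym (ℤₚ.*-identityʳ (ℤ.+ b))) (ℤ.+≤+ a≤b))

  ⟦⟧-mono-< : ∀ {a b} → a ℕ.< b → ⟦ a ⟧ ℚ.< ⟦ b ⟧
  ⟦⟧-mono-< {a} {b} a<b rewrite ⟦⟧-mkℚ a | ⟦⟧-mkℚ b =
    *<* (subst₂ ℤ._<_ (sym (ℤₚ.*-identityʳ (ℤ.+ a))) (sym (ℤₚ.*-identityʳ (ℤ.+ b))) (ℤ.+<+ a<b))

  ⟦⟧-cancel-≤ : ∀ {a b} → ⟦ a ⟧ ℚ.≤ ⟦ b ⟧ → a ℕ.≤ b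
  ⟦⟧-cancel-≤ {a} {b} p = ℕₚ.≮⇒≥ λ b<a → ℚₚ.<-irrefl refl (ℚₚ.<-≤-trans (⟦⟧-mono-< b<a) p)

  ⟦⟧-def : ∀ n → ⟦ n ⟧ ≡ ℤ.+ n / 1
  ⟦⟧-def n = refl

  ⟦suc⟧ : ∀ n → ⟦ suc n ⟧ ≡ ⟦ n ⟧ ℚ.+ 1ℚ
  ⟦suc⟧ n rewrite ⟦⟧-mkℚ n = ℚₚ./-cong {p₁ = ℤ.+ suc n} {q₁ = 1} lem refl
    where
    lem : ℤ.+ suc n ≡ (ℤ.+ n ℤ.* ℤ.+ 1) ℤ.+ (ℤ.+ 1 ℤ.* ℤ.+ 1)
    lem = trans (cong ℤ.+_ (ℕₚ.+-comm 1 n)) (cong (ℤ._+ ℤ.+ 1) (sym (ℤₚ.*-identityʳ (ℤ.+ n))))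

x+y-y : ∀ x y → (x ℚ.+ y) ℚ.- y ≡ x
x+y-y x y = trans (ℚₚ.+-assoc x y (ℚ.- y)) (trans (cong (x ℚ.+_) (ℚₚ.+-inverseʳ y)) (ℚₚ.+-identityʳ x))

x-y+y : ∀ x y → (x ℚ.- y) ℚ.+ y ≡ x
x-y+y x y = trans (ℚₚ.+-assoc x (ℚ.- y) y) (trans (cong (x ℚ.+_) (ℚₚ.+-inverseˡ y)) (ℚₚ.+-identityʳ x))

≤∧≢⇒< : ∀ {x y} → x ℚ.≤ y → x ≢ y → x ℚ.< y
≤∧≢⇒< x≤y x≢y = ℚₚ.≰⇒> λ y≤x → x≢y (ℚₚ.≤-antisym x≤y y≤x)

+-tight : ∀ {a b c d} → a ℚ.≤ b → c ℚ.≤ d → a ℚ.+ c ≡ b ℚ.+ d → a ≡ b × c ≡ d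
+-tight {a} {b} {c} {d} a≤b c≤d e with a ℚₚ.≟ b | c ℚₚ.≟ d
... | yes p | yes q = p , q
... | no p  | _     = ⊥-elim (ℚₚ.<⇒≢ (ℚₚ.+-mono-<-≤ (≤∧≢⇒< a≤b p) c≤d) e)
... | yes _ | no q  = ⊥-elim (ℚₚ.<⇒≢ (ℚₚ.+-mono-≤-< a≤b (≤∧≢⇒< c≤d q)) e)

avg : ℚ → ℚ → ℚ
avg x y = (x ℚ.+ y) ℚ.* ½

avg-idem : ∀ x → avg x x ≡ x
avg-idem x = trans (cong (ℚ._* ½) (cong₂ ℚ._+_ (sym (ℚₚ.*-identityʳ x)) (sym (ℚₚ.*-identityʳ x))))
  (trans (cong (ℚ._* ½) (sym (ℚₚ.*-distribˡ-+ x 1ℚ 1ℚ)))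
  (trans (ℚₚ.*-assoc x (1ℚ ℚ.+ 1ℚ) ½) (ℚₚ.*-identityʳ x)))

avg-mono : ∀ {a b c d} → a ℚ.≤ b → c ℚ.≤ d → avg a c ℚ.≤ avg b d
avg-mono a≤b c≤d = ℚₚ.*-monoʳ-≤-nonNeg ½ (ℚₚ.+-mono-≤ a≤b c≤d)

avg-tight : ∀ {a b c d} → a ℚ.≤ b → c ℚ.≤ d → avg a c ≡ avg b d → a ≡ b × c ≡ d
avg-tight {a} {b} {c} {d} a≤b c≤d e = +-tight a≤b c≤d
  (ℚₚ.≤-antisym (ℚₚ.+-mono-≤ a≤b c≤d)
    (ℚₚ.*-cancelʳ-≤-pos ½ (ℚₚ.≤-reflexive (sym e))))

bit : Bool → ℚ
bit true  = 1ℚ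
bit false = 0ℚ

bit-mono : ∀ {a b} → (a ≡ true → b ≡ true) → bit a ℚ.≤ bit b
bit-mono {false} {false} h = ℚₚ.≤-refl
bit-mono {false} {true}  h = ℚₚ.nonNegative⁻¹ 1ℚ
bit-mono {true} {b} h rewrite h refl = ℚₚ.≤-refl

bit-inj : ∀ {a b} → bit a ≡ bit b → a ≡ b
bit-inj {false} {false} _ = refl
bit-inj {true}  {true}  _ = refl
bit-inj {false} {true}  ()
bit-inj {true}  {false} ()

-- The three summands carry the levels below c, between c and c + 1, and above c + 1.
splice : ℚ → ℕ → Bool → ℚ → ℚ
splice x c u y = (((x ⊓ ⟦ c ⟧) ℚ.+ bit u) ℚ.+ (y ⊔ ⟦ suc c ⟧)) ℚ.- ⟦ suc c ⟧

splice-mono : ∀ {x x′ u u′ y y′} c → x ℚ.≤ x′ → (u ≡ true → u′ ≡ true) → y ℚ.≤ y′ →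
  splice x c u y ℚ.≤ splice x′ c u′ y′
splice-mono c p q r = ℚₚ.+-monoˡ-≤ (ℚ.- ⟦ suc c ⟧)
  (ℚₚ.+-mono-≤ (ℚₚ.+-mono-≤ (ℚₚ.⊓-monoˡ-≤ ⟦ c ⟧ p) (bit-mono q)) (ℚₚ.⊔-monoˡ-≤ ⟦ suc c ⟧ r))

-- All three summands are monotone, so equality of the sums forces equality of each of them, in
-- particular of the bits.
splice-bit : ∀ {x x′ u u′ y y′} c → x ℚ.≤ x′ → (u ≡ true → u′ ≡ true) → y ℚ.≤ y′ →
  splice x c u y ≡ splice x′ c u′ y′ → u ≡ u′
splice-bit {x} {x′} {u} {u′} {y} {y′} c p q r e =
  bit-inj (proj₂ (+-tight p′ (bit-mono q) (proj₁ (+-tight (ℚₚ.+-mono-≤ p′ (bit-mono q)) r′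
    (trans (sym (x-y+y _ ⟦ suc c ⟧)) (trans (cong (ℚ._+ ⟦ suc c ⟧) e) (x-y+y _ ⟦ suc c ⟧)))))))
  where
  p′ : x ⊓ ⟦ c ⟧ ℚ.≤ x′ ⊓ ⟦ c ⟧
  p′ = ℚₚ.⊓-monoˡ-≤ ⟦ c ⟧ p
  r′ : y ⊔ ⟦ suc c ⟧ ℚ.≤ y′ ⊔ ⟦ suc c ⟧
  r′ = ℚₚ.⊔-monoˡ-≤ ⟦ suc c ⟧ r

splice-cong : ∀ {x x′ u u′ y y′} c → x ⊓ ⟦ c ⟧ ≡ x′ ⊓ ⟦ c ⟧ → u ≡ u′ → y ⊔ ⟦ suc c ⟧ ≡ y′ ⊔ ⟦ suc c ⟧ →
  splice x c u y ≡ splice x′ c u′ y′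
splice-cong c p q r = cong (ℚ._- ⟦ suc c ⟧) (cong₂ ℚ._+_ (cong₂ ℚ._+_ p (cong bit q)) r)

splice-low : ∀ {v c} → v ℕ.≤ c → splice ⟦ v ⟧ c false ⟦ v ⟧ ≡ ⟦ v ⟧
splice-low {v} {c} v≤c
  rewrite ℚₚ.p≤q⇒p⊓q≡p (⟦⟧-mono v≤c) | ℚₚ.p≤q⇒p⊔q≡q (⟦⟧-mono (ℕₚ.m≤n⇒m≤1+n v≤c))
        | ℚₚ.+-identityʳ ⟦ v ⟧ = x+y-y ⟦ v ⟧ ⟦ suc c ⟧

splice-high : ∀ {v c} → suc c ℕ.≤ v → splice ⟦ v ⟧ c true ⟦ v ⟧ ≡ ⟦ v ⟧
splice-high {v} {c} c<v
  rewrite ℚₚ.p≥q⇒p⊓q≡q (⟦⟧-mono (ℕₚ.<⇒≤ c<v)) | ℚₚ.p≥q⇒p⊔q≡p (⟦⟧-mono c<v) | sym (⟦suc⟧ c)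
        | ℚₚ.+-comm ⟦ suc c ⟧ ⟦ v ⟧ = x+y-y ⟦ v ⟧ ⟦ suc c ⟧

glue : ℕ → ℚ → ℚ → ℚ
glue c x y = ((x ⊓ ⟦ c ⟧) ℚ.+ (y ⊔ ⟦ c ⟧)) ℚ.- ⟦ c ⟧

glue-mono : ∀ c {x x′ y y′} → x ℚ.≤ x′ → y ℚ.≤ y′ → glue c x y ℚ.≤ glue c x′ y′
glue-mono c p r = ℚₚ.+-monoˡ-≤ (ℚ.- ⟦ c ⟧) (ℚₚ.+-mono-≤ (ℚₚ.⊓-monoˡ-≤ ⟦ c ⟧ p) (ℚₚ.⊔-monoˡ-≤ ⟦ c ⟧ r))

glue-diag : ∀ c v → glue c ⟦ v ⟧ ⟦ v ⟧ ≡ ⟦ v ⟧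
glue-diag c v with ℕₚ.≤-total v c
... | inj₁ v≤c rewrite ℚₚ.p≤q⇒p⊓q≡p (⟦⟧-mono v≤c) | ℚₚ.p≤q⇒p⊔q≡q (⟦⟧-mono v≤c) = x+y-y ⟦ v ⟧ ⟦ c ⟧
... | inj₂ c≤v rewrite ℚₚ.p≥q⇒p⊓q≡q (⟦⟧-mono c≤v) | ℚₚ.p≥q⇒p⊔q≡p (⟦⟧-mono c≤v) | ℚₚ.+-comm ⟦ c ⟧ ⟦ v ⟧ = x+y-y ⟦ v ⟧ ⟦ c ⟧

glue-low : ∀ c {x x′ y y′} → x ≡ x′ → y ℚ.≤ ⟦ c ⟧ → y′ ℚ.≤ ⟦ c ⟧ → glue c x y ≡ glue c x′ y′
glue-low c refl a b rewrite ℚₚ.p≤q⇒p⊔q≡q a | ℚₚ.p≤q⇒p⊔q≡q b = refl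

glue-high : ∀ c {x x′ y y′} → ⟦ c ⟧ ℚ.≤ x → ⟦ c ⟧ ℚ.≤ x′ → y ≡ y′ → glue c x y ≡ glue c x′ y′
glue-high c a b refl rewrite ℚₚ.p≥q⇒p⊓q≡q a | ℚₚ.p≥q⇒p⊓q≡q b = refl

-- Reflection in the midpoint of `l` and `h`. It serves for a single entry between its neighbours
-- and for the reversal of all values at once.
mirror : ℚ → ℚ → ℚ → ℚ
mirror l h x = (l ℚ.+ h) ℚ.- x

mirror-low : ∀ l h → mirror l h h ≡ l
mirror-low l h = x+y-y l h

mirror-high : ∀ l h → mirror l h l ≡ h
mirror-high l h = trans (cong (ℚ._- l) (ℚₚ.+-comm l h)) (x+y-y h l)

mirror-anti : ∀ l h {x y} → x ℚ.≤ y → mirror l h y ℚ.≤ mirror l h x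
mirror-anti l h p = ℚₚ.+-monoʳ-≤ (l ℚ.+ h) (ℚₚ.neg-antimono-≤ p)

mirror-invol : ∀ l h x → mirror l h (mirror l h x) ≡ x
mirror-invol l h x = trans (cong (l ℚ.+ h ℚ.+_) (trans (ℚₚ.neg-distrib-+ (l ℚ.+ h) (ℚ.- x)) (cong (ℚ.- (l ℚ.+ h) ℚ.+_) (⁻¹-involutive x))))
  (trans (sym (ℚₚ.+-assoc (l ℚ.+ h) (ℚ.- (l ℚ.+ h)) x)) (trans (cong (ℚ._+ x) (ℚₚ.+-inverseʳ (l ℚ.+ h))) (ℚₚ.+-identityˡ x)))
  where open import Algebra.Properties.Group ℚₚ.+-0-group using (⁻¹-involutive)

mirror-inj : ∀ l h {x y} → mirror l h x ≡ mirror l h y → x ≡ y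
mirror-inj l h e = trans (sym (mirror-invol l h _)) (trans (cong (mirror l h) e) (mirror-invol l h _))

-- The polytope of a shape and its facets

data Edge : Set where
  V H : ℕ → ℕ → Edge

V-inj : ∀ {p q p′ q′} → V p q ≡ V p′ q′ → p ≡ p′ × q ≡ q′
V-inj refl = refl , refl

H-inj : ∀ {p q p′ q′} → H p q ≡ H p′ q′ → p ≡ p′ × q ≡ q′
H-inj refl = refl , refl

_≟ᴱ_ : (e f : Edge) → Dec (e ≡ f)
V p q ≟ᴱ V p′ q′ = map′ (λ { (refl , refl) → refl }) V-inj ((p ℕ.≟ p′) ×-dec (q ℕ.≟ q′))
V _ _ ≟ᴱ H _ _   = no λ ()
H _ _ ≟ᴱ V _ _   = no λ ()
H p q ≟ᴱ H p′ q′ = map′ (λ { (refl , refl) → refl }) H-inj ((p ℕ.≟ p′) ×-dec (q ℕ.≟ q′))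

row col : Edge → ℕ
row (V p _) = p
row (H p _) = p
col (V _ q) = q
col (H _ q) = q

Array : ∀ {ℓ} → Set ℓ → Set ℓ
Array A = ℕ → ℕ → A

src tgt : ∀ {ℓ} {A : Set ℓ} → Array A → Edge → A
src X (V p q) = X (suc p) q
src X (H p q) = X p q
tgt X (V p q) = X p q
tgt X (H p q) = X p (suc q)

Tight : Array ℚ → Edge → Set
Tight X e = src X e ≡ tgt X e

-- Rows p are counted from the bottom and columns q from the left, so that (p , q) is the paper's
-- position (N - p , q) counted from 0; the diagonal is p + q = N, and lo q ≤ x ≤ hi p holds at (p , q).
record Shape : Set where
  field
    N       : ℕ
    lo      : ℕ → ℕ
    lo-mono : ∀ {a b} → a ≤ b → lo a ≤ lo b
    lo-step : ∀ a → lo (suc a) ≤ suc (lo a)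
    -- With constant values beyond the diagonal, identities between `lo` and `hi` can be stated for
    -- all indices.
    lo-top  : ∀ {q} → N ≤ q → lo q ≡ lo N
    hi      : ℕ → ℕ
    hi-def  : ∀ p → hi p ≡ lo (N ∸ p)
    -- The numbers `lo 0` and `hi 0` are the least and the greatest part, so this is m ≥ 3.
    wide    : suc (suc (lo 0)) ≤ hi 0

  Free Cell : ℕ → ℕ → Set
  Free p q = lo q < hi p
  Cell p q = Free (suc p) q × Free p (suc q)

  -- Facet e says that the inequality of e is irredundant.  Every edge except V p 0 and H 0 q leaves
  -- a unit square, and it is irredundant exactly if that square is a cell.
  Facet : Edge → Set
  Facet (V p zero)    = Free p 0
  Facet (V p (suc q)) = Cell p q
  Facet (H zero q)    = Free 0 q
  Facet (H (suc p) q) = Cell p q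

module Poly (S : Shape) where
  open Shape S

  hi-anti : ∀ {a b} → a ≤ b → hi b ≤ hi a
  hi-anti {a} {b} a≤b = subst₂ _≤_ (sym (hi-def b)) (sym (hi-def a)) (lo-mono (ℕₚ.∸-monoʳ-≤ N a≤b))

  hi-step : ∀ a → hi a ≤ suc (hi (suc a))
  hi-step a rewrite hi-def a | hi-def (suc a) with a ℕₚ.<? N
  ... | yes a<N = ℕₚ.≤-trans (ℕₚ.≤-reflexive (cong lo (ℕₚ.+-∸-assoc 1 a<N))) (lo-step (N ∸ suc a))
  ... | no a≮N rewrite ℕₚ.m≤n⇒m∸n≡0 (ℕₚ.≮⇒≥ a≮N) = ℕₚ.≤-trans (lo-mono z≤n) (ℕₚ.n≤1+n _)

  lo≤hi : ∀ {p q} → p + q ≤ N → lo q ≤ hi p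
  lo≤hi {p} {q} h rewrite hi-def p = lo-mono (ℕₚ.≤-trans (ℕₚ.≤-reflexive (sym (ℕₚ.m+n∸m≡n p q))) (ℕₚ.∸-monoˡ-≤ p h))

  hi-diag : ∀ {p q} → p + q ≡ N → hi p ≡ lo q
  hi-diag {p} {q} h = trans (hi-def p) (cong lo (trans (cong (_∸ p) (sym h)) (ℕₚ.m+n∸m≡n p q)))

  free⇒< : ∀ {p q} → Free p q → p + q < N
  free⇒< {p} {q} fr = ℕₚ.≰⇒> λ N≤ → ℕₚ.<⇒≱ fr (subst (_≤ lo q) (sym (hi-def p)) (lo-mono (ℕₚ.m≤n+o⇒m∸n≤o N p N≤)))

  free-down : ∀ {p q p′ q′} → p′ ≤ p → q′ ≤ q → Free p q → Free p′ q′
  free-down a b fr = ℕₚ.≤-<-trans (lo-mono b) (ℕₚ.<-≤-trans fr (hi-anti a))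

  cell-down : ∀ {p q p′ q′} → p′ ≤ p → q′ ≤ q → Cell p q → Cell p′ q′
  cell-down a b (x , y) = free-down (s≤s a) b x , free-down a (s≤s b) y

  free? : ∀ p q → Dec (Free p q)
  free? p q = lo q ℕₚ.<? hi p

  cell? : ∀ p q → Dec (Cell p q)
  cell? p q = free? (suc p) q ×-dec free? p (suc q)

  facet? : ∀ e → Dec (Facet e)
  facet? (V p zero)    = free? p 0
  facet? (V p (suc q)) = cell? p q
  facet? (H zero q)    = free? 0 q
  facet? (H (suc p) q) = cell? p q

  facet⇒free : ∀ e → Facet e → Free (row e) (col e)
  facet⇒free (V p zero)    f = f
  facet⇒free (V p (suc q)) f = proj₂ f
  facet⇒free (H zero q)    f = f
  facet⇒free (H (suc p) q) f = proj₁ f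

  V-facet : ∀ {p q} → Free p q → (∀ q′ → q ≡ suc q′ → Free (suc p) q′) → Facet (V p q)
  V-facet {q = zero}  fr h = fr
  V-facet {q = suc q} fr h = h q refl , fr

  H-facet : ∀ {p q} → Free p q → (∀ p′ → p ≡ suc p′ → Free p′ (suc q)) → Facet (H p q)
  H-facet {p = zero}  fr h = fr
  H-facet {p = suc p} fr h = fr , h p refl

  cell-V : ∀ {p q} → Cell p q → Facet (V p q)
  cell-V (a , b) = V-facet (free-down (ℕₚ.n≤1+n _) ℕₚ.≤-refl a) λ { q′ refl → free-down ℕₚ.≤-refl (ℕₚ.n≤1+n _) a }

  cell-H : ∀ {p q} → Cell p q → Facet (H p q)
  cell-H (a , b) = H-facet (free-down ℕₚ.≤-refl (ℕₚ.n≤1+n _) b) λ { p′ refl → free-down (ℕₚ.n≤1+n _) ℕₚ.≤-refl b }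

  -- A redundant vertical inequality either has both ends pinned to one value, or its lower end and
  -- the left neighbour of that end are pinned to the same value. In the second case it follows by
  -- going around the square on its left.
  V-cases : ∀ p q → p + q < N → Facet (V p q) ⊎ (lo q ≡ hi p × lo q ≡ hi (suc p)) ⊎
    Σ ℕ λ q′ → q ≡ suc q′ × lo q ≡ hi (suc p) × lo q′ ≡ hi (suc p) × Facet (H p q′)
  V-cases p q p+q<N with free? p q
  ... | no ¬fr = inj₂ (inj₁ (ℕₚ.≤-antisym (lo≤hi (ℕₚ.<⇒≤ p+q<N)) (ℕₚ.≮⇒≥ ¬fr) ,
                   ℕₚ.≤-antisym (lo≤hi p+q<N) (ℕₚ.≤-trans (hi-anti (ℕₚ.n≤1+n p)) (ℕₚ.≮⇒≥ ¬fr))))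
  V-cases p zero p+q<N | yes fr = inj₁ fr
  V-cases p (suc q) p+q<N | yes fr with free? (suc p) q
  ... | yes fr′ = inj₁ (fr′ , fr)
  ... | no ¬fr′ = inj₂ (inj₂ (q , refl ,
          ℕₚ.≤-antisym (lo≤hi p+q<N) (ℕₚ.≤-trans (ℕₚ.≮⇒≥ ¬fr′) (lo-mono (ℕₚ.n≤1+n q))) ,
          ℕₚ.≤-antisym (ℕₚ.≤-trans (lo-mono (ℕₚ.n≤1+n q)) (lo≤hi p+q<N)) (ℕₚ.≮⇒≥ ¬fr′) ,
          H-facet (free-down ℕₚ.≤-refl (ℕₚ.n≤1+n q) fr) λ { p′ refl → free-down (ℕₚ.n≤1+n _) ℕₚ.≤-refl fr }))

  H-cases : ∀ p q → p + q < N → Facet (H p q) ⊎ (lo q ≡ hi p × lo (suc q) ≡ hi p) ⊎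
    Σ ℕ λ p′ → p ≡ suc p′ × lo (suc q) ≡ hi p × lo (suc q) ≡ hi p′ × Facet (V p′ q)
  H-cases p q p+q<N with free? p q
  ... | no ¬fr = inj₂ (inj₁ (ℕₚ.≤-antisym (lo≤hi (ℕₚ.<⇒≤ p+q<N)) (ℕₚ.≮⇒≥ ¬fr) ,
                   ℕₚ.≤-antisym (lo≤hi (subst (_≤ N) (sym (ℕₚ.+-suc p q)) p+q<N)) (ℕₚ.≤-trans (ℕₚ.≮⇒≥ ¬fr) (lo-mono (ℕₚ.n≤1+n q)))))
  H-cases zero q p+q<N | yes fr = inj₁ fr
  H-cases (suc p) q p+q<N | yes fr with free? p (suc q)
  ... | yes fr′ = inj₁ (fr , fr′)
  ... | no ¬fr′ = inj₂ (inj₂ (p , refl ,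
          ℕₚ.≤-antisym le (ℕₚ.≤-trans (hi-anti (ℕₚ.n≤1+n p)) (ℕₚ.≮⇒≥ ¬fr′)) ,
          ℕₚ.≤-antisym (ℕₚ.≤-trans le (hi-anti (ℕₚ.n≤1+n p))) (ℕₚ.≮⇒≥ ¬fr′) ,
          V-facet (free-down (ℕₚ.n≤1+n p) ℕₚ.≤-refl fr) λ { q′ refl → free-down ℕₚ.≤-refl (ℕₚ.n≤1+n _) fr }))
    where le : lo (suc q) ≤ hi (suc p)
          le = lo≤hi (subst (_≤ N) (sym (ℕₚ.+-suc (suc p) q)) p+q<N)

  -- Monotonicity is demanded on facets only, so that a new point is checked only there. `V-mono`
  -- and `H-mono` recover the other inequalities.
  record IsPoint (X : Array ℚ) : Set where
    field
      fixed : ∀ p q → p + q ≤ N → lo q ≡ hi p → X p q ≡ ⟦ lo q ⟧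
      mono  : ∀ e → Facet e → src X e ℚ.≤ tgt X e
  open IsPoint public

  Face′ : Set
  Face′ = Σ (Array ℚ) IsPoint

  T : Face′ → Edge → Set
  T F = Tight (proj₁ F)

  T? : ∀ F e → Dec (T F e)
  T? (X , _) e = src X e ℚₚ.≟ tgt X e

  infix 4 _⊑_
  _⊑_ : Face′ → Face′ → Set
  F ⊑ G = ∀ e → Facet e → T G e → T F e

  module _ {X : Array ℚ} (pt : IsPoint X) where

    private
      fix-hi : ∀ p q → p + q ≤ N → lo q ≡ hi p → X p q ≡ ⟦ hi p ⟧
      fix-hi p q h e = trans (fixed pt p q h e) (cong ⟦_⟧ e)
      H-bound : ∀ p {q} → p + q < N → p + suc q ≤ N
      H-bound p {q} = subst (_≤ N) (sym (ℕₚ.+-suc p q))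

    V-mono : ∀ p q → p + q < N → X (suc p) q ℚ.≤ X p q
    V-mono p q h with V-cases p q h
    ... | inj₁ f = mono pt (V p q) f
    ... | inj₂ (inj₁ (a , b)) = ℚₚ.≤-reflexive (trans (fixed pt (suc p) q h b) (sym (fixed pt p q (ℕₚ.<⇒≤ h) a)))
    ... | inj₂ (inj₂ (q′ , refl , a , b , f)) = ℚₚ.≤-trans
          (ℚₚ.≤-reflexive (trans (fix-hi (suc p) (suc q′) h a) (sym (fix-hi (suc p) q′ h′ b))))
          (ℚₚ.≤-trans (V-mono p q′ h′) (mono pt (H p q′) f))
      where h′ = ℕₚ.≤-<-trans (ℕₚ.+-monoʳ-≤ p (ℕₚ.n≤1+n q′)) h

    H-mono : ∀ p q → p + q < N → X p q ℚ.≤ X p (suc q)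
    H-mono p q h with H-cases p q h
    ... | inj₁ f = mono pt (H p q) f
    ... | inj₂ (inj₁ (a , b)) = ℚₚ.≤-reflexive (trans (fix-hi p q (ℕₚ.<⇒≤ h) a) (sym (fix-hi p (suc q) (H-bound p h) b)))
    ... | inj₂ (inj₂ (p′ , refl , a , b , f)) = ℚₚ.≤-trans (mono pt (V p′ q) f) (ℚₚ.≤-trans (H-mono p′ q h′)
          (ℚₚ.≤-reflexive (trans (fixed pt p′ (suc q) (H-bound p′ h′) b) (sym (fixed pt (suc p′) (suc q) (H-bound (suc p′) h) a)))))
      where h′ = ℕₚ.<-trans (ℕₚ.n<1+n _) h

    lower : ∀ p q → p + q ≤ N → ⟦ lo q ⟧ ℚ.≤ X p q
    lower p q h = go (N ∸ (p + q)) p (trans (ℕₚ.+-comm (N ∸ (p + q)) (p + q)) (ℕₚ.m+[n∸m]≡n h))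
      where
      go : ∀ d p → d + (p + q) ≡ N → ⟦ lo q ⟧ ℚ.≤ X p q
      go zero p e = ℚₚ.≤-reflexive (sym (fixed pt p q (ℕₚ.≤-reflexive e) (sym (hi-diag e))))
      go (suc d) p e = ℚₚ.≤-trans (go d (suc p) (trans (ℕₚ.+-suc d (p + q)) e))
        (V-mono p q (ℕₚ.≤-trans (s≤s (ℕₚ.m≤n+m (p + q) d)) (ℕₚ.≤-reflexive e)))

    upper : ∀ p q → p + q ≤ N → X p q ℚ.≤ ⟦ hi p ⟧
    upper p q h = go (N ∸ (p + q)) q (trans (ℕₚ.+-comm (N ∸ (p + q)) (p + q)) (ℕₚ.m+[n∸m]≡n h))
      where
      go : ∀ d q → d + (p + q) ≡ N → X p q ℚ.≤ ⟦ hi p ⟧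
      go zero q e = ℚₚ.≤-reflexive (fix-hi p q (ℕₚ.≤-reflexive e) (sym (hi-diag e)))
      go (suc d) q e = ℚₚ.≤-trans (H-mono p q (ℕₚ.≤-trans (s≤s (ℕₚ.m≤n+m (p + q) d)) (ℕₚ.≤-reflexive e)))
        (go d (suc q) (trans (cong (d +_) (ℕₚ.+-suc p q)) (trans (ℕₚ.+-suc d (p + q)) e)))

  module _ {F G : Face′} (F⊑G : F ⊑ G) where

    private
      X = proj₁ F
      Y = proj₁ G
      sandwich : ∀ {x y z : ℚ} → x ℚ.≤ y → y ℚ.≤ z → x ≡ z → x ≡ y × y ≡ z
      sandwich a b refl = ℚₚ.≤-antisym a b , ℚₚ.≤-antisym b a

    -- The detours of `V-cases` again: if the redundant inequality is tight on `G`, the steps of its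
    -- detour are squeezed and tight too, and their tightness passes to `F`.
    V-tight : ∀ p q → p + q < N → T G (V p q) → T F (V p q)
    V-tight p q h t with V-cases p q h
    ... | inj₁ f = F⊑G (V p q) f t
    ... | inj₂ (inj₁ (a , b)) = trans (fixed (proj₂ F) (suc p) q h b) (sym (fixed (proj₂ F) p q (ℕₚ.<⇒≤ h) a))
    ... | inj₂ (inj₂ (q′ , refl , a , b , f)) =
          trans (same F) (trans (V-tight p q′ h′ (proj₁ sw)) (F⊑G (H p q′) f (proj₂ sw)))
      where
      h′ = ℕₚ.≤-<-trans (ℕₚ.+-monoʳ-≤ p (ℕₚ.n≤1+n q′)) h
      same : ∀ K → proj₁ K (suc p) (suc q′) ≡ proj₁ K (suc p) q′
      same K = trans (fixed (proj₂ K) (suc p) (suc q′) h a) (trans (cong ⟦_⟧ (trans a (sym b))) (sym (fixed (proj₂ K) (suc p) q′ h′ b)))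
      sw = sandwich (V-mono (proj₂ G) p q′ h′) (mono (proj₂ G) (H p q′) f) (trans (sym (same G)) t)

    H-tight : ∀ p q → p + q < N → T G (H p q) → T F (H p q)
    H-tight p q h t with H-cases p q h
    ... | inj₁ f = F⊑G (H p q) f t
    ... | inj₂ (inj₁ (a , b)) = trans (fixed (proj₂ F) p q (ℕₚ.<⇒≤ h) a) (trans (cong ⟦_⟧ (trans a (sym b)))
            (sym (fixed (proj₂ F) p (suc q) (subst (_≤ N) (sym (ℕₚ.+-suc p q)) h) b)))
    ... | inj₂ (inj₂ (p′ , refl , a , b , f)) =
          trans (F⊑G (V p′ q) f (proj₁ sw)) (trans (H-tight p′ q h′ (proj₂ sw)) (same F))
      where
      h′ = ℕₚ.<-trans (ℕₚ.n<1+n _) h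
      same : ∀ K → proj₁ K p′ (suc q) ≡ proj₁ K (suc p′) (suc q)
      same K = trans (fixed (proj₂ K) p′ (suc q) (subst (_≤ N) (sym (ℕₚ.+-suc p′ q)) h′) b)
        (sym (fixed (proj₂ K) (suc p′) (suc q) (subst (_≤ N) (sym (ℕₚ.+-suc (suc p′) q)) h) a))
      sw = sandwich (mono (proj₂ G) (V p′ q) f) (H-mono (proj₂ G) p′ q h′) (trans t (sym (same G)))

-- Points and separating lattice paths

-- A cell is a vertex of the dual graph, entered through its In edges and left through its Out edges:
-- the flows (differences of entries) through the two pairs have the same sum.
data In (p q : ℕ) : Edge → Edge → Set where
  vh : In p q (V p q) (H p q)
  hv : In p q (H p q) (V p q)

data Out (p q : ℕ) : Edge → Edge → Set where
  hv : Out p q (H (suc p) q) (V p (suc q))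
  vh : Out p q (V p (suc q)) (H (suc p) q)

module Points (S : Shape) where
  open Shape S
  open Poly S

  -- The boundary of `U` is a path from the outer vertex to the sink between `c` and `c + 1`. A
  -- point raised by one exactly on `U` at this level keeps its pinned entries because of `U-hi` and
  -- `U-lo`.
  record Upset (c : ℕ) : Set₁ where
    field
      U     : Array Set
      U?    : ∀ p q → Dec (U p q)
      U-V   : ∀ p q → U (suc p) q → U p q
      U-H   : ∀ p q → U p q → U p (suc q)
      U-hi  : ∀ p q → p + q ≤ N → lo q ≡ hi p → c < lo q → U p q
      U-lo  : ∀ p q → p + q ≤ N → lo q ≡ hi p → lo q ≤ c → ¬ U p q

    mono-U : ∀ e → src U e → tgt U e
    mono-U (V p q) = U-V p q
    mono-U (H p q) = U-H p q

    UB : Array Bool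
    UB p q = does (U? p q)

  Crosses : ∀ {c} → Upset c → Edge → Set
  Crosses W e = tgt (Upset.U W) e × ¬ src (Upset.U W) e

  Avoids : ∀ {c} → Upset c → Edge → Set
  Avoids W e = tgt (Upset.U W) e → src (Upset.U W) e

  private
    does-mono : {A B : Set} (a : Dec A) (b : Dec B) → (A → B) → does a ≡ true → does b ≡ true
    does-mono (yes a) b f _ = dec-true b (f a)
    does-mono (no _) b f ()

    srcUB : ∀ {c} (W : Upset c) e → Σ (Dec (src (Upset.U W) e)) λ d → src (Upset.UB W) e ≡ does d
    srcUB W (V p q) = Upset.U? W (suc p) q , refl
    srcUB W (H p q) = Upset.U? W p q , refl

    tgtUB : ∀ {c} (W : Upset c) e → Σ (Dec (tgt (Upset.U W) e)) λ d → tgt (Upset.UB W) e ≡ does d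
    tgtUB W (V p q) = Upset.U? W p q , refl
    tgtUB W (H p q) = Upset.U? W p (suc q) , refl

    UB-mono : ∀ {c} (W : Upset c) e → src (Upset.UB W) e ≡ true → tgt (Upset.UB W) e ≡ true
    UB-mono W e h with srcUB W e | tgtUB W e
    ... | d , s | d′ , t = trans t (does-mono d d′ (Upset.mono-U W e) (trans (sym s) h))

    UB-avoids : ∀ {c} (W : Upset c) e → Avoids W e → src (Upset.UB W) e ≡ tgt (Upset.UB W) e
    UB-avoids W e av with srcUB W e | tgtUB W e
    ... | yes a , s | d′ , t = trans s (sym (trans t (dec-true d′ (Upset.mono-U W e a))))
    ... | no ¬a , s | d′ , t = trans s (sym (trans t (dec-false d′ (¬a ∘ av))))

    UB-crosses : ∀ {c} (W : Upset c) e → Crosses W e → src (Upset.UB W) e ≢ tgt (Upset.UB W) e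
    UB-crosses W e (a , b) h with srcUB W e | tgtUB W e
    ... | d , s | d′ , t with trans (sym (dec-false d b)) (trans (sym s) (trans h (trans t (dec-true d′ a))))
    ...   | ()

  zipArray : ∀ {A B C : Set} → (A → B → C) → Array A → Array B → Array C
  zipArray f X Y p q = f (X p q) (Y p q)

  src-zip : ∀ {A B C : Set} (f : A → B → C) X Y e → src (zipArray f X Y) e ≡ f (src X e) (src Y e)
  src-zip f X Y (V p q) = refl
  src-zip f X Y (H p q) = refl

  tgt-zip : ∀ {A B C : Set} (f : A → B → C) X Y e → tgt (zipArray f X Y) e ≡ f (tgt X e) (tgt Y e)
  tgt-zip f X Y (V p q) = refl
  tgt-zip f X Y (H p q) = refl

  module _ (F G : Face′) where
    private
      X = proj₁ F
      Y = proj₁ G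

    -- A point in the relative interior of the smallest face that contains both: it is tight exactly
    -- where both points are.
    mid : Face′
    mid = zipArray avg X Y , record
      { fixed = λ p q h e → trans (cong₂ avg (fixed (proj₂ F) p q h e) (fixed (proj₂ G) p q h e)) (avg-idem _)
      ; mono  = λ e f → subst₂ ℚ._≤_ (sym (src-zip avg X Y e)) (sym (tgt-zip avg X Y e))
                  (avg-mono (mono (proj₂ F) e f) (mono (proj₂ G) e f)) }

    mid-T : ∀ e → T F e → T G e → T mid e
    mid-T e s t = trans (src-zip avg X Y e) (trans (cong₂ avg s t) (sym (tgt-zip avg X Y e)))

    mid-T⁻ : ∀ e → Facet e → T mid e → T F e × T G e
    mid-T⁻ e f t = avg-tight (mono (proj₂ F) e f) (mono (proj₂ G) e f)
      (trans (sym (src-zip avg X Y e)) (trans t (tgt-zip avg X Y e)))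

    blend : ℕ → Face′
    blend c = zipArray (glue c) X Y , record
      { fixed = λ p q h e → trans (cong₂ (glue c) (fixed (proj₂ F) p q h e) (fixed (proj₂ G) p q h e)) (glue-diag c _)
      ; mono  = λ e f → subst₂ ℚ._≤_ (sym (src-zip (glue c) X Y e)) (sym (tgt-zip (glue c) X Y e))
                  (glue-mono c (mono (proj₂ F) e f) (mono (proj₂ G) e f)) }

    blend-T : ∀ c e → glue c (src X e) (src Y e) ≡ glue c (tgt X e) (tgt Y e) → T (blend c) e
    blend-T c e h = trans (src-zip (glue c) X Y e) (trans h (sym (tgt-zip (glue c) X Y e)))

    module _ {c : ℕ} (W : Upset c) where
      open Upset W

      private
        Z : Array ℚ
        Z p q = splice (X p q) c (UB p q) (Y p q)

        src-Z : ∀ e → src Z e ≡ splice (src X e) c (src UB e) (src Y e)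
        src-Z (V p q) = refl
        src-Z (H p q) = refl

        tgt-Z : ∀ e → tgt Z e ≡ splice (tgt X e) c (tgt UB e) (tgt Y e)
        tgt-Z (V p q) = refl
        tgt-Z (H p q) = refl

        Z-fixed : ∀ p q → p + q ≤ N → lo q ≡ hi p → Z p q ≡ ⟦ lo q ⟧
        Z-fixed p q h e rewrite fixed (proj₂ F) p q h e | fixed (proj₂ G) p q h e with c ℕₚ.<? lo q
        ... | yes c<lo rewrite dec-true (U? p q) (U-hi p q h e c<lo) = splice-high c<lo
        ... | no c≮lo rewrite dec-false (U? p q) (U-lo p q h e (ℕₚ.≮⇒≥ c≮lo)) = splice-low (ℕₚ.≮⇒≥ c≮lo)

      spliced : Face′
      spliced = Z , record
        { fixed = Z-fixed
        ; mono  = λ e f → subst₂ ℚ._≤_ (sym (src-Z e)) (sym (tgt-Z e))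
                    (splice-mono c (mono (proj₂ F) e f) (UB-mono W e) (mono (proj₂ G) e f)) }

      spliced-T : ∀ e → src X e ⊓ ⟦ c ⟧ ≡ tgt X e ⊓ ⟦ c ⟧ → Avoids W e →
        src Y e ⊔ ⟦ suc c ⟧ ≡ tgt Y e ⊔ ⟦ suc c ⟧ → T spliced e
      spliced-T e a b d = trans (src-Z e) (trans (splice-cong {src X e} {tgt X e} {y = src Y e} {y′ = tgt Y e} c a (UB-avoids W e b) d) (sym (tgt-Z e)))

      spliced-¬T : ∀ e → Facet e → Crosses W e → ¬ T spliced e
      spliced-¬T e f cr t = UB-crosses W e cr
        (splice-bit c (mono (proj₂ F) e f) (UB-mono W e) (mono (proj₂ G) e f) (trans (sym (src-Z e)) (trans t (tgt-Z e))))

  -- Only what `F` has strictly between `c` and `c + 1` is rerouted along `W`. Hence a tight facet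
  -- stays tight if the path avoids it, and every facet crossed by the path becomes slack.
  cut : ∀ {c} → Face′ → Upset c → Face′
  cut F W = spliced F F W

  cut-T : ∀ {c} F (W : Upset c) e → T F e → Avoids W e → T (cut F W) e
  cut-T {c} F W e t a = spliced-T F F W e (cong (_⊓ ⟦ c ⟧) t) a (cong (_⊔ ⟦ suc c ⟧) t)

  ℕ-point : (X : Array ℕ) → (∀ p q → lo q ≡ hi p → X p q ≡ lo q) → (∀ p q → X (suc p) q ≤ X p q) →
    (∀ p q → X p q ≤ X p (suc q)) → Face′
  ℕ-point X fx mv mh = (λ p q → ⟦ X p q ⟧) , record
    { fixed = λ p q _ e → cong ⟦_⟧ (fx p q e)
    ; mono  = λ { (V p q) _ → ⟦⟧-mono (mv p q) ; (H p q) _ → ⟦⟧-mono (mh p q) } }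

  -- The first lies on all vertical facets and the second on all horizontal ones, which gives a
  -- point on every facet.
  loPt hiPt : Face′
  loPt = ℕ-point (λ p q → lo q) (λ _ _ _ → refl) (λ _ _ → ℕₚ.≤-refl) (λ p q → lo-mono (ℕₚ.n≤1+n q))
  hiPt = ℕ-point (λ p q → hi p) (λ _ _ e → sym e) (λ p q → hi-anti (ℕₚ.n≤1+n p)) (λ _ _ → ℕₚ.≤-refl)

  -- The value c truncated to the admissible range of each position.
  constPt : ℕ → Face′
  constPt c = ℕ-point (λ p q → lo q ℕ.⊔ (hi p ℕ.⊓ c))
    (λ p q e → trans (cong (λ h → lo q ℕ.⊔ (h ℕ.⊓ c)) (sym e)) (ℕₚ.⊔-absorbs-⊓ (lo q) c))
    (λ p q → ℕₚ.⊔-monoʳ-≤ (lo q) (ℕₚ.⊓-monoˡ-≤ c (hi-anti (ℕₚ.n≤1+n p))))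
    (λ p q → ℕₚ.⊔-monoˡ-≤ (hi p ℕ.⊓ c) (lo-mono (ℕₚ.n≤1+n q)))

  -- One step up or to the right exhausts the range of the position, and such a step changes a bound
  -- by at most one. So only one unit is left, and every path through the position ends in the same
  -- sink.
  thin : ∀ {p q} → Free p q → ¬ Cell p q → hi p ≡ suc (lo q)
  thin {p} {q} fr ¬cell with free? (suc p) q
  ... | no ¬a = ℕₚ.≤-antisym (ℕₚ.≤-trans (hi-step p) (s≤s (ℕₚ.≮⇒≥ ¬a))) fr
  ... | yes a with free? p (suc q)
  ...   | yes b = ⊥-elim (¬cell (a , b))
  ...   | no ¬b = ℕₚ.≤-antisym (ℕₚ.≤-trans (ℕₚ.≮⇒≥ ¬b) (lo-step q)) fr

  -- Upsets correspond to lattice paths in the dual graph.  Those below leave the region through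
  -- the edge H p q (resp. V p q), the only facet they cross beyond it.
  module _ {p q : ℕ} (fr : Free p q) (¬cell : ¬ Cell p q) where

    private
      c : ℕ
      c = lo q
      hi≡ : hi p ≡ suc c
      hi≡ = thin fr ¬cell

    sinkH : Upset c
    sinkH = record
      { U    = λ p′ q′ → q < q′ × (p′ < p ⊎ c < hi p′)
      ; U?   = λ p′ q′ → (q ℕₚ.<? q′) ×-dec ((p′ ℕₚ.<? p) ⊎-dec (c ℕₚ.<? hi p′))
      ; U-V  = λ { p′ q′ (a , inj₁ b) → a , inj₁ (ℕₚ.<-trans (ℕₚ.n<1+n p′) b)
                 ; p′ q′ (a , inj₂ b) → a , inj₂ (ℕₚ.<-≤-trans b (hi-anti (ℕₚ.n≤1+n p′))) }
      ; U-H  = λ { p′ q′ (a , b) → ℕₚ.m<n⇒m<1+n a , b }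
      ; U-hi = λ p′ q′ _ e c< → ℕₚ.≰⇒> (λ q′≤q → ℕₚ.<⇒≱ c< (lo-mono q′≤q)) , inj₂ (subst (c <_) e c<)
      ; U-lo = λ { p′ q′ _ e ≤c (a , inj₁ b) → ℕₚ.<⇒≱ fr (ℕₚ.≤-trans (hi-anti (ℕₚ.<⇒≤ b)) (subst (_≤ c) e ≤c))
                 ; p′ q′ _ e ≤c (a , inj₂ b) → ℕₚ.<⇒≱ b (subst (_≤ c) e ≤c) } }

    sinkH-crosses : Crosses sinkH (H p q)
    sinkH-crosses = (ℕₚ.n<1+n q , inj₂ fr) , λ x → ℕₚ.<-irrefl refl (proj₁ x)

    sinkH-V : ∀ p′ q′ → Facet (V p′ q′) → Avoids sinkH (V p′ q′)
    sinkH-V p′ zero f (() , _)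
    sinkH-V p′ (suc q′) f (a , b) with c ℕₚ.<? hi (suc p′)
    ... | yes y = a , inj₂ y
    ... | no n = ⊥-elim (n (ℕₚ.≤-<-trans (lo-mono (ℕₚ.≤-pred a)) (proj₁ f)))

    sinkH-H : ∀ p′ q′ → p ≤ p′ → Facet (H p′ q′) → H p′ q′ ≢ H p q → Avoids sinkH (H p′ q′)
    sinkH-H p′ q′ p≤ f ne (a , b) with q ℕ.≟ q′
    ... | no q≢ = ℕₚ.≤∧≢⇒< (ℕₚ.≤-pred a) q≢ , b
    ... | yes refl with p ℕ.≟ p′
    ...   | yes refl = ⊥-elim (ne refl)
    sinkH-H zero q′ z≤n f ne (a , b) | yes refl | no p≢ = ⊥-elim (p≢ refl)
    sinkH-H (suc p′) q′ p≤ (f₁ , f₂) ne (a , b) | yes refl | no p≢ = ⊥-elim (¬cell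
      ( ℕₚ.<-≤-trans f₁ (hi-anti (ℕₚ.≤∧≢⇒< p≤ p≢))
      , ℕₚ.<-≤-trans f₂ (hi-anti (ℕₚ.≤-pred (ℕₚ.≤∧≢⇒< p≤ p≢)))))

    sinkV : Upset c
    sinkV = record
      { U    = λ p′ q′ → q ≤ q′ × (p′ ≤ p ⊎ c < lo q′)
      ; U?   = λ p′ q′ → (q ℕₚ.≤? q′) ×-dec ((p′ ℕₚ.≤? p) ⊎-dec (c ℕₚ.<? lo q′))
      ; U-V  = λ { p′ q′ (a , inj₁ b) → a , inj₁ (ℕₚ.≤-trans (ℕₚ.n≤1+n p′) b)
                 ; p′ q′ (a , inj₂ b) → a , inj₂ b }
      ; U-H  = λ { p′ q′ (a , inj₁ b) → ℕₚ.m≤n⇒m≤1+n a , inj₁ b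
                 ; p′ q′ (a , inj₂ b) → ℕₚ.m≤n⇒m≤1+n a , inj₂ (ℕₚ.<-≤-trans b (lo-mono (ℕₚ.n≤1+n q′))) }
      ; U-hi = λ p′ q′ _ e c< → ℕₚ.<⇒≤ (ℕₚ.≰⇒> (λ q′≤q → ℕₚ.<⇒≱ c< (lo-mono q′≤q))) , inj₂ c<
      ; U-lo = λ { p′ q′ _ e ≤c (a , inj₁ b) → ℕₚ.<⇒≱ fr (ℕₚ.≤-trans (hi-anti b) (subst (_≤ c) e ≤c))
                 ; p′ q′ _ e ≤c (a , inj₂ b) → ℕₚ.<⇒≱ b ≤c } }

    sinkV-crosses : Crosses sinkV (V p q)
    sinkV-crosses = (ℕₚ.≤-refl , inj₁ ℕₚ.≤-refl) ,
      λ { (_ , inj₁ x) → ℕₚ.<-irrefl refl x ; (_ , inj₂ x) → ℕₚ.<-irrefl refl x }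

    sinkV-V : ∀ p′ q′ → Facet (V p′ q′) → V p′ q′ ≢ V p q → Avoids sinkV (V p′ q′)
    sinkV-V p′ q′ f ne (a , inj₂ b) = a , inj₂ b
    sinkV-V p′ q′ f ne (a , inj₁ b) with c ℕₚ.<? lo q′
    ... | yes y = a , inj₂ y
    ... | no n with p′ ℕ.≟ p
    ...   | no p≢ = a , inj₁ (ℕₚ.≤∧≢⇒< b p≢)
    ...   | yes refl with q ℕ.≟ q′
    ...     | yes refl = ⊥-elim (ne refl)
    sinkV-V p′ zero f ne (z≤n , inj₁ b) | no n | yes refl | no q≢ = ⊥-elim (q≢ refl)
    sinkV-V p′ (suc q′) (f₁ , f₂) ne (a , inj₁ b) | no n | yes refl | no q≢ = ⊥-elim (¬cell
      ( ℕₚ.≤-<-trans (lo-mono (ℕₚ.≤-pred (ℕₚ.≤∧≢⇒< a q≢))) f₁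
      , ℕₚ.≤-<-trans (lo-mono (ℕₚ.≤∧≢⇒< a q≢)) f₂))

    sinkV-H : ∀ p′ q′ → p < p′ ⊎ q ≤ q′ → Facet (H p′ q′) → Avoids sinkV (H p′ q′)
    sinkV-H p′ q′ pq f (a , b) with p′ ℕₚ.≤? p | pq
    ... | yes y | inj₁ x = ⊥-elim (ℕₚ.<⇒≱ x y)
    ... | yes y | inj₂ x = x , inj₁ y
    sinkV-H p′ q′ pq f (a , inj₁ b) | no n | _ = ⊥-elim (n b)
    sinkV-H zero q′ pq f (a , inj₂ b) | no n | _ = ⊥-elim (n z≤n)
    sinkV-H (suc p′) q′ pq (f₁ , f₂) (a , inj₂ b) | no n | _ = ⊥-elim (ℕₚ.<⇒≱ f₂
      (ℕₚ.≤-trans (hi-anti (ℕₚ.≤-pred (ℕₚ.≰⇒> n))) (ℕₚ.≤-trans (ℕₚ.≤-reflexive hi≡) b)))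

-- Lattice paths that avoid two given edges

module Paths (S : Shape) (Bad : Edge → Set) (bad? : ∀ e → Dec (Bad e))
  (two : ∀ {x y z} → Bad x → Bad y → Bad z → x ≢ y → y ≢ z → x ≢ z → ⊥) where
  open Shape S
  open Poly S
  open Points S

  InRect Beyond : ℕ → ℕ → Edge → Set
  InRect p q x = row x ≤ p × col x ≤ q
  Beyond p q (V p′ q′) = p ≤ p′ × q < q′
  Beyond p q (H p′ q′) = p < p′ × q ≤ q′

  -- Initial part of a lattice path, from the outer vertex to the vertex of cell (p , q).
  record Back (p q : ℕ) : Set₁ where
    field
      B     : Array Set
      B?    : ∀ p q → Dec (B p q)
      B-V   : ∀ p′ q′ → B (suc p′) q′ → B p′ q′
      B-H   : ∀ p′ q′ → B p′ q′ → B p′ (suc q′)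
      right : ∀ p′ q′ → p′ ≤ p → q < q′ → B p′ q′
      up    : ∀ p′ q′ → p < p′ → q′ ≤ q → ¬ B p′ q′
      avoid : ∀ x → Bad x → InRect p q x → tgt B x → src B x

  -- Final part of a lattice path, from the vertex of cell (p , q) to a sink.
  record Forth (p q : ℕ) : Set₁ where
    field
      c     : ℕ
      lo≤c  : lo q ≤ c
      c<hi  : c < hi p
      B     : Array Set
      B?    : ∀ p q → Dec (B p q)
      B-V   : ∀ p′ q′ → B (suc p′) q′ → B p′ q′
      B-H   : ∀ p′ q′ → B p′ q′ → B p′ (suc q′)
      right : ∀ p′ q′ → p′ ≤ p → q < q′ → B p′ q′
      up    : ∀ p′ q′ → p < p′ → q′ ≤ q → ¬ B p′ q′
      B-hi  : ∀ p′ q′ → p < p′ → p′ + q′ ≤ N → lo q′ ≡ hi p′ → c < lo q′ → B p′ q′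
      B-lo  : ∀ p′ q′ → p < p′ → p′ + q′ ≤ N → lo q′ ≡ hi p′ → lo q′ ≤ c → ¬ B p′ q′
      avoid : ∀ x → Facet x → Bad x → Beyond p q x → tgt B x → src B x

  fromV : ∀ p → ¬ Bad (V p 0) → Σ (Back p 0) λ b → Back.B b p 0
  fromV p ok = record
    { B = λ p′ q′ → p′ ≤ p ; B? = λ p′ q′ → p′ ℕₚ.≤? p
    ; B-V = λ p′ q′ → ℕₚ.≤-trans (ℕₚ.n≤1+n p′) ; B-H = λ p′ q′ b → b
    ; right = λ p′ q′ a b → a ; up = λ p′ q′ a b → ℕₚ.<⇒≱ a
    ; avoid = λ { (H _ _) _ _ b → b
                ; (V p′ zero) bad (x , y) b → ℕₚ.≤∧≢⇒< b λ { refl → ok bad } } } , ℕₚ.≤-refl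

  fromH : ∀ q → ¬ Bad (H 0 q) → Σ (Back 0 q) λ b → ¬ Back.B b 0 q
  fromH q ok = record
    { B = λ p′ q′ → q < q′ ; B? = λ p′ q′ → q ℕₚ.<? q′
    ; B-V = λ p′ q′ b → b ; B-H = λ p′ q′ → ℕₚ.m<n⇒m<1+n
    ; right = λ p′ q′ a b → b ; up = λ p′ q′ a b → ℕₚ.≤⇒≯ b
    ; avoid = λ { (V _ _) _ _ b → b
                ; (H zero q′) bad (x , y) b → ℕₚ.≤∧≢⇒< (ℕₚ.≤-pred b) λ { refl → ok bad } } } , ℕₚ.<-irrefl refl

  -- Removing everything above row `p` from the columns up to `q + 1` makes the path leave the cell
  -- (p , q) to the right, across `V p (suc q)`.
  leftStep : ∀ {p q} → Back p q → ¬ Bad (V p (suc q)) → Σ (Back p (suc q)) λ b → Back.B b p (suc q)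
  leftStep {p} {q} b ok = record
    { B = λ p′ q′ → B p′ q′ × (p′ ≤ p ⊎ suc q < q′)
    ; B? = λ p′ q′ → B? p′ q′ ×-dec ((p′ ℕₚ.≤? p) ⊎-dec (suc q ℕₚ.<? q′))
    ; B-V = λ { p′ q′ (x , inj₁ y) → B-V p′ q′ x , inj₁ (ℕₚ.≤-trans (ℕₚ.n≤1+n p′) y)
              ; p′ q′ (x , inj₂ y) → B-V p′ q′ x , inj₂ y }
    ; B-H = λ { p′ q′ (x , inj₁ y) → B-H p′ q′ x , inj₁ y
              ; p′ q′ (x , inj₂ y) → B-H p′ q′ x , inj₂ (ℕₚ.m<n⇒m<1+n y) }
    ; right = λ p′ q′ x y → right p′ q′ x (ℕₚ.<-trans (ℕₚ.n<1+n q) y) , inj₁ x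
    ; up = λ { p′ q′ x y (_ , inj₁ z) → ℕₚ.<⇒≱ x z ; p′ q′ x y (_ , inj₂ z) → ℕₚ.≤⇒≯ y z }
    ; avoid = av } , (right p (suc q) ℕₚ.≤-refl ℕₚ.≤-refl , inj₁ ℕₚ.≤-refl)
    where
    open Back b
    B″ : Array Set
    B″ p′ q′ = B p′ q′ × (p′ ≤ p ⊎ suc q < q′)
    av : ∀ x → Bad x → InRect p (suc q) x → tgt B″ x → src B″ x
    av (V p′ q′) bad (x , y) (t , _) with q′ ℕₚ.≤? q
    ... | yes z with p′ ℕ.≟ p
    ...   | yes refl = ⊥-elim (up (suc p) q′ ℕₚ.≤-refl z (avoid (V p q′) bad (x , z) t))
    ...   | no p≢ = avoid (V p′ q′) bad (x , z) t , inj₁ (ℕₚ.≤∧≢⇒< x p≢)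
    av (V p′ q′) bad (x , y) (t , _) | no z with ℕₚ.≤-antisym y (ℕₚ.≰⇒> z) | p′ ℕ.≟ p
    ... | refl | yes refl = ⊥-elim (ok bad)
    ... | refl | no p≢ = right (suc p′) (suc q) (ℕₚ.≤∧≢⇒< x p≢) ℕₚ.≤-refl , inj₁ (ℕₚ.≤∧≢⇒< x p≢)
    av (H p′ q′) bad (x , y) (t , _) with q′ ℕₚ.≤? q
    ... | yes z = avoid (H p′ q′) bad (x , z) t , inj₁ x
    ... | no z = right p′ q′ x (ℕₚ.≰⇒> z) , inj₁ x

  downStep : ∀ {p q} → Back p q → ¬ Bad (H (suc p) q) → Σ (Back (suc p) q) λ b → ¬ Back.B b (suc p) q
  downStep {p} {q} b ok = record
    { B = B″
    ; B? = λ p′ q′ → B? p′ q′ ⊎-dec ((p′ ℕₚ.≤? suc p) ×-dec (q ℕₚ.<? q′))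
    ; B-V = λ { p′ q′ (inj₁ x) → inj₁ (B-V p′ q′ x)
              ; p′ q′ (inj₂ (x , y)) → inj₂ (ℕₚ.≤-trans (ℕₚ.n≤1+n p′) x , y) }
    ; B-H = λ { p′ q′ (inj₁ x) → inj₁ (B-H p′ q′ x)
              ; p′ q′ (inj₂ (x , y)) → inj₂ (x , ℕₚ.m<n⇒m<1+n y) }
    ; right = λ p′ q′ x y → inj₂ (x , y)
    ; up = λ { p′ q′ x y (inj₁ z) → up p′ q′ (ℕₚ.<-trans (ℕₚ.n<1+n p) x) y z
             ; p′ q′ x y (inj₂ (_ , z)) → ℕₚ.≤⇒≯ y z }
    ; avoid = av } , λ { (inj₁ z) → up (suc p) q ℕₚ.≤-refl ℕₚ.≤-refl z ; (inj₂ (_ , z)) → ℕₚ.<-irrefl refl z }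
    where
    open Back b
    B″ : Array Set
    B″ p′ q′ = B p′ q′ ⊎ (p′ ≤ suc p × q < q′)
    av : ∀ x → Bad x → InRect (suc p) q x → tgt B″ x → src B″ x
    av (H p′ q′) bad (x , y) t with p′ ℕₚ.≤? p
    av (H p′ q′) bad (x , y) (inj₁ t) | yes z = inj₁ (avoid (H p′ q′) bad (z , y) t)
    av (H p′ q′) bad (x , y) (inj₂ (_ , t)) | yes z = inj₁ (avoid (H p′ q′) bad (z , y) (right p′ (suc q′) z t))
    av (H p′ q′) bad (x , y) t | no z with ℕₚ.≤-antisym x (ℕₚ.≰⇒> z) | q′ ℕ.≟ q
    ... | refl | yes refl = ⊥-elim (ok bad)
    av (H p′ q′) bad (x , y) (inj₁ t) | no z | refl | no q≢ = ⊥-elim (up (suc p) (suc q′) ℕₚ.≤-refl (ℕₚ.≤∧≢⇒< y q≢) t)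
    av (H p′ q′) bad (x , y) (inj₂ (_ , t)) | no z | refl | no q≢ = ⊥-elim (ℕₚ.<⇒≱ (ℕₚ.≤∧≢⇒< y q≢) (ℕₚ.≤-pred t))
    av (V p′ q′) bad (x , y) (inj₂ (_ , t)) = ⊥-elim (ℕₚ.<⇒≱ t y)
    av (V p′ q′) bad (x , y) (inj₁ t) with p′ ℕₚ.≤? p
    ... | yes z = inj₁ (avoid (V p′ q′) bad (z , y) t)
    ... | no z = ⊥-elim (up p′ q′ (ℕₚ.≰⇒> z) y t)

  H≢ : ∀ {p q p′ q′} → q ≢ q′ → H p q ≢ H p′ q′
  H≢ n refl = n refl

  V≢ʳ : ∀ {p q p′ q′} → p ≢ p′ → V p q ≢ V p′ q′
  V≢ʳ n refl = n refl

  H≢ʳ : ∀ {p q p′ q′} → p ≢ p′ → H p q ≢ H p′ q′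
  H≢ʳ n refl = n refl

  BadIn BadOut : ℕ → ℕ → Set
  BadIn p q = Bad (V p q) × Bad (H p q)
  BadOut p q = Bad (H (suc p) q) × Bad (V p (suc q))

  private
    back₀ : ∀ p → (¬ BadIn p 0 → Back p 0) → ¬ BadIn (suc p) 0 → Back (suc p) 0
    back₀ p rec ok with bad? (V (suc p) 0)
    ... | no a = proj₁ (fromV (suc p) a)
    ... | yes a = proj₁ (downStep (rec λ { (x , y) → two a x y (V≢ʳ (λ ())) (λ ()) (λ ()) }) (λ b → ok (a , b)))

    back₁ : ∀ q → (¬ BadIn 0 q → Back 0 q) → ¬ BadIn 0 (suc q) → Back 0 (suc q)
    back₁ q rec ok with bad? (H 0 (suc q))
    ... | no a = proj₁ (fromH (suc q) a)
    ... | yes a = proj₁ (leftStep (rec λ { (x , y) → two a x y (λ ()) (λ ()) (H≢ (λ ())) }) (λ b → ok (b , a)))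

    back₂ : ∀ p q → (¬ BadIn p (suc q) → Back p (suc q)) → (¬ BadIn (suc p) q → Back (suc p) q) →
      ¬ BadIn (suc p) (suc q) → Back (suc p) (suc q)
    back₂ p q recH recV ok with bad? (V (suc p) (suc q)) | bad? (H (suc p) (suc q)) | bad? (V (suc p) q) ×-dec bad? (H (suc p) q)
    ... | yes a | yes b | _ = ⊥-elim (ok (a , b))
    ... | yes a | no b | _ = proj₁ (downStep (recH λ { (x , y) → two a x y (V≢ʳ (λ ())) (λ ()) (λ ()) }) b)
    ... | no a | _ | no d = proj₁ (leftStep (recV d) a)
    ... | no a | yes b | yes (x , y) = ⊥-elim (two b x y (λ ()) (λ ()) (H≢ (λ ())))
    ... | no a | no b | yes (x , y) = proj₁ (downStep (recH λ { (z , w) → two x z w (V≢ʳ (λ ())) (λ ()) (λ ()) }) b)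

  -- A dead end needs three bad edges: a bad in-edge next to a predecessor with two bad in-edges, or
  -- two such predecessors. By `two` there are at most two.
  back : ∀ p q → ¬ BadIn p q → Back p q
  back zero zero ok with bad? (V 0 0) | bad? (H 0 0)
  ... | no a  | _     = proj₁ (fromV 0 a)
  ... | yes _ | no b  = proj₁ (fromH 0 b)
  ... | yes a | yes b = ⊥-elim (ok (a , b))
  back (suc p) zero    = back₀ p (back p zero)
  back zero (suc q)    = back₁ q (back zero q)
  back (suc p) (suc q) = back₂ p q (back p (suc q)) (back (suc p) q)

  private
    -- Forces the start of the path at the cell: up to row `p` the set consists of the columns right
    -- of `q`, and above it nothing up to column `q` remains.
    norm : ℕ → ℕ → Array Set → Array Set
    norm p q U p′ q′ = q < q′ × (p′ ≤ p ⊎ U p′ q′)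

  module _ {p q : ℕ} {U : Array Set} (U? : ∀ p q → Dec (U p q))
    (U-V : ∀ p′ q′ → U (suc p′) q′ → U p′ q′) (U-H : ∀ p′ q′ → U p′ q′ → U p′ (suc q′))
    (c : ℕ) (lo≤c : lo q ≤ c) (c<hi : c < hi p)
    (U-hi : ∀ p′ q′ → p < p′ → q < q′ → p′ + q′ ≤ N → lo q′ ≡ hi p′ → c < lo q′ → U p′ q′)
    (U-lo : ∀ p′ q′ → p < p′ → q < q′ → p′ + q′ ≤ N → lo q′ ≡ hi p′ → lo q′ ≤ c → ¬ U p′ q′)
    (av : ∀ x → Facet x → Bad x → Beyond p q x → tgt (norm p q U) x → src (norm p q U) x) where

    normalised : Forth p q
    normalised = record
      { c = c ; lo≤c = lo≤c ; c<hi = c<hi ; B = norm p q U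
      ; B? = λ p′ q′ → (q ℕₚ.<? q′) ×-dec ((p′ ℕₚ.≤? p) ⊎-dec U? p′ q′)
      ; B-V = λ { p′ q′ (a , inj₁ b) → a , inj₁ (ℕₚ.≤-trans (ℕₚ.n≤1+n p′) b)
                ; p′ q′ (a , inj₂ b) → a , inj₂ (U-V p′ q′ b) }
      ; B-H = λ { p′ q′ (a , inj₁ b) → ℕₚ.m<n⇒m<1+n a , inj₁ b
                ; p′ q′ (a , inj₂ b) → ℕₚ.m<n⇒m<1+n a , inj₂ (U-H p′ q′ b) }
      ; right = λ p′ q′ a b → b , inj₁ a
      ; up = λ p′ q′ a b z → ℕₚ.≤⇒≯ b (proj₁ z)
      ; B-hi = λ p′ q′ x h e c< → let q<q′ = ℕₚ.≰⇒> (λ q′≤q → ℕₚ.<⇒≱ c< (ℕₚ.≤-trans (lo-mono q′≤q) lo≤c)) in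
                 q<q′ , inj₂ (U-hi p′ q′ x q<q′ h e c<)
      ; B-lo = λ { p′ q′ x h e ≤c (a , inj₁ b) → ℕₚ.<⇒≱ x b
                 ; p′ q′ x h e ≤c (a , inj₂ b) → U-lo p′ q′ x a h e ≤c b }
      ; avoid = av }

  upStep : ∀ {p q} → Cell p q → Forth (suc p) q → ¬ Bad (H (suc p) q) → Forth p q
  upStep {p} {q} cell f ok = normalised B? B-V B-H c lo≤c (ℕₚ.<-≤-trans c<hi (hi-anti (ℕₚ.n≤1+n p))) bhi blo av
    where
    open Forth f
    bhi : ∀ p′ q′ → p < p′ → q < q′ → p′ + q′ ≤ N → lo q′ ≡ hi p′ → c < lo q′ → B p′ q′
    bhi p′ q′ x y h e c< with suc p ℕ.≟ p′
    ... | yes refl = right (suc p) q′ ℕₚ.≤-refl y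
    ... | no n = B-hi p′ q′ (ℕₚ.≤∧≢⇒< x n) h e c<
    blo : ∀ p′ q′ → p < p′ → q < q′ → p′ + q′ ≤ N → lo q′ ≡ hi p′ → lo q′ ≤ c → ¬ B p′ q′
    blo p′ q′ x y h e ≤c with suc p ℕ.≟ p′
    ... | yes refl = λ _ → ℕₚ.<⇒≱ c<hi (subst (_≤ c) e ≤c)
    ... | no n = B-lo p′ q′ (ℕₚ.≤∧≢⇒< x n) h e ≤c
    av : ∀ x → Facet x → Bad x → Beyond p q x → tgt (norm p q B) x → src (norm p q B) x
    av (V p′ q′) fx bad (x , y) (a , t) with p ℕ.≟ p′
    ... | yes refl = a , inj₂ (right (suc p) q′ ℕₚ.≤-refl y)
    av (V p′ q′) fx bad (x , y) (a , inj₁ t) | no n = ⊥-elim (n (ℕₚ.≤-antisym x t))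
    av (V p′ q′) fx bad (x , y) (a , inj₂ t) | no n = a , inj₂ (avoid (V p′ q′) fx bad (ℕₚ.≤∧≢⇒< x n , y) t)
    av (H p′ q′) fx bad (x , y) (a , inj₁ t) = ⊥-elim (ℕₚ.<⇒≱ x t)
    av (H p′ q′) fx bad (x , y) (a , inj₂ t) with suc p ℕ.≟ p′ | q ℕ.≟ q′
    ... | yes refl | yes refl = ⊥-elim (ok bad)
    ... | yes refl | no n = ℕₚ.≤∧≢⇒< y n , inj₂ (right (suc p) q′ ℕₚ.≤-refl (ℕₚ.≤∧≢⇒< y n))
    ... | no n | yes refl = ⊥-elim (up p′ q (ℕₚ.≤∧≢⇒< x n) ℕₚ.≤-refl (avoid (H p′ q′) fx bad (ℕₚ.≤∧≢⇒< x n , y) t))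
    ... | no n | no m = ℕₚ.≤∧≢⇒< y m , inj₂ (avoid (H p′ q′) fx bad (ℕₚ.≤∧≢⇒< x n , y) t)

  rightStep : ∀ {p q} → Cell p q → Forth p (suc q) → ¬ Bad (V p (suc q)) → Forth p q
  rightStep {p} {q} cell f ok = normalised B? B-V B-H c (ℕₚ.≤-trans (lo-mono (ℕₚ.n≤1+n q)) lo≤c) c<hi
      (λ p′ q′ x _ → B-hi p′ q′ x) (λ p′ q′ x _ → B-lo p′ q′ x) av
    where
    open Forth f
    av : ∀ x → Facet x → Bad x → Beyond p q x → tgt (norm p q B) x → src (norm p q B) x
    av (V p′ q′) fx bad (x , y) (a , t) with suc q ℕ.≟ q′ | p ℕ.≟ p′
    ... | yes refl | yes refl = ⊥-elim (ok bad)
    av (V p′ q′) fx bad (x , y) (a , inj₁ t) | yes refl | no n = ⊥-elim (n (ℕₚ.≤-antisym x t))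
    av (V p′ q′) fx bad (x , y) (a , inj₂ t) | yes refl | no n = ⊥-elim (up p′ (suc q) (ℕₚ.≤∧≢⇒< x n) ℕₚ.≤-refl t)
    av (V p′ q′) fx bad (x , y) (a , inj₁ t) | no m | yes refl = a , inj₂ (avoid (V p′ q′) fx bad (x , ℕₚ.≤∧≢⇒< y m) (right p′ q′ ℕₚ.≤-refl (ℕₚ.≤∧≢⇒< y m)))
    av (V p′ q′) fx bad (x , y) (a , inj₁ t) | no m | no n = ⊥-elim (n (ℕₚ.≤-antisym x t))
    av (V p′ q′) fx bad (x , y) (a , inj₂ t) | no m | _ = a , inj₂ (avoid (V p′ q′) fx bad (x , ℕₚ.≤∧≢⇒< y m) t)
    av (H p′ q′) fx bad (x , y) (a , inj₁ t) = ⊥-elim (ℕₚ.<⇒≱ x t)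
    av (H p′ q′) fx bad (x , y) (a , inj₂ t) with q ℕ.≟ q′
    ... | yes refl = ⊥-elim (up p′ (suc q) x ℕₚ.≤-refl t)
    ... | no n = ℕₚ.≤∧≢⇒< y n , inj₂ (avoid (H p′ q′) fx bad (x , ℕₚ.≤∧≢⇒< y n) t)

  upSink : ∀ {p q} → Cell p q → ¬ Cell (suc p) q → ¬ Bad (H (suc p) q) → Forth p q
  upSink {p} {q} cell ¬cell ok = record
    { c = lo q ; lo≤c = ℕₚ.≤-refl ; c<hi = free-down (ℕₚ.n≤1+n p) ℕₚ.≤-refl (proj₁ cell)
    ; B = U ; B? = U? ; B-V = U-V ; B-H = U-H
    ; right = λ p′ q′ a b → b , inj₁ (s≤s a)
    ; up = λ p′ q′ a b z → ℕₚ.≤⇒≯ b (proj₁ z)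
    ; B-hi = λ p′ q′ _ → U-hi p′ q′ ; B-lo = λ p′ q′ _ → U-lo p′ q′
    ; avoid = av }
    where
    open Upset (sinkH (proj₁ cell) ¬cell)
    av : ∀ x → Facet x → Bad x → Beyond p q x → tgt U x → src U x
    av (V p′ q′) fx bad (x , y) t = sinkH-V (proj₁ cell) ¬cell p′ q′ fx t
    av (H p′ q′) fx bad (x , y) t = sinkH-H (proj₁ cell) ¬cell p′ q′ x fx (λ e → ok (subst Bad e bad)) t

  rightSink : ∀ {p q} → Cell p q → ¬ Cell p (suc q) → ¬ Bad (V p (suc q)) → Forth p q
  rightSink {p} {q} cell ¬cell ok = record
    { c = lo (suc q) ; lo≤c = lo-mono (ℕₚ.n≤1+n q) ; c<hi = proj₂ cell
    ; B = U ; B? = U? ; B-V = U-V ; B-H = U-H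
    ; right = λ p′ q′ a b → b , inj₁ a
    ; up = λ p′ q′ a b z → ℕₚ.≤⇒≯ b (proj₁ z)
    ; B-hi = λ p′ q′ _ → U-hi p′ q′ ; B-lo = λ p′ q′ _ → U-lo p′ q′
    ; avoid = av }
    where
    open Upset (sinkV (proj₂ cell) ¬cell)
    av : ∀ x → Facet x → Bad x → Beyond p q x → tgt U x → src U x
    av (V p′ q′) fx bad (x , y) t = sinkV-V (proj₂ cell) ¬cell p′ q′ fx (λ e → ok (subst Bad e bad)) t
    av (H p′ q′) fx bad (x , y) t = sinkV-H (proj₂ cell) ¬cell p′ q′ (inj₁ x) fx t

  -- The fuel `d` bounds the distance to the diagonal. A step into a cell with two bad out-edges is
  -- fatal, but a second obstacle beside such a cell would make three bad edges.
  forth : ∀ d p q → N ≤ p + q + d → Cell p q → ¬ BadOut p q → Forth p q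
  forth zero p q le cell ok = ⊥-elim (ℕₚ.<⇒≱ (free⇒< (proj₂ cell))
    (ℕₚ.≤-trans le (ℕₚ.≤-trans (ℕₚ.≤-reflexive (ℕₚ.+-identityʳ _)) (ℕₚ.+-monoʳ-≤ p (ℕₚ.n≤1+n q)))))
  forth (suc d) p q le cell ok with goUp? | goRight?
    where
    goUp? : ¬ Bad (H (suc p) q) → Forth p q ⊎ (Cell (suc p) q × BadOut (suc p) q)
    goUp? a with cell? (suc p) q
    ... | no n = inj₁ (upSink cell n a)
    ... | yes y with bad? (H (suc (suc p)) q) ×-dec bad? (V (suc p) (suc q))
    ...   | yes b = inj₂ (y , b)
    ...   | no b = inj₁ (upStep cell (forth d (suc p) q (ℕₚ.≤-trans le (ℕₚ.≤-reflexive (ℕₚ.+-suc (p + q) d))) y b) a)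
    goRight? : ¬ Bad (V p (suc q)) → Forth p q ⊎ (Cell p (suc q) × BadOut p (suc q))
    goRight? a with cell? p (suc q)
    ... | no n = inj₁ (rightSink cell n a)
    ... | yes y with bad? (H (suc p) (suc q)) ×-dec bad? (V p (suc (suc q)))
    ...   | yes b = inj₂ (y , b)
    ...   | no b = inj₁ (rightStep cell (forth d p (suc q) (ℕₚ.≤-trans le (ℕₚ.≤-reflexive (trans (ℕₚ.+-suc (p + q) d) (cong (_+ d) (sym (ℕₚ.+-suc p q)))))) y b) a)
  ... | u | r with bad? (H (suc p) q) | bad? (V p (suc q))
  ... | yes a | yes b = ⊥-elim (ok (a , b))
  ... | no a | yes b with u a
  ...   | inj₁ f = f
  ...   | inj₂ (_ , (x , y)) = ⊥-elim (two b x y (λ ()) (λ ()) (V≢ʳ (λ ())))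
  forth (suc d) p q le cell ok | u | r | yes a | no b with r b
  ...   | inj₁ f = f
  ...   | inj₂ (_ , (x , y)) = ⊥-elim (two a x y (H≢ (λ ())) (λ ()) (λ ()))
  forth (suc d) p q le cell ok | u | r | no a | no b with u a | r b
  ...   | inj₁ f | _ = f
  ...   | inj₂ _ | inj₁ f = f
  ...   | inj₂ (_ , (x , y)) | inj₂ (_ , (z , w)) = ⊥-elim (two x y z (λ ()) (λ ()) (H≢ʳ (λ ())))

  Avoiding : ∀ {c} → Upset c → Set
  Avoiding W = ∀ x → Facet x → Bad x → Avoids W x

  module _ {p q : ℕ} (cell : Cell p q) (b : Back p q) (f : Forth p q) where
    private
      module b = Back b
      module f = Forth f
      U : Array Set
      U p′ q′ = (p′ ≤ p × b.B p′ q′) ⊎ (p < p′ × f.B p′ q′)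

      U-V : ∀ p′ q′ → U (suc p′) q′ → U p′ q′
      U-V p′ q′ (inj₁ (x , y)) = inj₁ (ℕₚ.≤-trans (ℕₚ.n≤1+n p′) x , b.B-V p′ q′ y)
      U-V p′ q′ (inj₂ (x , y)) with p ℕₚ.<? p′ | q ℕₚ.<? q′
      ... | yes z | _ = inj₂ (z , f.B-V p′ q′ y)
      ... | no z | yes w = inj₁ (ℕₚ.≮⇒≥ z , b.right p′ q′ (ℕₚ.≮⇒≥ z) w)
      ... | no z | no w = ⊥-elim (f.up (suc p′) q′ x (ℕₚ.≮⇒≥ w) y)

      U-H : ∀ p′ q′ → U p′ q′ → U p′ (suc q′)
      U-H p′ q′ (inj₁ (x , y)) = inj₁ (x , b.B-H p′ q′ y)
      U-H p′ q′ (inj₂ (x , y)) = inj₂ (x , f.B-H p′ q′ y)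

      c<hi : ∀ {p′} → p′ ≤ p → f.c < hi p′
      c<hi x = ℕₚ.<-≤-trans f.c<hi (hi-anti x)

      U-hi : ∀ p′ q′ → p′ + q′ ≤ N → lo q′ ≡ hi p′ → f.c < lo q′ → U p′ q′
      U-hi p′ q′ h e c< with p ℕₚ.<? p′ | q ℕₚ.<? q′
      ... | yes z | _ = inj₂ (z , f.B-hi p′ q′ z h e c<)
      ... | no z | yes w = inj₁ (ℕₚ.≮⇒≥ z , b.right p′ q′ (ℕₚ.≮⇒≥ z) w)
      ... | no z | no w = ⊥-elim (ℕₚ.<⇒≱ c< (ℕₚ.≤-trans (lo-mono (ℕₚ.≮⇒≥ w)) f.lo≤c))

      U-lo : ∀ p′ q′ → p′ + q′ ≤ N → lo q′ ≡ hi p′ → lo q′ ≤ f.c → ¬ U p′ q′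
      U-lo p′ q′ h e ≤c (inj₁ (x , _)) = ℕₚ.<⇒≱ (c<hi x) (subst (_≤ f.c) e ≤c)
      U-lo p′ q′ h e ≤c (inj₂ (x , y)) = f.B-lo p′ q′ x h e ≤c y

    -- Rows up to `p` come from the initial part and the rows above from the final part. They fit
    -- together because `right` and `up` prescribe the same sets around the cell in both.
    path : Upset f.c
    path = record
      { U = U ; U? = λ p′ q′ → ((p′ ℕₚ.≤? p) ×-dec b.B? p′ q′) ⊎-dec ((p ℕₚ.<? p′) ×-dec f.B? p′ q′)
      ; U-V = U-V ; U-H = U-H ; U-hi = U-hi ; U-lo = U-lo }

    path-avoids : Avoiding path
    path-avoids (V p′ q′) fx bad (inj₁ (x , y)) with p′ ℕ.≟ p
    ... | no n = inj₁ (ℕₚ.≤∧≢⇒< x n , src-in)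
      where
      src-in : b.B (suc p′) q′
      src-in with q ℕₚ.<? q′
      ... | yes z = b.right (suc p′) q′ (ℕₚ.≤∧≢⇒< x n) z
      ... | no z = b.avoid (V p′ q′) bad (x , ℕₚ.≮⇒≥ z) y
    ... | yes refl with q ℕₚ.<? q′
    ...   | yes z = inj₂ (ℕₚ.≤-refl , f.avoid (V p q′) fx bad (ℕₚ.≤-refl , z) (f.right p q′ ℕₚ.≤-refl z))
    ...   | no z = ⊥-elim (b.up (suc p) q′ ℕₚ.≤-refl (ℕₚ.≮⇒≥ z) (b.avoid (V p q′) bad (ℕₚ.≤-refl , ℕₚ.≮⇒≥ z) y))
    path-avoids (V p′ q′) fx bad (inj₂ (x , y)) with q ℕₚ.<? q′
    ... | yes z = inj₂ (ℕₚ.m<n⇒m<1+n x , f.avoid (V p′ q′) fx bad (ℕₚ.<⇒≤ x , z) y)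
    ... | no z = ⊥-elim (f.up p′ q′ x (ℕₚ.≮⇒≥ z) y)
    path-avoids (H p′ q′) fx bad (inj₁ (x , y)) with q ℕₚ.<? q′
    ... | yes z = inj₁ (x , b.right p′ q′ x z)
    ... | no z = inj₁ (x , b.avoid (H p′ q′) bad (x , ℕₚ.≮⇒≥ z) y)
    path-avoids (H p′ q′) fx bad (inj₂ (x , y)) with q ℕₚ.≤? q′
    ... | yes z = inj₂ (x , f.avoid (H p′ q′) fx bad (x , z) y)
    ... | no z = ⊥-elim (f.up p′ (suc q′) x (ℕₚ.≰⇒> z) y)

    path-V : b.B p q → Crosses path (V p q)
    path-V y = inj₁ (ℕₚ.≤-refl , y) , λ { (inj₁ (x , _)) → ℕₚ.<-irrefl refl x
                                        ; (inj₂ (x , z)) → f.up (suc p) q x ℕₚ.≤-refl z }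

    path-H : ¬ b.B p q → Crosses path (H p q)
    path-H y = inj₁ (ℕₚ.≤-refl , b.right p (suc q) ℕₚ.≤-refl ℕₚ.≤-refl) ,
      λ { (inj₁ (_ , z)) → y z ; (inj₂ (x , z)) → ℕₚ.<-irrefl refl x }

    path-up : f.B (suc p) (suc q) → Crosses path (H (suc p) q)
    path-up y = inj₂ (ℕₚ.≤-refl , y) , λ { (inj₁ (x , _)) → ℕₚ.<-irrefl refl x
                                         ; (inj₂ (x , z)) → f.up (suc p) q x ℕₚ.≤-refl z }

    path-right : ¬ f.B (suc p) (suc q) → Crosses path (V p (suc q))
    path-right y = inj₁ (ℕₚ.≤-refl , b.right p (suc q) ℕₚ.≤-refl ℕₚ.≤-refl) ,
      λ { (inj₁ (x , _)) → ℕₚ.<-irrefl refl x ; (inj₂ (x , z)) → y z }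

  record Separator (g : Edge) : Set₁ where
    constructor sep
    field
      {c}     : ℕ
      upset   : Upset c
      crosses : Crosses upset g
      avoids  : Avoiding upset

  -- The path comes to the tail of `g`, crosses `g` and continues from its head. The two last
  -- hypotheses are what `back` and `forth` require there; an edge without tail starts at the outer
  -- vertex, and one without head ends in a sink.
  separate : ∀ g → Facet g → ¬ Bad g →
    (∀ p q h → Cell p q → Out p q g h → ¬ BadIn p q) →
    (∀ p q h → Cell p q → In p q g h → ¬ BadOut p q) → Separator g
  separate (V p zero) fg ok tl hd with cell? p 0
  ... | no n = sep (sinkV fg n) (sinkV-crosses fg n) λ
          { (V p′ q′) fx bad → sinkV-V fg n p′ q′ fx (λ e → ok (subst Bad e bad))
          ; (H p′ q′) fx bad → sinkV-H fg n p′ q′ (inj₂ z≤n) fx }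
  ... | yes y with fromV p ok | forth N p 0 (ℕₚ.m≤n+m N (p + 0)) y (hd p 0 _ y vh)
  ...   | b , r | f = sep (path y b f) (path-V y b f r) (path-avoids y b f)
  separate (H zero q) fg ok tl hd with cell? 0 q
  ... | no n = sep (sinkH fg n) (sinkH-crosses fg n) λ
          { (V p′ q′) fx bad → sinkH-V fg n p′ q′ fx
          ; (H p′ q′) fx bad → sinkH-H fg n p′ q′ z≤n fx (λ e → ok (subst Bad e bad)) }
  ... | yes y with fromH q ok | forth N 0 q (ℕₚ.m≤n+m N q) y (hd 0 q _ y hv)
  ...   | b , r | f = sep (path y b f) (path-H y b f r) (path-avoids y b f)
  separate (V p (suc q)) fg ok tl hd with cell? p (suc q) | back p q (tl p q _ fg vh)
  ... | yes y | b with leftStep b ok | forth N p (suc q) (ℕₚ.m≤n+m N (p + suc q)) y (hd p (suc q) _ y vh)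
  ...   | b′ , r | f = sep (path y b′ f) (path-V y b′ f r) (path-avoids y b′ f)
  separate (V p (suc q)) fg ok tl hd | no n | b =
    let f = rightSink fg n ok in sep (path fg b f) (path-right fg b f (proj₂ (sinkV-crosses (proj₂ fg) n))) (path-avoids fg b f)
  separate (H (suc p) q) fg ok tl hd with cell? (suc p) q | back p q (tl p q _ fg hv)
  ... | yes y | b with downStep b ok | forth N (suc p) q (ℕₚ.m≤n+m N (suc p + q)) y (hd (suc p) q _ y hv)
  ...   | b′ , r | f = sep (path y b′ f) (path-H y b′ f r) (path-avoids y b′ f)
  separate (H (suc p) q) fg ok tl hd | no n | b =
    let f = upSink fg n ok in sep (path fg b f) (path-up fg b f (proj₁ (sinkH-crosses (proj₁ fg) n))) (path-avoids fg b f)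

-- Symmetries, facets of cells, conflicts

module Symmetry (S : Shape) where
  open Shape S
  open Poly S
  open Points S

  edges : List Edge
  edges = cartesianProductWith V (upTo N) (upTo N) ++ cartesianProductWith H (upTo N) (upTo N)

  facet∈edges : ∀ e → Facet e → e ∈ edges
  facet∈edges e f with free⇒< (facet⇒free e f)
  facet∈edges (V p q) f | h = ∈-++⁺ˡ (∈-cartesianProductWith⁺ V (∈-upTo⁺ (ℕₚ.≤-<-trans (ℕₚ.m≤m+n p q) h)) (∈-upTo⁺ (ℕₚ.≤-<-trans (ℕₚ.m≤n+m q p) h)))
  facet∈edges (H p q) f | h = ∈-++⁺ʳ (cartesianProductWith V (upTo N) (upTo N))
    (∈-cartesianProductWith⁺ H (∈-upTo⁺ (ℕₚ.≤-<-trans (ℕₚ.m≤m+n p q) h)) (∈-upTo⁺ (ℕₚ.≤-<-trans (ℕₚ.m≤n+m q p) h)))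

  -- Shows that the edges singled out by `Facet` are irredundant. From a point on `e`, every other
  -- facet is removed by passing to the midpoint with a cut that crosses it and avoids `e`.
  module FacetFace (e : Edge) where
    private
      one : ∀ {x y z} → x ≡ e → y ≡ e → z ≡ e → x ≢ y → y ≢ z → x ≢ z → ⊥
      one refl refl _ x≢y _ _ = x≢y refl

    open Paths S (_≡ e) (_≟ᴱ e) one

    private
      separator : ∀ g → Facet g → g ≢ e → Separator g
      separator g fg ne = separate g fg ne (λ { _ _ _ _ _ (refl , ()) }) (λ { _ _ _ _ _ (refl , ()) })

      module Step (g : Edge) (F : Face′) where
        carved : Facet g → g ≢ e → Face′
        carved fg ne = cut F (Separator.upset (separator g fg ne))

        step : Dec (Facet g) → Dec (g ≡ e) → Face′
        step (yes fg) (no ne) = mid F (carved fg ne)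
        step (yes fg) (yes _) = F
        step (no _)   _       = F

        step-e : Facet e → T F e → ∀ a b → T (step a b) e
        step-e fe t (yes fg) (no ne) = mid-T F (carved fg ne) e t (cut-T F (Separator.upset (separator g fg ne)) e t
          (Separator.avoids (separator g fg ne) e fe refl))
        step-e fe t (yes fg) (yes _) = t
        step-e fe t (no _)   _       = t

        step-⊒ : ∀ a b → F ⊑ step a b
        step-⊒ (yes fg) (no ne) x fx t = proj₁ (mid-T⁻ F (carved fg ne) x fx t)
        step-⊒ (yes fg) (yes _) x fx t = t
        step-⊒ (no _)   _       x fx t = t

        step-g : Facet g → g ≢ e → ∀ a b → ¬ T (step a b) g
        step-g fg ne (yes fg′) (no ne′) t = spliced-¬T F F (Separator.upset (separator g fg′ ne′)) g fg
          (Separator.crosses (separator g fg′ ne′)) (proj₂ (mid-T⁻ F (carved fg′ ne′) g fg t))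
        step-g fg ne (yes fg′) (yes eq) t = ne eq
        step-g fg ne (no ¬fg) _ t = ¬fg fg

      open Step

      next : Edge → Face′ → Face′
      next g F = step g F (facet? g) (g ≟ᴱ e)

      prune : List Edge → Face′ → Face′
      prune []       F = F
      prune (g ∷ gs) F = prune gs (next g F)

      prune-e : ∀ gs F → Facet e → T F e → T (prune gs F) e
      prune-e []       F fe t = t
      prune-e (g ∷ gs) F fe t = prune-e gs _ fe (step-e g F fe t (facet? g) (g ≟ᴱ e))

      prune-⊒ : ∀ gs F → F ⊑ prune gs F
      prune-⊒ []       F x fx t = t
      prune-⊒ (g ∷ gs) F x fx t = step-⊒ g F (facet? g) (g ≟ᴱ e) x fx (prune-⊒ gs _ x fx t)

      prune-g : ∀ gs F {g} → g ∈ gs → Facet g → g ≢ e → ¬ T (prune gs F) g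
      prune-g (g ∷ gs) F (here refl) fg ne t = step-g g F fg ne (facet? g) (g ≟ᴱ e) (prune-⊒ gs _ g fg t)
      prune-g (_ ∷ gs) F (there g∈) fg ne t = prune-g gs _ g∈ fg ne t

      start : ∀ e → Σ Face′ λ F → T F e
      start (V p q) = loPt , refl
      start (H p q) = hiPt , refl

    facetFace : Face′
    facetFace = prune edges (proj₁ (start e))

    facetFace-T : Facet e → T facetFace e
    facetFace-T fe = prune-e edges _ fe (proj₂ (start e))

    facetFace-only : ∀ g → Facet g → T facetFace g → g ≡ e
    facetFace-only g fg t with g ≟ᴱ e
    ... | yes eq = eq
    ... | no ne = ⊥-elim (prune-g edges _ (facet∈edges g fg) fg ne t)

  open FacetFace public

  data Quad (e f g : Edge) : Set where
    inQ  : ∀ {p q h} → Cell p q → In p q e f → Out p q g h → Quad e f g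
    outQ : ∀ {p q h} → Cell p q → Out p q e f → In p q g h → Quad e f g

  module _ {e f : Edge} where
    private
      Bad : Edge → Set
      Bad x = x ≡ e ⊎ x ≡ f

      bad? : ∀ x → Dec (Bad x)
      bad? x = (x ≟ᴱ e) ⊎-dec (x ≟ᴱ f)

      two : ∀ {x y z} → Bad x → Bad y → Bad z → x ≢ y → y ≢ z → x ≢ z → ⊥
      two (inj₁ refl) (inj₁ refl) _ a b c = a refl
      two (inj₁ refl) (inj₂ refl) (inj₁ refl) a b c = c refl
      two (inj₁ refl) (inj₂ refl) (inj₂ refl) a b c = b refl
      two (inj₂ refl) (inj₂ refl) _ a b c = a refl
      two (inj₂ refl) (inj₁ refl) (inj₁ refl) a b c = b refl
      two (inj₂ refl) (inj₁ refl) (inj₂ refl) a b c = c refl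

      open Paths S Bad bad? two

      badIn : ∀ {p q} → BadIn p q → In p q e f
      badIn (inj₁ refl , inj₂ refl) = vh
      badIn (inj₂ refl , inj₁ refl) = hv
      badIn (inj₁ refl , inj₁ ())
      badIn (inj₂ refl , inj₂ ())

      badOut : ∀ {p q} → BadOut p q → Out p q e f
      badOut (inj₁ refl , inj₂ refl) = hv
      badOut (inj₂ refl , inj₁ refl) = vh
      badOut (inj₁ refl , inj₁ ())
      badOut (inj₂ refl , inj₂ ())

      Tail Head : Edge → Set
      Tail g = ∃ λ p → ∃ λ q → ∃ λ h → Cell p q × Out p q g h × BadIn p q
      Head g = ∃ λ p → ∃ λ q → ∃ λ h → Cell p q × In p q g h × BadOut p q

      tail? : ∀ g → Facet g → Dec (Tail g)
      tail? (V p zero) fg = no λ { (_ , _ , _ , _ , () , _) }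
      tail? (H zero q) fg = no λ { (_ , _ , _ , _ , () , _) }
      tail? (V p (suc q)) fg = map′ (λ b → p , q , _ , fg , vh , b) (λ { (_ , _ , _ , _ , vh , b) → b }) (bad? (V p q) ×-dec bad? (H p q))
      tail? (H (suc p) q) fg = map′ (λ b → p , q , _ , fg , hv , b) (λ { (_ , _ , _ , _ , hv , b) → b }) (bad? (V p q) ×-dec bad? (H p q))

      head? : ∀ g → Dec (Head g)
      head? (V p q) = map′ (λ { (y , b) → p , q , _ , y , vh , b }) (λ { (_ , _ , _ , y , vh , b) → y , b }) (cell? p q ×-dec (bad? (H (suc p) q) ×-dec bad? (V p (suc q))))
      head? (H p q) = map′ (λ { (y , b) → p , q , _ , y , hv , b }) (λ { (_ , _ , _ , y , hv , b) → y , b }) (cell? p q ×-dec (bad? (H (suc p) q) ×-dec bad? (V p (suc q))))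

    -- The point `F` shows that the facets `e` and `f` meet; for disjoint facets the closure
    -- hypothesis would be vacuous. If `g` leaves no cell entered by `e` and `f` and enters no cell
    -- left by them, a cut of `F` along a path through `g` contradicts the hypothesis.
    quad : ∀ {g} → Facet e → Facet f → Facet g → g ≢ e → g ≢ f → (F : Face′) → T F e → T F f →
      (∀ G → T G e → T G f → T G g) → Quad e f g
    quad {g} fe ff fg g≢e g≢f F te tf cl with tail? g fg | head? g
    ... | yes (_ , _ , _ , y , o , b) | _ = inQ y (badIn b) o
    ... | no _ | yes (_ , _ , _ , y , i , b) = outQ y (badOut b) i
    ... | no ¬t | no ¬h with separate g fg (λ { (inj₁ x) → g≢e x ; (inj₂ x) → g≢f x })
            (λ p q h y o b → ¬t (p , q , h , y , o , b)) (λ p q h y i b → ¬h (p , q , h , y , i , b))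
    ...   | sep W cr av = ⊥-elim (spliced-¬T F F W g fg cr
              (cl (cut F W) (cut-T F W e te (av e fe (inj₁ refl))) (cut-T F W f tf (av f ff (inj₂ refl)))))

  cell-top : ∀ {p q} → Cell p q → Facet (H (suc p) q)
  cell-top y = y

  cell-right : ∀ {p q} → Cell p q → Facet (V p (suc q))
  cell-right y = y

  private
    pinch : ∀ {x y z : ℚ} → x ℚ.≤ y → y ℚ.≤ z → x ≡ z → x ≡ y × y ≡ z
    pinch a b refl = ℚₚ.≤-antisym a b , ℚₚ.≤-antisym b a

  module _ {p q : ℕ} (y : Cell p q) (F : Face′) where
    private
      m = mono (proj₂ F)

    in⇒out : T F (V p q) → T F (H p q) → T F (H (suc p) q) × T F (V p (suc q))
    in⇒out s t = pinch (m (H (suc p) q) (cell-top y)) (m (V p (suc q)) (cell-right y)) (trans s t)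

    out⇒in : T F (H (suc p) q) → T F (V p (suc q)) → T F (V p q) × T F (H p q)
    out⇒in s t = pinch (m (V p q) (cell-V y)) (m (H p q) (cell-H y)) (trans s t)

  in-closed : ∀ {p q e f g h} → Cell p q → In p q e f → Out p q g h → ∀ F → T F e → T F f → T F g
  in-closed y vh hv F s t = proj₁ (in⇒out y F s t)
  in-closed y vh vh F s t = proj₂ (in⇒out y F s t)
  in-closed y hv hv F s t = proj₁ (in⇒out y F t s)
  in-closed y hv vh F s t = proj₂ (in⇒out y F t s)

  out-closed : ∀ {p q e f g h} → Cell p q → Out p q e f → In p q g h → ∀ F → T F e → T F f → T F g
  out-closed y hv vh F s t = proj₁ (out⇒in y F s t)
  out-closed y hv hv F s t = proj₂ (out⇒in y F s t)
  out-closed y vh vh F s t = proj₁ (out⇒in y F t s)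
  out-closed y vh hv F s t = proj₂ (out⇒in y F t s)

  module _ {p q : ℕ} (y : Cell p q) where
    private
      -- The greatest lower bound at the four corners of the cell. It does not exceed `hi (suc p)`,
      -- the least upper bound there, so a point can be constant on the whole cell.
      c = lo (suc q)
      clamp : ∀ {a b} → a ≤ suc p → b ≤ suc q → ⟦ lo b ℕ.⊔ (hi a ℕ.⊓ c) ⟧ ≡ ⟦ c ⟧
      clamp {a} {b} a≤ b≤ = cong ⟦_⟧ (trans
        (cong (lo b ℕ.⊔_) (ℕₚ.m≥n⇒m⊓n≡n (ℕₚ.≤-trans (lo≤hi (subst (_≤ N) (sym (ℕₚ.+-suc (suc p) q)) (free⇒< (proj₁ y)))) (hi-anti a≤))))
        (ℕₚ.m≤n⇒m⊔n≡n (lo-mono b≤)))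

    cellFace : Face′
    cellFace = constPt c

    cellFace-In : ∀ {e f} → In p q e f → T cellFace e × T cellFace f
    cellFace-In i = go i
      where
      v : T cellFace (V p q)
      v = trans (clamp ℕₚ.≤-refl (ℕₚ.n≤1+n q)) (sym (clamp (ℕₚ.n≤1+n p) (ℕₚ.n≤1+n q)))
      h : T cellFace (H p q)
      h = trans (clamp (ℕₚ.n≤1+n p) (ℕₚ.n≤1+n q)) (sym (clamp (ℕₚ.n≤1+n p) ℕₚ.≤-refl))
      go : ∀ {e f} → In p q e f → T cellFace e × T cellFace f
      go vh = v , h
      go hv = h , v

    cellFace-Out : ∀ {e f} → Out p q e f → T cellFace e × T cellFace f
    cellFace-Out hv = in-closed y vh hv cellFace (proj₁ (cellFace-In vh)) (proj₂ (cellFace-In vh)) ,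
                      in-closed y vh vh cellFace (proj₁ (cellFace-In vh)) (proj₂ (cellFace-In vh))
    cellFace-Out vh = in-closed y vh vh cellFace (proj₁ (cellFace-In vh)) (proj₂ (cellFace-In vh)) ,
                      in-closed y vh hv cellFace (proj₁ (cellFace-In vh)) (proj₂ (cellFace-In vh))

  in-facets : ∀ {p q e f} → Cell p q → In p q e f → Facet e × Facet f
  in-facets y vh = cell-V y , cell-H y
  in-facets y hv = cell-H y , cell-V y

  out-facets : ∀ {p q e f} → Cell p q → Out p q e f → Facet e × Facet f
  out-facets y hv = y , y
  out-facets y vh = y , y

  in≢out : ∀ {p q e f g h} → In p q e f → Out p q g h → e ≢ g × f ≢ g
  in≢out vh hv = (λ ()) , λ ()
  in≢out vh vh = (λ ()) , λ ()
  in≢out hv hv = (λ ()) , λ ()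
  in≢out hv vh = (λ ()) , λ ()

  out-swap : ∀ {p q e f} → Out p q e f → Out p q f e
  out-swap hv = vh
  out-swap vh = hv

  -- A symmetry of the face poset together with the permutation of the facets it induces.
  record Sym : Set where
    field
      π π⁻ : Edge → Edge
      π-F  : ∀ {e} → Facet e → Facet (π e)
      π⁻-F : ∀ {e} → Facet e → Facet (π⁻ e)
      ππ⁻  : ∀ {e} → Facet e → π (π⁻ e) ≡ e
      π⁻π  : ∀ {e} → Facet e → π⁻ (π e) ≡ e
      ρ ρ⁻ : Face′ → Face′
      ρ-T   : ∀ F {e} → Facet e → T F e → T (ρ F) (π e)
      ρ⁻-T  : ∀ F {e} → Facet e → T F e → T (ρ⁻ F) (π⁻ e)
      ρ-T⁻  : ∀ F {e} → Facet e → T (ρ F) (π e) → T F e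
      ρ⁻-T⁻ : ∀ F {e} → Facet e → T (ρ⁻ F) (π⁻ e) → T F e

    π-inj : ∀ {e f} → Facet e → Facet f → π e ≡ π f → e ≡ f
    π-inj fe ff eq = trans (sym (π⁻π fe)) (trans (cong π⁻ eq) (π⁻π ff))

    ρ-T′ : ∀ F {e} → Facet e → T F (π⁻ e) → T (ρ F) e
    ρ-T′ F fe t = subst (T (ρ F)) (ππ⁻ fe) (ρ-T F (π⁻-F fe) t)

    ρ-T⁻′ : ∀ F {e} → Facet e → T (ρ F) e → T F (π⁻ e)
    ρ-T⁻′ F fe t = ρ-T⁻ F (π⁻-F fe) (subst (T (ρ F)) (sym (ππ⁻ fe)) t)

    ρ⁻-T′ : ∀ F {e} → Facet e → T F (π e) → T (ρ⁻ F) e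
    ρ⁻-T′ F fe t = subst (T (ρ⁻ F)) (π⁻π fe) (ρ⁻-T F (π-F fe) t)

    ρ⁻-T⁻′ : ∀ F {e} → Facet e → T (ρ⁻ F) e → T F (π e)
    ρ⁻-T⁻′ F fe t = ρ⁻-T⁻ F (π-F fe) (subst (T (ρ⁻ F)) (sym (π⁻π fe)) t)

    ρ-mono : ∀ {F G} → F ⊑ G → ρ F ⊑ ρ G
    ρ-mono {F} {G} h e fe t = ρ-T′ F fe (h (π⁻ e) (π⁻-F fe) (ρ-T⁻′ G fe t))

  open Sym public

  idSym : Sym
  idSym = record
    { π = λ e → e ; π⁻ = λ e → e ; π-F = λ f → f ; π⁻-F = λ f → f ; ππ⁻ = λ _ → refl ; π⁻π = λ _ → refl
    ; ρ = λ F → F ; ρ⁻ = λ F → F ; ρ-T = λ _ _ t → t ; ρ⁻-T = λ _ _ t → t ; ρ-T⁻ = λ _ _ t → t ; ρ⁻-T⁻ = λ _ _ t → t }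

  infixr 9 _⊙_
  _⊙_ : Sym → Sym → Sym
  A ⊙ B = record
    { π = π A ∘ π B ; π⁻ = π⁻ B ∘ π⁻ A ; π-F = π-F A ∘ π-F B ; π⁻-F = π⁻-F B ∘ π⁻-F A
    ; ππ⁻ = λ fe → trans (cong (π A) (ππ⁻ B (π⁻-F A fe))) (ππ⁻ A fe)
    ; π⁻π = λ fe → trans (cong (π⁻ B) (π⁻π A (π-F B fe))) (π⁻π B fe)
    ; ρ = ρ A ∘ ρ B ; ρ⁻ = ρ⁻ B ∘ ρ⁻ A
    ; ρ-T = λ F fe t → ρ-T A _ (π-F B fe) (ρ-T B F fe t)
    ; ρ⁻-T = λ F fe t → ρ⁻-T B _ (π⁻-F A fe) (ρ⁻-T A F fe t)
    ; ρ-T⁻ = λ F fe t → ρ-T⁻ B F fe (ρ-T⁻ A _ (π-F B fe) t)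
    ; ρ⁻-T⁻ = λ F fe t → ρ⁻-T⁻ A F fe (ρ⁻-T⁻ B _ (π⁻-F A fe) t) }

  inv : Sym → Sym
  inv A = record
    { π = π⁻ A ; π⁻ = π A ; π-F = π⁻-F A ; π⁻-F = π-F A ; ππ⁻ = π⁻π A ; π⁻π = ππ⁻ A
    ; ρ = ρ⁻ A ; ρ⁻ = ρ A ; ρ-T = ρ⁻-T A ; ρ⁻-T = ρ-T A ; ρ-T⁻ = ρ⁻-T⁻ A ; ρ⁻-T⁻ = ρ-T⁻ A }

  module _ (A : Sym) where

    private
      transfer : ∀ {e f g} → Facet e → Facet f → Facet g → g ≢ e → g ≢ f → (F : Face′) → T F e → T F f →
        (∀ G → T G e → T G f → T G g) → Quad (π A e) (π A f) (π A g)
      transfer fe ff fg a b F s t cl = quad (π-F A fe) (π-F A ff) (π-F A fg)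
        (a ∘ π-inj A fg fe) (b ∘ π-inj A fg ff) (ρ A F) (ρ-T A F fe s) (ρ-T A F ff t)
        λ G s′ t′ → ρ⁻-T⁻′ A G fg (cl (ρ⁻ A G) (ρ⁻-T′ A G fe s′) (ρ⁻-T′ A G ff t′))

    -- That two facets force a third is a property of the face poset and passes to the images, where
    -- `quad` turns it back into incidence with a cell.
    in-quad : ∀ {p q e f g h} → Cell p q → In p q e f → Out p q g h → Quad (π A e) (π A f) (π A g)
    in-quad y i o = transfer (proj₁ (in-facets y i)) (proj₂ (in-facets y i)) (proj₁ (out-facets y o))
      (proj₁ (in≢out i o) ∘ sym) (proj₂ (in≢out i o) ∘ sym)
      (cellFace y) (proj₁ (cellFace-In y i)) (proj₂ (cellFace-In y i)) (in-closed y i o)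

    out-quad : ∀ {p q e f g h} → Cell p q → Out p q e f → In p q g h → Quad (π A e) (π A f) (π A g)
    out-quad y o i = transfer (proj₁ (out-facets y o)) (proj₂ (out-facets y o)) (proj₁ (in-facets y i))
      (proj₁ (in≢out i o)) (proj₁ (in≢out i (out-swap o)))
      (cellFace y) (proj₁ (cellFace-Out y o)) (proj₂ (cellFace-Out y o)) (out-closed y o i)

  -- e and f lie in a common minimal set of facets without common point.
  record Conflict (e f : Edge) : Set where
    field
      base left right : Face′
      left⊑  : left ⊑ base
      right⊑ : right ⊑ base
      left-T  : T left e
      right-T : T right f
      clash   : ∀ F → F ⊑ base → T F e → T F f → ⊥

  conflict-sym : ∀ {e f} → Conflict e f → Conflict f e
  conflict-sym C = record { base = base ; left = right ; right = left ; left⊑ = right⊑ ; right⊑ = left⊑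
    ; left-T = right-T ; right-T = left-T ; clash = λ F h s t → clash F h t s }
    where open Conflict C

  conflict-π : (A : Sym) → ∀ {e f} → Facet e → Facet f → Conflict e f → Conflict (π A e) (π A f)
  conflict-π A fe ff C = record
    { base = ρ A base ; left = ρ A left ; right = ρ A right
    ; left⊑ = ρ-mono A {left} {base} left⊑ ; right⊑ = ρ-mono A {right} {base} right⊑
    ; left-T = ρ-T A left fe left-T ; right-T = ρ-T A right ff right-T
    ; clash = λ F h s t → clash (ρ⁻ A F)
        (λ x fx u → ρ⁻-T′ A F fx (h (π A x) (π-F A fx) (ρ-T A base fx u)))
        (ρ⁻-T′ A F fe s) (ρ⁻-T′ A F ff t) }
    where open Conflict C

  conflict-π⁻ : (A : Sym) → ∀ {e f} → Facet e → Facet f → Conflict (π A e) (π A f) → Conflict e f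
  conflict-π⁻ A fe ff C = subst₂ Conflict (π⁻π A fe) (π⁻π A ff) (conflict-π (inv A) (π-F A fe) (π-F A ff) C)

  -- From automorphisms of the face poset to permutations of the facets

  module FromAut (to from : Face′ → Face′)
    (to-mono : ∀ F G → F ⊑ G → to F ⊑ to G) (from-mono : ∀ F G → F ⊑ G → from F ⊑ from G)
    (to-from : ∀ F → to (from F) ⊑ F × F ⊑ to (from F)) (from-to : ∀ F → from (to F) ⊑ F × F ⊑ from (to F)) where

    private
      ff : ∀ e → Face′
      ff = facetFace

      ⊑-facet : ∀ F {e} → T F e → F ⊑ ff e
      ⊑-facet F {e} t g fg u = subst (T F) (sym (facetFace-only e g fg u)) t

      module One (to from : Face′ → Face′)
        (to-mono : ∀ F G → F ⊑ G → to F ⊑ to G) (from-mono : ∀ F G → F ⊑ G → from F ⊑ from G)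
        (to-from : ∀ F → to (from F) ⊑ F × F ⊑ to (from F)) (from-to : ∀ F → from (to F) ⊑ F × F ⊑ from (to F)) where

        -- If the image lay on no facet, it would contain every face, and so would `F`. But `F` lies
        -- on `e`, and there is a facet other than `e`.
        some-facet : ∀ F {e} → Facet e → T F e → ∃ λ g → Facet g × T (to F) g
        some-facet F {e} fe t with any? (λ g → facet? g ×-dec T? (to F) g) edges
        ... | yes a = satisfied a
        ... | no ¬a = ⊥-elim (¬T-other (other e))
          where
          top : ∀ G → G ⊑ F
          top G x fx u = proj₂ (from-to G) x fx (from-mono (to G) (to F)
            (λ g fg w → ⊥-elim (¬a (lose (facet∈edges g fg) (fg , w)))) x fx (proj₁ (from-to F) x fx u))
          free00 : Free 0 0
          free00 = ℕₚ.≤-trans (s≤s (ℕₚ.n≤1+n _)) wide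
          other : ∀ e → ∃ λ g → Facet g × g ≢ e
          other (V _ _) = H 0 0 , free00 , λ ()
          other (H _ _) = V 0 0 , free00 , λ ()
          ¬T-other : ¬ ∃ λ g → Facet g × g ≢ e
          ¬T-other (g , fg , g≢e) = g≢e (sym (facetFace-only g e fe (top (ff g) e fe t)))

      module Image (to from : Face′ → Face′)
        (to-mono : ∀ F G → F ⊑ G → to F ⊑ to G) (from-mono : ∀ F G → F ⊑ G → from F ⊑ from G)
        (to-from : ∀ F → to (from F) ⊑ F × F ⊑ to (from F)) (from-to : ∀ F → from (to F) ⊑ F × F ⊑ from (to F))
        (e : Edge) (fe : Facet e) where
        module To′   = One to from to-mono from-mono to-from from-to
        module From′ = One from to from-mono to-mono from-to to-from

        img : Edge
        img = proj₁ (To′.some-facet (ff e) fe (facetFace-T e fe))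

        img-F : Facet img
        img-F = proj₁ (proj₂ (To′.some-facet (ff e) fe (facetFace-T e fe)))

        img-T : T (to (ff e)) img
        img-T = proj₂ (proj₂ (To′.some-facet (ff e) fe (facetFace-T e fe)))

        -- from (ff img) is a proper face above ff e, hence contained in no facet but e.
        below : ff e ⊑ from (ff img)
        below x fx u = proj₂ (from-to (ff e)) x fx (from-mono (to (ff e)) (ff img) (⊑-facet (to (ff e)) img-T) x fx u)

        from-img : T (from (ff img)) e
        from-img with From′.some-facet (ff img) img-F (facetFace-T img img-F)
        ... | g , fg , u = subst (T (from (ff img))) (facetFace-only e g fg (below g fg u)) u

        to-T : ∀ F → T F e → T (to F) img
        to-T F t = to-mono F (ff e) (⊑-facet F t) img img-F img-T

        to-T⁻ : ∀ F → T (to F) img → T F e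
        to-T⁻ F t = proj₂ (from-to F) e fe (from-mono (to F) (ff img) (⊑-facet (to F) t) e fe from-img)

      module To″ = Image to from to-mono from-mono to-from from-to
      module From″ = Image from to from-mono to-mono from-to to-from

      φ φ⁻ : Edge → Edge
      φ e with facet? e
      ... | yes fe = To″.img e fe
      ... | no _ = e
      φ⁻ e with facet? e
      ... | yes fe = From″.img e fe
      ... | no _ = e

      φ-F : ∀ {e} → Facet e → Facet (φ e)
      φ-F {e} fe with facet? e
      ... | yes fe′ = To″.img-F e fe′
      ... | no n = ⊥-elim (n fe)

      φ⁻-F : ∀ {e} → Facet e → Facet (φ⁻ e)
      φ⁻-F {e} fe with facet? e
      ... | yes fe′ = From″.img-F e fe′
      ... | no n = ⊥-elim (n fe)

      to-T : ∀ F {e} → Facet e → T F e → T (to F) (φ e)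
      to-T F {e} fe t with facet? e
      ... | yes fe′ = To″.to-T e fe′ F t
      ... | no n = ⊥-elim (n fe)

      to-T⁻ : ∀ F {e} → Facet e → T (to F) (φ e) → T F e
      to-T⁻ F {e} fe t with facet? e
      ... | yes fe′ = To″.to-T⁻ e fe′ F t
      ... | no n = ⊥-elim (n fe)

      from-T : ∀ F {e} → Facet e → T F e → T (from F) (φ⁻ e)
      from-T F {e} fe t with facet? e
      ... | yes fe′ = From″.to-T e fe′ F t
      ... | no n = ⊥-elim (n fe)

      from-T⁻ : ∀ F {e} → Facet e → T (from F) (φ⁻ e) → T F e
      from-T⁻ F {e} fe t with facet? e
      ... | yes fe′ = From″.to-T⁻ e fe′ F t
      ... | no n = ⊥-elim (n fe)

    autSym : Sym
    autSym = record
      { π = φ ; π⁻ = φ⁻ ; π-F = φ-F ; π⁻-F = φ⁻-F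
      ; ππ⁻ = λ {e} fe → facetFace-only e _ (φ-F (φ⁻-F fe)) (proj₂ (to-from (ff e)) _ (φ-F (φ⁻-F fe))
                (to-T (from (ff e)) (φ⁻-F fe) (from-T (ff e) fe (facetFace-T e fe))))
      ; π⁻π = λ {e} fe → facetFace-only e _ (φ⁻-F (φ-F fe)) (proj₂ (from-to (ff e)) _ (φ⁻-F (φ-F fe))
                (from-T (to (ff e)) (φ-F fe) (to-T (ff e) fe (facetFace-T e fe))))
      ; ρ = to ; ρ⁻ = from ; ρ-T = to-T ; ρ⁻-T = from-T ; ρ-T⁻ = to-T⁻ ; ρ⁻-T⁻ = from-T⁻ }

-- Which facets conflict

module Conflicts (S : Shape) where
  open Shape S
  open Poly S
  open Points S
  open Symmetry S

  tgt≤hi : ∀ F e → Facet e → tgt (proj₁ F) e ℚ.≤ ⟦ hi (row e) ⟧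
  tgt≤hi F (V p q) fe = upper (proj₂ F) p q (ℕₚ.<⇒≤ (free⇒< (facet⇒free (V p q) fe)))
  tgt≤hi F (H p q) fe = upper (proj₂ F) p (suc q) (subst (_≤ N) (sym (ℕₚ.+-suc p q)) (free⇒< (facet⇒free (H p q) fe)))

  lo≤src : ∀ F e → Facet e → ⟦ lo (col e) ⟧ ℚ.≤ src (proj₁ F) e
  lo≤src F (V p q) fe = lower (proj₂ F) (suc p) q (free⇒< (facet⇒free (V p q) fe))
  lo≤src F (H p q) fe = lower (proj₂ F) p q (ℕₚ.<⇒≤ (free⇒< (facet⇒free (H p q) fe)))

  -- Cutting at level c, the part of left below and the part of right above combine to a common point.
  ¬conflict : ∀ {e f} c → Facet e → Facet f → hi (row e) ≤ c → c ≤ lo (col f) → ¬ Conflict e f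
  ¬conflict {e} {f} c fe ff e≤c c≤f C = clash (blend left right c)
    (λ x fx t → blend-T left right c x (cong₂ (glue c) (left⊑ x fx t) (right⊑ x fx t)))
    (blend-T left right c e (glue-low c left-T (ℚₚ.≤-trans (mono (proj₂ right) e fe) tgt≤) tgt≤))
    (blend-T left right c f (glue-high c ≤src (ℚₚ.≤-trans ≤src (mono (proj₂ left) f ff)) right-T))
    where
    open Conflict C
    tgt≤ : tgt (proj₁ right) e ℚ.≤ ⟦ c ⟧
    tgt≤ = ℚₚ.≤-trans (tgt≤hi right e fe) (⟦⟧-mono e≤c)
    ≤src : ⟦ c ⟧ ℚ.≤ src (proj₁ left) f
    ≤src = ℚₚ.≤-trans (⟦⟧-mono c≤f) (lo≤src left f ff)

  -- The chain runs down column κ to row ρ and then along this row; the value has to pass from c to c + 1 on it.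
  module Chain (κ ρ c : ℕ) (loκ≤c : lo κ ≤ c) (c<hiρ : c < hi ρ)
    (κ-ok : ∀ κ′ → κ ≡ suc κ′ → lo κ′ < c) (ρ-ok : ∀ ρ′ → ρ ≡ suc ρ′ → suc c < hi ρ′) where

    data Link : Edge → Set where
      vlink : ∀ r → ρ ≤ r → c < hi r → Link (V r κ)
      hlink : ∀ q → κ ≤ q → lo q ≤ c → Link (H ρ q)

    -- Here `κ-ok` and `ρ-ok` enter: they make the squares to the left of the column and below the
    -- row cells.
    link-facet : ∀ {e} → Link e → Facet e
    link-facet (vlink r _ c<) = V-facet (ℕₚ.≤-<-trans loκ≤c c<)
      λ κ′ e → ℕₚ.<-≤-trans (κ-ok κ′ e) (ℕₚ.≤-pred (ℕₚ.≤-trans c< (hi-step r)))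
    link-facet (hlink q _ ≤c) = H-facet (ℕₚ.≤-<-trans ≤c c<hiρ)
      λ ρ′ e → ℕₚ.≤-<-trans (ℕₚ.≤-trans (lo-step q) (s≤s ≤c)) (ρ-ok ρ′ e)

    private
      through : ∀ {e} → Link e → Upset c
      through (vlink r _ c<) = record
        { U = λ p q → p ≤ r ⊎ c < lo q ; U? = λ p q → (p ℕₚ.≤? r) ⊎-dec (c ℕₚ.<? lo q)
        ; U-V = λ { p q (inj₁ a) → inj₁ (ℕₚ.≤-trans (ℕₚ.n≤1+n p) a) ; p q (inj₂ a) → inj₂ a }
        ; U-H = λ { p q (inj₁ a) → inj₁ a ; p q (inj₂ a) → inj₂ (ℕₚ.<-≤-trans a (lo-mono (ℕₚ.n≤1+n q))) }
        ; U-hi = λ p q _ _ → inj₂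
        ; U-lo = λ { p q _ e ≤c (inj₁ a) → ℕₚ.<⇒≱ c< (ℕₚ.≤-trans (hi-anti a) (subst (_≤ c) e ≤c))
                   ; p q _ e ≤c (inj₂ a) → ℕₚ.<⇒≱ a ≤c } }
      through (hlink q _ ≤c) = record
        { U = λ p′ q′ → q < q′ × c < hi p′ ; U? = λ p′ q′ → (q ℕₚ.<? q′) ×-dec (c ℕₚ.<? hi p′)
        ; U-V = λ { p′ q′ (a , b) → a , ℕₚ.<-≤-trans b (hi-anti (ℕₚ.n≤1+n p′)) }
        ; U-H = λ { p′ q′ (a , b) → ℕₚ.m<n⇒m<1+n a , b }
        ; U-hi = λ p′ q′ _ e c< → ℕₚ.≰⇒> (λ q′≤q → ℕₚ.<⇒≱ c< (ℕₚ.≤-trans (lo-mono q′≤q) ≤c)) , subst (c <_) e c<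
        ; U-lo = λ { p′ q′ _ e ≤c′ (a , b) → ℕₚ.<⇒≱ b (subst (_≤ c) e ≤c′) } }

      through-avoids : ∀ {e x} (l : Link e) → Link x → x ≢ e → Avoids (through l) x
      through-avoids (vlink r _ _) (vlink r′ _ _) ne (inj₁ a) = inj₁ (ℕₚ.≤∧≢⇒< a λ { refl → ne refl })
      through-avoids (vlink r _ _) (vlink r′ _ _) ne (inj₂ a) = inj₂ a
      through-avoids (vlink r ρ≤r _) (hlink q _ _) ne _ = inj₁ ρ≤r
      through-avoids (hlink q κ≤q _) (vlink r _ _) ne (a , _) = ⊥-elim (ℕₚ.<⇒≱ a κ≤q)
      through-avoids (hlink q _ _) (hlink q′ _ _) ne (a , b) = ℕₚ.≤∧≢⇒< (ℕₚ.≤-pred a) (λ { refl → ne refl }) , b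

      -- Truncated at `c` from above, `hiPt` is constant along the chain, and so is `loPt` truncated
      -- at `c + 1` from below. Along the chain only the unit between varies, and it is gained at
      -- the chosen link.
      linkFace : ∀ {e} → Link e → Face′
      linkFace l = spliced hiPt loPt (through l)

      level : ∀ {x} → Link x → src (proj₁ hiPt) x ⊓ ⟦ c ⟧ ≡ tgt (proj₁ hiPt) x ⊓ ⟦ c ⟧ ×
        src (proj₁ loPt) x ⊔ ⟦ suc c ⟧ ≡ tgt (proj₁ loPt) x ⊔ ⟦ suc c ⟧
      level (vlink r _ c<) = trans (ℚₚ.p≥q⇒p⊓q≡q (⟦⟧-mono (ℕₚ.≤-pred (ℕₚ.≤-trans c< (hi-step r)))))
        (sym (ℚₚ.p≥q⇒p⊓q≡q (⟦⟧-mono (ℕₚ.<⇒≤ c<)))) , refl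
      level (hlink q _ ≤c) = refl , trans (ℚₚ.p≤q⇒p⊔q≡q (⟦⟧-mono (ℕₚ.m≤n⇒m≤1+n ≤c)))
        (sym (ℚₚ.p≤q⇒p⊔q≡q (⟦⟧-mono (ℕₚ.≤-trans (lo-step q) (s≤s ≤c)))))

      linkFace-T : ∀ {e x} (l : Link e) → Link x → x ≢ e → T (linkFace l) x
      linkFace-T {x = x} l k ne = spliced-T hiPt loPt (through l) x (proj₁ (level k)) (through-avoids l k ne) (proj₂ (level k))

      -- If all links were tight, a value at most `c` would be carried down the column and along the
      -- row to the diagonal, where the entry is `hi ρ`, which exceeds `c`.
      module Tight-chain (F : Face′) (tight : ∀ {x} → Link x → T F x) where
        X = proj₁ F

        ρ+κ<N : ρ + κ < N
        ρ+κ<N = free⇒< (ℕₚ.≤-<-trans loκ≤c c<hiρ)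

        down : ∀ d p → d + (p + κ) ≡ N → ρ ≤ p → X p κ ℚ.≤ ⟦ c ⟧
        down zero p e ρ≤p = ℚₚ.≤-trans (ℚₚ.≤-reflexive (fixed (proj₂ F) p κ (ℕₚ.≤-reflexive e) (sym (hi-diag e)))) (⟦⟧-mono loκ≤c)
        down (suc d) p e ρ≤p with c ℕₚ.<? hi p
        ... | yes c< = ℚₚ.≤-trans (ℚₚ.≤-reflexive (sym (tight (vlink p ρ≤p c<))))
                (down d (suc p) (trans (ℕₚ.+-suc d (p + κ)) e) (ℕₚ.m≤n⇒m≤1+n ρ≤p))
        ... | no ≮ = ℚₚ.≤-trans (upper (proj₂ F) p κ (ℕₚ.≤-trans (ℕₚ.m≤n+m (p + κ) (suc d)) (ℕₚ.≤-reflexive e))) (⟦⟧-mono (ℕₚ.≮⇒≥ ≮))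

        along : ∀ k → ρ + (κ + k) ≤ N → X ρ (κ + k) ℚ.≤ ⟦ c ⟧
        along zero h rewrite ℕₚ.+-identityʳ κ = down (N ∸ (ρ + κ)) ρ (ℕₚ.m∸n+n≡m h) ℕₚ.≤-refl
        along (suc k) h = ℚₚ.≤-trans (ℚₚ.≤-reflexive step) prev
          where
          h′ : ρ + (κ + k) ≤ N
          h′ = ℕₚ.≤-trans (ℕₚ.+-monoʳ-≤ ρ (ℕₚ.+-monoʳ-≤ κ (ℕₚ.n≤1+n k))) h
          prev = along k h′
          step : X ρ (κ + suc k) ≡ X ρ (κ + k)
          -- The edge is a link only if `lo` is at most `c` there; this follows from the bound
          -- already obtained, because entries are at least `lo`.
          step = trans (cong (X ρ) (ℕₚ.+-suc κ k)) (sym (tight (hlink (κ + k) (ℕₚ.m≤m+n κ k)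
            (⟦⟧-cancel-≤ (ℚₚ.≤-trans (lower (proj₂ F) ρ (κ + k) h′) prev)))))

        absurd : ⊥
        absurd = ℕₚ.<⇒≱ c<hiρ (⟦⟧-cancel-≤ (ℚₚ.≤-trans (ℚₚ.≤-reflexive (sym
            (trans (fixed (proj₂ F) ρ (κ + k) (ℕₚ.≤-reflexive e) (sym (hi-diag e))) (cong ⟦_⟧ (sym (hi-diag e))))))
            (along k (ℕₚ.≤-reflexive e))))
          where
          k = N ∸ (ρ + κ)
          e : ρ + (κ + k) ≡ N
          e = trans (sym (ℕₚ.+-assoc ρ κ k)) (ℕₚ.m+[n∸m]≡n (ℕₚ.<⇒≤ ρ+κ<N))

    -- The whole chain has no common point, but after the removal of any one link it has. The face
    -- `base` lies on all links except the two chosen ones.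
    conflict : ∀ {e f} → Link e → Link f → e ≢ f → Conflict e f
    conflict {e} {f} l k ne = record
      { base = mid (linkFace l) (linkFace k) ; left = linkFace k ; right = linkFace l
      ; left⊑ = λ x fx t → proj₂ (mid-T⁻ (linkFace l) (linkFace k) x fx t)
      ; right⊑ = λ x fx t → proj₁ (mid-T⁻ (linkFace l) (linkFace k) x fx t)
      ; left-T = linkFace-T k l ne ; right-T = linkFace-T l k (ne ∘ sym)
      ; clash = λ F F⊑ te tf → Tight-chain.absurd F λ {x} j → tight F F⊑ te tf j }
      where
      tight : ∀ F → F ⊑ mid (linkFace l) (linkFace k) → T F e → T F f → ∀ {x} → Link x → T F x
      tight F F⊑ te tf {x} j with x ≟ᴱ e | x ≟ᴱ f
      ... | yes refl | _ = te
      ... | no _ | yes refl = tf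
      ... | no a | no b = F⊑ x (link-facet j) (mid-T (linkFace l) (linkFace k) x (linkFace-T l j a) (linkFace-T k j b))

  lo0<hi0 : lo 0 < hi 0
  lo0<hi0 = ℕₚ.≤-trans (s≤s (ℕₚ.n≤1+n _)) wide

  private
    no-suc : ∀ {P : ℕ → Set} k → 0 ≡ suc k → P k
    no-suc k ()

    below : ∀ {a b} → a < b → ∃ λ c → b ≡ suc c × a ≤ c
    below (s≤s h) = _ , refl , h

  -- The chain is the hook itself. The level decides which edges are links: at `lo 0` all free edges
  -- of the first column, at `hi 0` minus one all free edges of the bottom row, and at `lo q` the
  -- edge `H 0 q` with every `V r 0` for which (r , q) is free.
  conflict-VV : ∀ {r r′} → Free r 0 → Free r′ 0 → r ≢ r′ → Conflict (V r 0) (V r′ 0)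
  conflict-VV {r} {r′} fr fr′ ne = conflict (vlink r z≤n fr) (vlink r′ z≤n fr′) λ { refl → ne refl }
    where open Chain 0 0 (lo 0) ℕₚ.≤-refl lo0<hi0 (no-suc {λ k → lo k < lo 0}) (no-suc {λ k → suc (lo 0) < hi k})

  conflict-HH : ∀ {q q′} → Free 0 q → Free 0 q′ → q ≢ q′ → Conflict (H 0 q) (H 0 q′)
  conflict-HH {q} {q′} fr fr′ ne with below lo0<hi0
  ... | c , hi0≡ , lo0≤c = conflict (hlink q z≤n (ℕₚ.≤-pred (subst (lo q <_) hi0≡ fr)))
          (hlink q′ z≤n (ℕₚ.≤-pred (subst (lo q′ <_) hi0≡ fr′))) λ { refl → ne refl }
    where open Chain 0 0 c lo0≤c (ℕₚ.≤-reflexive (sym hi0≡)) (no-suc {λ k → lo k < c}) (no-suc {λ k → suc c < hi k})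

  conflict-VH : ∀ {r q} → Free r q → Conflict (V r 0) (H 0 q)
  conflict-VH {r} {q} fr = conflict (vlink r z≤n fr) (hlink q z≤n ℕₚ.≤-refl) λ ()
    where open Chain 0 0 (lo q) (lo-mono z≤n) (ℕₚ.<-≤-trans fr (hi-anti z≤n)) (no-suc {λ k → lo k < lo q}) (no-suc {λ k → suc (lo q) < hi k})

  -- Together with `conflict-VH` this recovers the shape from the conflicts: edges of the two arms
  -- of the hook conflict exactly if the position they span is free.
  conflict-VH⁻ : ∀ {r q} → Free r 0 → Free 0 q → Conflict (V r 0) (H 0 q) → Free r q
  conflict-VH⁻ {r} {q} fr fq C = ℕₚ.≰⇒> λ le → ¬conflict (lo q) fr fq le ℕₚ.≤-refl C

  -- The chain turns at row `p + 1` instead of the bottom row, so that it contains the top edge of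
  -- the cell.
  conflict-top : ∀ {r p q} → suc p ≤ r → Free r q → suc (lo q) < hi p → Conflict (V r 0) (H (suc p) q)
  conflict-top {r} {p} {q} p<r fr h = conflict (vlink r p<r fr) (hlink q z≤n ℕₚ.≤-refl) λ ()
    where
    below-p : ∀ ρ′ → suc p ≡ suc ρ′ → suc (lo q) < hi ρ′
    below-p _ refl = h
    open Chain 0 (suc p) (lo q) (lo-mono z≤n) (ℕₚ.<-≤-trans fr (hi-anti p<r)) (no-suc {λ k → lo k < lo q}) below-p

  conflict-right : ∀ {r p q} → suc q ≤ r → Free p r → suc (lo q) < hi p → Conflict (H 0 r) (V p (suc q))
  conflict-right {r} {p} {q} q<r fr h with below fr
  ... | c , hip≡ , lor≤c = conflict (hlink r q<r lor≤c) (vlink p z≤n (ℕₚ.≤-reflexive (sym hip≡))) λ ()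
    where
    before-q : ∀ κ′ → suc q ≡ suc κ′ → lo κ′ < c
    before-q _ refl = ℕₚ.≤-pred (subst (suc (lo q) <_) hip≡ h)
    open Chain (suc q) 0 c (ℕₚ.≤-trans (lo-mono q<r) lor≤c)
      (ℕₚ.<-≤-trans (ℕₚ.≤-reflexive (sym hip≡)) (hi-anti {0} {p} z≤n)) before-q (no-suc {λ k → suc c < hi k})

-- Rigidity

tr : Edge → Edge
tr (V p q) = H q p
tr (H p q) = V q p

tr-tr : ∀ e → tr (tr e) ≡ e
tr-tr (V p q) = refl
tr-tr (H p q) = refl

tr-inj : ∀ {e f} → tr e ≡ tr f → e ≡ f
tr-inj {e} {f} h = trans (sym (tr-tr e)) (trans (cong tr h) (tr-tr f))

tr-In : ∀ {p q e f} → In p q e f → In q p (tr e) (tr f)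
tr-In vh = hv
tr-In hv = vh

tr-Out : ∀ {p q e f} → Out p q e f → Out q p (tr e) (tr f)
tr-Out vh = hv
tr-Out hv = vh

-- Forgets that the squares are cells. The transpose of a cell is not yet known to be a cell when a
-- symmetry composed with the transposition is examined.
data RawQuad (e f g : Edge) : Set where
  inR  : ∀ p q h → In p q e f → Out p q g h → RawQuad e f g
  outR : ∀ p q h → Out p q e f → In p q g h → RawQuad e f g

tr-RawQuad : ∀ {e f g} → RawQuad e f g → RawQuad (tr e) (tr f) (tr g)
tr-RawQuad (inR p q h i o)  = inR q p _ (tr-In i) (tr-Out o)
tr-RawQuad (outR p q h o i) = outR q p _ (tr-Out o) (tr-In i)

data RawPair (e f : Edge) : Set where
  inP  : ∀ p q → In p q e f → RawPair e f
  outP : ∀ p q → Out p q e f → RawPair e f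

rawPair : ∀ {e f g} → RawQuad e f g → RawPair e f
rawPair (inR p q h i o)  = inP p q i
rawPair (outR p q h o i) = outP p q o

module Pairs (S : Shape) where
  open Shape S
  open Poly S
  open Symmetry S

  Pair : Edge → Edge → Set
  Pair e f = ∃₂ λ p q → Cell p q × (In p q e f ⊎ Out p q e f)

  quad-pair : ∀ {e f g} → Quad e f g → Pair e f
  quad-pair (inQ y i o)  = _ , _ , y , inj₁ i
  quad-pair (outQ y o i) = _ , _ , y , inj₂ o

  pair-facet : ∀ {e f} → Pair e f → Facet e × Facet f
  pair-facet (_ , _ , y , inj₁ i) = in-facets y i
  pair-facet (_ , _ , y , inj₂ o) = out-facets y o

  pair-π : (A : Sym) → ∀ {e f} → Pair e f → Pair (π A e) (π A f)
  pair-π A (p , q , y , inj₁ i) = quad-pair (in-quad A y i hv)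
  pair-π A (p , q , y , inj₂ o) = quad-pair (out-quad A y o vh)

  pair-π⁻ : (A : Sym) → ∀ {e f} → Facet e → Facet f → Pair (π A e) (π A f) → Pair e f
  pair-π⁻ A fe ff h = subst₂ Pair (π⁻π A fe) (π⁻π A ff) (pair-π (inv A) h)

  raw : ∀ {e f g} → Quad e f g → RawQuad e f g
  raw (inQ y i o)  = inR _ _ _ i o
  raw (outQ y o i) = outR _ _ _ o i

  -- Stated for a map of edges, since it is applied to `π G` and to `π G` followed by the
  -- transposition. `φ-top` and `φ-right` say that the partner of an image among the out-edges of a
  -- cell is the image of a partner.
  module Spread (φ : Edge → Edge)
    (φ-quad : ∀ {p q e f g h} → Cell p q → In p q e f → Out p q g h → RawQuad (φ e) (φ f) (φ g))
    (φ-inj : ∀ {e f} → Facet e → Facet f → φ e ≡ φ f → e ≡ f)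
    (φ-top : ∀ {e a b} → Facet e → φ e ≡ H (suc a) b → ∃ λ e′ → φ e′ ≡ V a (suc b) × Pair e e′)
    (φ-right : ∀ {e a b} → Facet e → φ e ≡ V a (suc b) → ∃ λ e′ → φ e′ ≡ H (suc a) b × Pair e e′)
    (φ-V : φ (V 0 0) ≡ V 0 0) (φ-H : φ (H 0 0) ≡ H 0 0) (φ-up : φ (H 1 0) ≡ H 1 0) where

    Fixed : ℕ → ℕ → Set
    Fixed p q = φ (V p q) ≡ V p q × φ (H p q) ≡ H p q

    data OutImage (p q : ℕ) : Set where
      same : φ (H (suc p) q) ≡ H (suc p) q → φ (V p (suc q)) ≡ V p (suc q) → OutImage p q
      swap : φ (H (suc p) q) ≡ V p (suc q) → φ (V p (suc q)) ≡ H (suc p) q → OutImage p q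

    private
      out-of : ∀ {p q g} → RawQuad (V p q) (H p q) g → g ≡ H (suc p) q ⊎ g ≡ V p (suc q)
      out-of (inR p q h vh hv) = inj₁ refl
      out-of (inR p q h vh vh) = inj₂ refl
      out-of (outR p q h () i)

    out-image : ∀ {p q} → Cell p q → Fixed p q → OutImage p q
    out-image {p} {q} y (a , b) with out-of (subst₂ (λ e f → RawQuad e f (φ (H (suc p) q))) a b (φ-quad y vh hv))
                                   | out-of (subst₂ (λ e f → RawQuad e f (φ (V p (suc q)))) a b (φ-quad y vh vh))
    ... | inj₁ s | inj₂ t = same s t
    ... | inj₂ s | inj₁ t = swap s t
    ... | inj₁ s | inj₁ t with φ-inj {H (suc p) q} {V p (suc q)} y y (trans s (sym t))
    ...   | ()
    out-image {p} {q} y (a , b) | inj₂ s | inj₂ t with φ-inj {H (suc p) q} {V p (suc q)} y y (trans s (sym t))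
    ...   | ()

    private
      in-raw : ∀ {p q} → Cell p q → RawPair (φ (V p q)) (φ (H p q))
      in-raw y = rawPair (φ-quad y vh hv)

      fix-up : ∀ {p} → Cell p 0 → Cell (suc p) 0 → φ (H (suc p) 0) ≡ H (suc p) 0 → φ (V p 1) ≡ V p 1 → Fixed (suc p) 0
      fix-up {p} y₀ y a b with φ (V (suc p) 0) in eq | subst (RawPair (φ (V (suc p) 0))) a (in-raw y)
      ... | _ | inP _ _ vh = refl , a
      ... | _ | outP _ _ vh with φ-inj {V (suc p) 0} {V p 1} (cell-V y) y₀ (trans eq (sym b))
      ...   | ()

      fix-right : ∀ {q} → Cell 0 q → Cell 0 (suc q) → φ (V 0 (suc q)) ≡ V 0 (suc q) → φ (H 1 q) ≡ H 1 q → Fixed 0 (suc q)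
      fix-right {q} y₀ y a b with φ (H 0 (suc q)) in eq | subst (λ x → RawPair x (φ (H 0 (suc q)))) a (in-raw y)
      ... | _ | inP _ _ vh = a , refl
      ... | _ | outP _ _ vh with φ-inj {H 0 (suc q)} {H 1 q} (cell-H y) y₀ (trans eq (sym b))
      ...   | ()

      -- V (p + 1) 0 lies in one cell only, and so must its image.
      no-swap-up : ∀ {p} → Cell (suc p) 0 → Cell (suc (suc p)) 0 → φ (H (suc (suc p)) 0) ≡ V (suc p) 1 →
        φ (V (suc p) 1) ≡ H (suc (suc p)) 0 → ⊥
      no-swap-up {p} y₀ y a b with φ (V (suc (suc p)) 0) in eq | subst (RawPair (φ (V (suc (suc p)) 0))) a (in-raw y)
      ... | _ | outP _ _ hv with φ-inj {V (suc (suc p)) 0} {V (suc p) 1} (cell-V y) y₀ (trans eq (sym b))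
      ...   | ()
      no-swap-up {p} y₀ y a b | _ | inP _ _ hv with φ-top (cell-V y) eq
      ... | e′ , e′≡ , (_ , _ , _ , inj₁ vh) with trans (sym a) e′≡
      ...   | ()

      no-swap-right : ∀ {q} → Cell 0 (suc q) → Cell 0 (suc (suc q)) → φ (V 0 (suc (suc q))) ≡ H 1 (suc q) →
        φ (H 1 (suc q)) ≡ V 0 (suc (suc q)) → ⊥
      no-swap-right {q} y₀ y a b with φ (H 0 (suc (suc q))) in eq | subst (λ x → RawPair x (φ (H 0 (suc (suc q))))) a (in-raw y)
      ... | _ | outP _ _ hv with φ-inj {H 0 (suc (suc q))} {H 1 (suc q)} (cell-H y) y₀ (trans eq (sym b))
      ...   | ()
      no-swap-right {q} y₀ y a b | _ | inP _ _ hv with φ-right (cell-H y) eq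
      ... | e′ , e′≡ , (_ , _ , _ , inj₁ hv) with trans (sym a) e′≡
      ...   | ()

      -- The in-edges of this cell are out-edges of two different cells. An exchange at either of
      -- them, or at both, would send the in-edges to two edges that are no pair at any cell.
      fix-inner : ∀ {p q} → Cell (suc p) (suc q) → OutImage (suc p) q → OutImage p (suc q) → Fixed (suc p) (suc q)
      fix-inner y (same _ b) (same a _) = b , a
      fix-inner y (same _ b) (swap a _) with subst₂ RawPair b a (in-raw y)
      ... | inP _ _ ()
      ... | outP _ _ ()
      fix-inner y (swap _ b) (same a _) with subst₂ RawPair b a (in-raw y)
      ... | inP _ _ ()
      ... | outP _ _ ()
      fix-inner y (swap _ b) (swap a _) with subst₂ RawPair b a (in-raw y)
      ... | inP _ _ ()
      ... | outP _ _ ()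

      fix-1-0 : Cell 1 0 → OutImage 0 0 → Cell 0 0 → Fixed 1 0
      fix-1-0 y (same a b) y₀ = fix-up y₀ y a b
      fix-1-0 y (swap a b) y₀ with trans (sym a) φ-up
      ... | ()

      fix-0-1 : Cell 0 1 → OutImage 0 0 → Cell 0 0 → Fixed 0 1
      fix-0-1 y (same a b) y₀ = fix-right y₀ y b a
      fix-0-1 y (swap a b) y₀ with trans (sym a) φ-up
      ... | ()

      fix-up′ : ∀ {p} → Cell (suc (suc p)) 0 → OutImage (suc p) 0 → Cell (suc p) 0 → Fixed (suc (suc p)) 0
      fix-up′ y (same a b) y₀ = fix-up y₀ y a b
      fix-up′ y (swap a b) y₀ = ⊥-elim (no-swap-up y₀ y a b)

      fix-right′ : ∀ {q} → Cell 0 (suc (suc q)) → OutImage 0 (suc q) → Cell 0 (suc q) → Fixed 0 (suc (suc q))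
      fix-right′ y (same a b) y₀ = fix-right y₀ y b a
      fix-right′ y (swap a b) y₀ = ⊥-elim (no-swap-right y₀ y b a)

    cell-left : ∀ {p q} → Cell p (suc q) → Cell p q
    cell-left = cell-down ℕₚ.≤-refl (ℕₚ.n≤1+n _)

    cell-below : ∀ {p q} → Cell (suc p) q → Cell p q
    cell-below = cell-down (ℕₚ.n≤1+n _) ℕₚ.≤-refl

    -- Off the hook the two predecessors of a cell control each other. A cell on the hook has only
    -- one, and an exchange is excluded by the lonely edge of the hook; at the corner this is the
    -- hypothesis `φ-up`.
    fixed-in : ∀ p q → Cell p q → Fixed p q
    fixed-in zero zero y = φ-V , φ-H
    fixed-in (suc zero) zero y = fix-1-0 y (out-image (cell-below y) (fixed-in 0 0 (cell-below y))) (cell-below y)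
    fixed-in (suc (suc p)) zero y = fix-up′ y (out-image (cell-below y) (fixed-in (suc p) 0 (cell-below y))) (cell-below y)
    fixed-in zero (suc zero) y = fix-0-1 y (out-image (cell-left y) (fixed-in 0 0 (cell-left y))) (cell-left y)
    fixed-in zero (suc (suc q)) y = fix-right′ y (out-image (cell-left y) (fixed-in 0 (suc q) (cell-left y))) (cell-left y)
    fixed-in (suc p) (suc q) y = fix-inner y (out-image (cell-left y) (fixed-in (suc p) q (cell-left y)))
                                             (out-image (cell-below y) (fixed-in p (suc q) (cell-below y)))

last-before : (P : ℕ → Set) → (∀ k → Dec (P k)) → ∀ n → P 0 → ¬ P n → ∃ λ k → P k × ¬ P (suc k)
last-before P P? zero p0 ¬pn = ⊥-elim (¬pn p0)
last-before P P? (suc n) p0 ¬pn with P? n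
... | yes pn = n , pn , ¬pn
... | no ¬p = last-before P P? n p0 ¬p

module Rigidity (S : Shape) where
  open Shape S
  open Poly S
  open Points S using (thin)
  open Symmetry S
  open Conflicts S
  open Pairs S

  -- The edges lying in no cell, which run along the two ends of the hook.
  data IsA : Edge → Set where
    isA : ∀ {p} → Free p 0 → ¬ Cell p 0 → IsA (V p 0)

  data IsB : Edge → Set where
    isB : ∀ {q} → Free 0 q → ¬ Cell 0 q → IsB (H 0 q)

  A-facet : ∀ {e} → IsA e → Facet e
  A-facet (isA f _) = f

  B-facet : ∀ {e} → IsB e → Facet e
  B-facet (isB f _) = f

  A-hi : ∀ {e} → IsA e → hi (row e) ≡ suc (lo 0)
  A-hi (isA f n) = thin f n

  B-lo : ∀ {e} → IsB e → hi 0 ≡ suc (lo (col e))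
  B-lo (isB f n) = thin f n

  A≢B : ∀ {e} → IsA e → IsB e → ⊥
  A≢B (isA _ _) ()

  free10 : Free 1 0
  free10 = ℕₚ.≤-pred (ℕₚ.≤-trans wide (hi-step 0))

  cell00 : Cell 0 0
  cell00 = free10 , ℕₚ.≤-trans (s≤s (lo-step 0)) wide

  lonely : ∀ {e} → Facet e → (∀ f → ¬ Pair e f) → IsA e ⊎ IsB e
  lonely {V p zero} fe n with cell? p 0
  ... | yes y = ⊥-elim (n _ (p , 0 , y , inj₁ vh))
  ... | no ¬y = inj₁ (isA fe ¬y)
  lonely {H zero q} fe n with cell? 0 q
  ... | yes y = ⊥-elim (n _ (0 , q , y , inj₁ hv))
  ... | no ¬y = inj₂ (isB fe ¬y)
  lonely {V p (suc q)} fe n = ⊥-elim (n _ (p , q , fe , inj₂ vh))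
  lonely {H (suc p) q} fe n = ⊥-elim (n _ (p , q , fe , inj₂ hv))

  A-lonely : ∀ {e f} → IsA e → ¬ Pair e f
  A-lonely (isA _ n) (_ , _ , y , inj₁ vh) = n y
  A-lonely (isA _ n) (_ , _ , y , inj₂ ())

  B-lonely : ∀ {e f} → IsB e → ¬ Pair e f
  B-lonely (isB _ n) (_ , _ , y , inj₁ hv) = n y
  B-lonely (isB _ n) (_ , _ , y , inj₂ ())

  -- Values on the edges of A are at most `lo 0` plus one, on those of B at least `hi 0` minus one.
  -- By `wide` a level separates them.
  A-B-¬conflict : ∀ {e f} → IsA e → IsB f → ¬ Conflict e f
  A-B-¬conflict a b = ¬conflict (suc (lo 0)) (A-facet a) (B-facet b) (ℕₚ.≤-reflexive (A-hi a))
    (ℕₚ.≤-pred (ℕₚ.≤-trans wide (ℕₚ.≤-reflexive (B-lo b))))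

  A-A-conflict : ∀ {e f} → IsA e → IsA f → e ≢ f → Conflict e f
  A-A-conflict (isA f _) (isA g _) ne = conflict-VV f g λ { refl → ne refl }

  B-B-conflict : ∀ {e f} → IsB e → IsB f → e ≢ f → Conflict e f
  B-B-conflict (isB f _) (isB g _) ne = conflict-HH f g λ { refl → ne refl }

  topA : ∃ λ p → IsA (V p 0)
  topA with last-before (λ p → Free p 0) (λ p → free? p 0) N lo0<hi0 (λ h → ℕₚ.<⇒≢ h (sym (hi-diag (ℕₚ.+-identityʳ N))))
  ... | p , f , n = p , isA f (n ∘ proj₁)

  lastB : ∃ λ q → IsB (H 0 q)
  lastB with last-before (λ q → Free 0 q) (λ q → free? 0 q) N lo0<hi0 (λ h → ℕₚ.<⇒≢ h (sym (hi-diag {0} {N} refl)))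
  ... | q , f , n = q , isB f (n ∘ proj₂)

  a₀ b₀ : Edge
  a₀ = V (proj₁ topA) 0
  b₀ = H 0 (proj₁ lastB)

  a₀-A : IsA a₀
  a₀-A = proj₂ topA

  b₀-B : IsB b₀
  b₀-B = proj₂ lastB

  Keeps Swaps : Sym → Set
  Keeps G = (∀ {e} → IsA e → IsA (π G e)) × (∀ {e} → IsB e → IsB (π G e))
  Swaps G = (∀ {e} → IsA e → IsB (π G e)) × (∀ {e} → IsB e → IsA (π G e))

  module _ (G : Sym) where

    private
      π-lonely : ∀ {e} → Facet e → (∀ f → ¬ Pair e f) → ∀ f → ¬ Pair (π G e) f
      π-lonely {e} fe n f h = n (π⁻ G f) (pair-π⁻ G fe (π⁻-F G ff) (subst (Pair (π G e)) (sym (ππ⁻ G ff)) h))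
        where ff = proj₂ (pair-facet h)

      A-image : ∀ {e} → IsA e → IsA (π G e) ⊎ IsB (π G e)
      A-image a = lonely (π-F G (A-facet a)) (π-lonely (A-facet a) λ f → A-lonely a)

      B-image : ∀ {e} → IsB e → IsA (π G e) ⊎ IsB (π G e)
      B-image b = lonely (π-F G (B-facet b)) (π-lonely (B-facet b) λ f → B-lonely b)

    -- Any two edges of A conflict, likewise of B, but never one of A with one of B. So the images
    -- of A lie all in A or all in B, and those of B follow.
    keeps-or-swaps : Keeps G ⊎ Swaps G
    keeps-or-swaps with A-image a₀-A
    ... | inj₁ a₀A = inj₁ (keepA , keepB)
      where
      keepA : ∀ {e} → IsA e → IsA (π G e)
      keepA {e} a with A-image a | e ≟ᴱ a₀
      ... | inj₁ x | _ = x
      ... | inj₂ x | yes refl = a₀A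
      ... | inj₂ x | no ne = ⊥-elim (A-B-¬conflict a₀A x
              (conflict-sym (conflict-π G (A-facet a) (A-facet a₀-A) (A-A-conflict a a₀-A ne))))
      keepB : ∀ {e} → IsB e → IsB (π G e)
      keepB {e} b with B-image b
      ... | inj₂ x = x
      ... | inj₁ x = ⊥-elim (A-B-¬conflict a₀-A b (conflict-π⁻ G (A-facet a₀-A) (B-facet b)
              (A-A-conflict a₀A x λ eq → A≢B (subst IsA (π-inj G (A-facet a₀-A) (B-facet b) eq) a₀-A) b)))
    ... | inj₂ a₀B = inj₂ (swapA , swapB)
      where
      swapA : ∀ {e} → IsA e → IsB (π G e)
      swapA {e} a with A-image a | e ≟ᴱ a₀
      ... | inj₂ x | _ = x
      ... | inj₁ x | yes refl = a₀B
      ... | inj₁ x | no ne = ⊥-elim (A-B-¬conflict x a₀B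
              (conflict-π G (A-facet a) (A-facet a₀-A) (A-A-conflict a a₀-A ne)))
      swapB : ∀ {e} → IsB e → IsA (π G e)
      swapB {e} b with B-image b
      ... | inj₁ x = x
      ... | inj₂ x = ⊥-elim (A-B-¬conflict a₀-A b (conflict-π⁻ G (A-facet a₀-A) (B-facet b)
              (B-B-conflict a₀B x λ eq → A≢B (subst IsA (π-inj G (A-facet a₀-A) (B-facet b) eq) a₀-A) b)))

    private
      -- A sink edge of level k conflicts with nothing at another level, and A and B have different levels.
      sink-clash : ∀ {x y e} → IsA x → IsB y → Facet e → ¬ Cell (row e) (col e) → Conflict e x → Conflict e y → ⊥
      sink-clash {x} {y} {e} a b fe n cx cy = ℕₚ.<⇒≱ wide (ℕₚ.≤-trans (ℕₚ.≤-reflexive (B-lo b)) (ℕₚ.≤-trans (s≤s (ℕₚ.≤-pred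
          (ℕₚ.≤-trans loy<hie (ℕₚ.≤-reflexive (thin (facet⇒free e fe) n))))) loe<))
        where
        loy<hie : lo (col y) < hi (row e)
        loy<hie = ℕₚ.≰⇒> λ le → ¬conflict _ fe (B-facet b) le ℕₚ.≤-refl cy
        loe< : suc (lo (col e)) ≤ suc (lo 0)
        loe< = ℕₚ.≰⇒> λ le → ¬conflict _ (A-facet a) fe (ℕₚ.≤-reflexive (A-hi a)) le (conflict-sym cx)

      V00-a₀ : Conflict (V 0 0) a₀
      V00-a₀ = go a₀-A
        where
        go : ∀ {e} → IsA e → Conflict (V 0 0) e
        go (isA f n) = conflict-VV lo0<hi0 f λ { refl → n cell00 }

      V00-b₀ : Conflict (V 0 0) b₀
      V00-b₀ = conflict-VH (B-facet b₀-B)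

      f-V00 : Facet (V 0 0)
      f-V00 = lo0<hi0
      f-H00 : Facet (H 0 0)
      f-H00 = lo0<hi0

      no-sink : Facet (π G (V 0 0)) → ¬ Cell (row (π G (V 0 0))) (col (π G (V 0 0))) → ⊥
      no-sink fe n with keeps-or-swaps
      ... | inj₁ (kA , kB) = sink-clash (kA a₀-A) (kB b₀-B) fe n
              (conflict-π G f-V00 (A-facet a₀-A) V00-a₀) (conflict-π G f-V00 (B-facet b₀-B) V00-b₀)
      ... | inj₂ (sA , sB) = sink-clash (sB b₀-B) (sA a₀-A) fe n
              (conflict-π G f-V00 (B-facet b₀-B) V00-b₀) (conflict-π G f-V00 (A-facet a₀-A) V00-a₀)

      pair-V00 : ∀ {f} → Pair (V 0 0) f → f ≡ H 0 0
      pair-V00 (_ , _ , _ , inj₁ vh) = refl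
      pair-V00 (_ , _ , _ , inj₂ ())

      pair-H00 : ∀ {f} → Pair (H 0 0) f → f ≡ V 0 0
      pair-H00 (_ , _ , _ , inj₁ hv) = refl
      pair-H00 (_ , _ , _ , inj₂ ())

      partner : ∀ {e e′} → Facet e → (∀ {f} → Pair e f → f ≡ e′) → ∀ {x f} → π G e ≡ x → Pair x f → f ≡ π G e′
      partner fe u refl h = trans (sym (ππ⁻ G ff)) (cong (π G)
          (u (pair-π⁻ G fe (π⁻-F G ff) (subst (Pair _) (sym (ππ⁻ G ff)) h))))
        where ff = proj₂ (pair-facet h)

      partnerV : ∀ {x y f} → π G (V 0 0) ≡ x → π G (H 0 0) ≡ y → Pair x f → f ≡ y
      partnerV e e′ h = trans (partner f-V00 pair-V00 e h) e′

      partnerH : ∀ {x y f} → π G (V 0 0) ≡ x → π G (H 0 0) ≡ y → Pair y f → f ≡ x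
      partnerH e e′ h = trans (partner f-H00 pair-H00 e′ h) e

    corner : (π G (V 0 0) ≡ V 0 0 × π G (H 0 0) ≡ H 0 0) ⊎ (π G (V 0 0) ≡ H 0 0 × π G (H 0 0) ≡ V 0 0)
    corner with π G (V 0 0) in eV | π G (H 0 0) in eH | pair-π G (0 , 0 , cell00 , inj₁ vh)
    ... | _ | _ | zero , zero , y , inj₁ vh = inj₁ (refl , refl)
    ... | _ | _ | zero , zero , y , inj₁ hv = inj₂ (refl , refl)
    -- Outside the first column the vertical in-edge is also the right side of the neighbouring cell
    -- and has a second partner there. The other cases of in-edges are alike.
    ... | _ | _ | p , suc q , y , inj₁ vh with partnerV eV eH (p , q , cell-V y , inj₂ vh)
    ...   | ()
    corner | _ | _ | p , suc q , y , inj₁ hv with partnerH eV eH (p , q , cell-V y , inj₂ vh)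
    ...   | ()
    corner | _ | _ | suc p , zero , y , inj₁ vh with partnerH eV eH (p , zero , cell-H y , inj₂ hv)
    ...   | ()
    corner | _ | _ | suc p , zero , y , inj₁ hv with partnerV eV eH (p , zero , cell-H y , inj₂ hv)
    ...   | ()
    -- If the image enters a further cell, it has a second partner there; if it enters none, it
    -- leads to a sink, which `no-sink` excludes.
    corner | _ | _ | p , q , y , inj₂ hv = ⊥-elim (no-sink (π-F G f-V00)
      (subst (λ e → ¬ Cell (row e) (col e)) (sym eV) λ c → go (partnerV eV eH (suc p , q , c , inj₁ hv))))
      where go : V (suc p) q ≡ V p (suc q) → ⊥
            go ()
    corner | _ | _ | p , q , y , inj₂ vh = ⊥-elim (no-sink (π-F G f-V00)
      (subst (λ e → ¬ Cell (row e) (col e)) (sym eV) λ c → go (partnerV eV eH (p , suc q , c , inj₁ vh))))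
      where go : H p (suc q) ≡ H (suc p) q → ⊥
            go ()

  -- The last row with the greatest upper bound; for a partition, `p + 1` is the multiplicity of the
  -- greatest part.
  Drop : ℕ → Set
  Drop p = hi 0 ≤ hi p × ¬ (hi 0 ≤ hi (suc p))

  drop : ∃ Drop
  drop = last-before (λ p → hi 0 ≤ hi p) (λ p → hi 0 ℕₚ.≤? hi p) N ℕₚ.≤-refl
    (λ h → ℕₚ.<⇒≱ lo0<hi0 (ℕₚ.≤-trans h (ℕₚ.≤-reflexive (hi-diag (ℕₚ.+-identityʳ N)))))

  module _ (lo1≤ : lo 1 ≤ lo 0) {p : ℕ} (d : Drop p) where
    private
      sl<hip : suc (lo 0) < hi p
      sl<hip = ℕₚ.≤-trans wide (proj₁ d)

      l<hisp : lo 0 < hi (suc p)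
      l<hisp = ℕₚ.≤-pred (ℕₚ.≤-trans sl<hip (hi-step p))

    drop-cell₀ : Cell p 0
    drop-cell₀ = l<hisp , ℕₚ.≤-<-trans lo1≤ (ℕₚ.<-trans (ℕₚ.n<1+n _) sl<hip)

    drop-cell₁ : Cell p 1
    drop-cell₁ = ℕₚ.≤-<-trans lo1≤ l<hisp , ℕₚ.≤-<-trans (ℕₚ.≤-trans (lo-step 1) (s≤s lo1≤)) sl<hip

    drop-conflict : Conflict a₀ (H (suc p) 0)
    drop-conflict = conflict-top (ℕₚ.≰⇒> λ ra≤p → ℕₚ.<⇒≱ sl<hip (ℕₚ.≤-trans (hi-anti ra≤p) (ℕₚ.≤-reflexive (A-hi a₀-A))))
      (A-facet a₀-A) sl<hip

  b₀-conflict : Conflict b₀ (V 0 1)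
  b₀-conflict = go b₀-B
    where
    go : ∀ {e} → IsB e → Conflict e (V 0 1)
    go (isB {zero} f n) = ⊥-elim (n cell00)
    go (isB {suc q} f n) = conflict-right (s≤s z≤n) f wide

  module Straight (G : Sym) (πV : π G (V 0 0) ≡ V 0 0) (πH : π G (H 0 0) ≡ H 0 0) (π↑ : π G (H 1 0) ≡ H 1 0) where

    private
      φ-top : ∀ {e a b} → Facet e → π G e ≡ H (suc a) b → ∃ λ e′ → π G e′ ≡ V a (suc b) × Pair e e′
      φ-top {e} {a} {b} fe eq = π⁻ G (V a (suc b)) , ππ⁻ G {V a (suc b)} y ,
          pair-π⁻ G fe (π⁻-F G {V a (suc b)} y) (subst₂ Pair (sym eq) (sym (ππ⁻ G {V a (suc b)} y)) (a , b , y , inj₂ hv))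
        where y : Cell a b
              y = subst Facet eq (π-F G fe)

      φ-right : ∀ {e a b} → Facet e → π G e ≡ V a (suc b) → ∃ λ e′ → π G e′ ≡ H (suc a) b × Pair e e′
      φ-right {e} {a} {b} fe eq = π⁻ G (H (suc a) b) , ππ⁻ G {H (suc a) b} y ,
          pair-π⁻ G fe (π⁻-F G {H (suc a) b} y) (subst₂ Pair (sym eq) (sym (ππ⁻ G {H (suc a) b} y)) (a , b , y , inj₂ vh))
        where y : Cell a b
              y = subst Facet eq (π-F G fe)

    open Spread (π G) (λ y i o → raw (in-quad G y i o)) (π-inj G) φ-top φ-right πV πH π↑ public

    private
      same₀₀ : π G (V 0 1) ≡ V 0 1
      same₀₀ with out-image cell00 (πV , πH)
      ... | same _ b = b
      ... | swap a _ with trans (sym a) π↑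
      ...   | ()

      -- The ends are told apart by a fixed facet. If `lo 1` exceeds `lo 0`, this is `V 0 1`: it
      -- conflicts with B and lies above the level of A. Otherwise it is `H (suc p) 0` at the drop:
      -- it conflicts with A and lies below the level of B, and it is fixed because `V p 1` enters a
      -- cell.
      ¬swaps : ¬ Swaps G
      ¬swaps (sA , sB) with lo 1 ℕₚ.≤? lo 0
      ... | no lo1≰ = ¬conflict (suc (lo 0)) (A-facet (sB b₀-B)) (cell-right {0} {0} cell00)
              (ℕₚ.≤-reflexive (A-hi (sB b₀-B))) (ℕₚ.≰⇒> lo1≰)
              (subst (Conflict (π G b₀)) same₀₀ (conflict-π G (B-facet b₀-B) (cell-right {0} {0} cell00) b₀-conflict))
      ... | yes lo1≤ with drop
      ...   | p , d with out-image (drop-cell₀ lo1≤ d) (fixed-in p 0 (drop-cell₀ lo1≤ d)) | proj₁ (fixed-in p 1 (drop-cell₁ lo1≤ d))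
      ...     | swap _ b | c with trans (sym b) c
      ...       | ()
      ¬swaps (sA , sB) | yes lo1≤ | p , d | same a _ | _ =
        ¬conflict (hi (suc p)) (cell-top {p} {0} (drop-cell₀ lo1≤ d)) (B-facet (sA a₀-A)) ℕₚ.≤-refl
          (ℕₚ.≤-pred (ℕₚ.≤-trans (ℕₚ.≰⇒> (proj₂ d)) (ℕₚ.≤-reflexive (B-lo (sA a₀-A)))))
          (conflict-sym (subst (Conflict (π G a₀)) a
            (conflict-π G (A-facet a₀-A) (cell-top {p} {0} (drop-cell₀ lo1≤ d)) (drop-conflict lo1≤ d))))

    keeps : Keeps G
    keeps with keeps-or-swaps G
    ... | inj₁ k = k
    ... | inj₂ s = ⊥-elim (¬swaps s)

    -- The two out-edges of a cell can only be exchanged if they lead to the same sink.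
    swap-corner : ∀ {p q} → Cell p q → π G (H (suc p) q) ≡ V p (suc q) → π G (V p (suc q)) ≡ H (suc p) q →
      Free (suc p) (suc q) × ¬ Cell (suc p) q × ¬ Cell p (suc q)
    swap-corner {p} {q} y a b = free , ¬up , ¬right
      where
      ¬up : ¬ Cell (suc p) q
      ¬up c with trans (sym a) (proj₂ (fixed-in (suc p) q c))
      ... | ()
      ¬right : ¬ Cell p (suc q)
      ¬right c with trans (sym b) (proj₁ (fixed-in p (suc q) c))
      ... | ()
      free : Free (suc p) (suc q)
      free = ℕₚ.≰⇒> λ hi≤lo → clash hi≤lo
        where
        g : Edge
        g = V (suc p) 0
        fg : Facet g
        fg = free-down ℕₚ.≤-refl z≤n (proj₁ y)
        level : hi (suc p) ≤ lo (suc q) → hi (row (π G g)) ≤ lo (suc q)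
        level h with cell? (suc p) 0
        ... | yes c = subst (λ e → hi (row e) ≤ lo (suc q)) (sym (proj₁ (fixed-in (suc p) 0 c))) h
        ... | no n = ℕₚ.≤-trans (ℕₚ.≤-reflexive (trans (A-hi (proj₁ keeps (isA fg n))) (sym (thin fg n)))) h
        clash : hi (suc p) ≤ lo (suc q) → ⊥
        clash h = ¬conflict (lo (suc q)) (π-F G fg) (cell-right {p} {q} y) (level h) ℕₚ.≤-refl
          (subst (Conflict (π G g)) a (conflict-π G fg (cell-top {p} {q} y)
            (conflict-top ℕₚ.≤-refl (proj₁ y) (ℕₚ.≤-<-trans (ℕₚ.≤-trans (proj₁ y) h) (proj₂ y)))))

  module Reflected (G : Sym) (πV : π G (V 0 0) ≡ H 0 0) (πH : π G (H 0 0) ≡ V 0 0) (π↑ : π G (H 1 0) ≡ V 0 1) where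

    private
      un-tr : ∀ {e f} → tr e ≡ f → e ≡ tr f
      un-tr {e} refl = sym (tr-tr e)

      φ : Edge → Edge
      φ e = tr (π G e)

      φ-top : ∀ {e a b} → Facet e → φ e ≡ H (suc a) b → ∃ λ e′ → φ e′ ≡ V a (suc b) × Pair e e′
      φ-top {e} {a} {b} fe eq = π⁻ G (H (suc b) a) , cong tr (ππ⁻ G {H (suc b) a} y) ,
          pair-π⁻ G fe (π⁻-F G {H (suc b) a} y) (subst₂ Pair (sym (un-tr eq)) (sym (ππ⁻ G {H (suc b) a} y)) (b , a , y , inj₂ vh))
        where y : Cell b a
              y = subst Facet (un-tr eq) (π-F G fe)

      φ-right : ∀ {e a b} → Facet e → φ e ≡ V a (suc b) → ∃ λ e′ → φ e′ ≡ H (suc a) b × Pair e e′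
      φ-right {e} {a} {b} fe eq = π⁻ G (V b (suc a)) , cong tr (ππ⁻ G {V b (suc a)} y) ,
          pair-π⁻ G fe (π⁻-F G {V b (suc a)} y) (subst₂ Pair (sym (un-tr eq)) (sym (ππ⁻ G {V b (suc a)} y)) (b , a , y , inj₂ hv))
        where y : Cell b a
              y = subst Facet (un-tr eq) (π-F G fe)

      open Spread φ (λ y i o → tr-RawQuad (raw (in-quad G y i o)))
        (λ fe ff h → π-inj G fe ff (tr-inj h)) φ-top φ-right (cong tr πV) (cong tr πH) (cong tr π↑)

      im-V : ∀ {p q} → Cell p q → π G (V p q) ≡ H q p
      im-V y = un-tr (proj₁ (fixed-in _ _ y))

      im-H : ∀ {p q} → Cell p q → π G (H p q) ≡ V q p
      im-H y = un-tr (proj₂ (fixed-in _ _ y))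

      -- The images `H q p` and `V q p` of the in-edges form a pair, which is possible only as the
      -- in-edges of the cell (q , p).
      cell-tr : ∀ {p q} → Cell p q → Cell q p
      cell-tr {p} {q} y with subst₂ Pair (im-V y) (im-H y) (pair-π G (p , q , y , inj₁ vh))
      ... | _ , _ , c , inj₁ hv = c
      ... | _ , _ , c , inj₂ ()

      same₀₀ : π G (V 0 1) ≡ H 1 0
      same₀₀ with out-image cell00 (cong tr πV , cong tr πH)
      ... | same _ b = un-tr b
      ... | swap a _ with trans (sym a) (cong tr π↑)
      ...   | ()

      -- If A and B were preserved while the cells are transposed, conflicts with A would force
      -- every cell of the bottom row to have the least `lo`, and conflicts with B every cell of the
      -- first column the greatest `hi`. The facets used for `¬swaps` then yield a cell that
      -- violates this.
      module ¬Keeps (k : Keeps G) where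

        row₀ : ∀ {q} → Cell 0 q → lo q ≤ lo 0
        row₀ {q} y = ℕₚ.≮⇒≥ λ lo< → ¬conflict (suc (lo 0)) (A-facet a₀-A) (cell-H y) (ℕₚ.≤-reflexive (A-hi a₀-A)) lo<
          (conflict-π⁻ G (A-facet a₀-A) (cell-H y) (subst (Conflict (π G a₀)) (sym (im-H y)) (vv (proj₁ k a₀-A))))
          where
          vv : ∀ {e} → IsA e → Conflict e (V q 0)
          vv (isA f n) = conflict-VV f (cell-V (cell-tr y)) λ { refl → n (cell-tr y) }

        col₀ : ∀ {c} → Cell c 0 → hi 0 ≤ hi c
        col₀ {c} y = ℕₚ.≮⇒≥ λ hi< → ¬conflict (hi c) (cell-V y) (B-facet b₀-B) ℕₚ.≤-refl
          (ℕₚ.≤-pred (ℕₚ.≤-trans hi< (ℕₚ.≤-reflexive (B-lo b₀-B))))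
          (conflict-π⁻ G (cell-V y) (B-facet b₀-B) (subst (λ e → Conflict e (π G b₀)) (sym (im-V y)) (hh (proj₂ k b₀-B))))
          where
          hh : ∀ {e} → IsB e → Conflict (H 0 c) e
          hh (isB f n) = conflict-HH (cell-H (cell-tr y)) f λ { refl → n (cell-tr y) }

        absurd : ⊥
        absurd with lo 1 ℕₚ.≤? lo 0
        ... | no lo1≰ = ¬10 ((ℕₚ.≤-pred (ℕₚ.≤-trans (ℕₚ.≤-trans wide hi0≤hi1) (hi-step 1))) ,
                ℕₚ.≤-<-trans (lo-step 0) (ℕₚ.≤-trans wide hi0≤hi1))
          where
          ¬10 : ¬ Cell 1 0
          ¬10 y = lo1≰ (row₀ (cell-tr y))
          hi0≤hi1 : hi 0 ≤ hi 1
          hi0≤hi1 = ℕₚ.≮⇒≥ λ hi< → ¬conflict (hi 1) (cell-top {0} {0} cell00) (B-facet (proj₂ k b₀-B)) ℕₚ.≤-refl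
            (ℕₚ.≤-pred (ℕₚ.≤-trans hi< (ℕₚ.≤-reflexive (B-lo (proj₂ k b₀-B)))))
            (conflict-sym (subst (Conflict (π G b₀)) same₀₀ (conflict-π G (B-facet b₀-B) (cell-right {0} {0} cell00) b₀-conflict)))
        ... | yes lo1≤ with drop
        ...   | p , d with out-image (drop-cell₀ lo1≤ d) (fixed-in p 0 (drop-cell₀ lo1≤ d)) | proj₁ (fixed-in p 1 (drop-cell₁ lo1≤ d))
        ...     | swap _ b | c with trans (sym b) c
        ...       | ()
        absurd | yes lo1≤ | p , d | same a _ | _ = proj₂ d (col₀ (cell-tr c₀))
          where
          losp≤ : lo (suc p) ≤ lo 0
          losp≤ = ℕₚ.≮⇒≥ λ lo< → ¬conflict (suc (lo 0)) (A-facet (proj₁ k a₀-A))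
            (subst Facet (un-tr a) (π-F G (cell-top {p} {0} (drop-cell₀ lo1≤ d)))) (ℕₚ.≤-reflexive (A-hi (proj₁ k a₀-A))) lo<
            (subst (Conflict (π G a₀)) (un-tr a)
              (conflict-π G (A-facet a₀-A) (cell-top {p} {0} (drop-cell₀ lo1≤ d)) (drop-conflict lo1≤ d)))
          c₀ : Cell 0 (suc p)
          c₀ = ℕₚ.≤-<-trans losp≤ free10 , ℕₚ.≤-<-trans (ℕₚ.≤-trans (lo-step (suc p)) (s≤s losp≤)) wide

    swaps : Swaps G
    swaps with keeps-or-swaps G
    ... | inj₁ k = ⊥-elim (¬Keeps.absurd k)
    ... | inj₂ s = s

    private
      -- As `lo q` is least, `H 0 q` conflicts with `a₀`. Its image `V q 0` then conflicts with an
      -- edge of B, which forces `hi q` to be greatest.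
      low⇒high : ∀ q → lo q ≤ lo 0 → hi 0 ≤ hi q
      low⇒high q h = go (proj₁ swaps a₀-A) (subst (Conflict (π G a₀)) (im-H y) (conflict-π G (A-facet a₀-A) (cell-H y)
          (conflict-VH (ℕₚ.≤-trans (s≤s h) (ℕₚ.≤-reflexive (sym (A-hi a₀-A)))))))
        where
        y : Cell 0 q
        y = ℕₚ.≤-<-trans h free10 , ℕₚ.≤-<-trans (ℕₚ.≤-trans (lo-step q) (s≤s h)) wide
        go : ∀ {e} → IsB e → Conflict e (V q 0) → hi 0 ≤ hi q
        go b@(isB f n) C = ℕₚ.≤-trans (ℕₚ.≤-reflexive (B-lo b)) (conflict-VH⁻ (cell-V (cell-tr y)) f (conflict-sym C))

      high⇒low : ∀ c → hi 0 ≤ hi c → lo c ≤ lo 0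
      high⇒low c h = go (proj₂ swaps b₀-B) (subst (λ e → Conflict e (π G b₀)) (im-V y) (conflict-π G (cell-V y) (B-facet b₀-B)
          (conflict-VH (ℕₚ.<-≤-trans (B-facet b₀-B) h))))
        where
        y : Cell c 0
        y = ℕₚ.≤-pred (ℕₚ.≤-trans (ℕₚ.≤-trans wide h) (hi-step c)) , ℕₚ.≤-<-trans (lo-step 0) (ℕₚ.≤-trans wide h)
        go : ∀ {e} → IsA e → Conflict (H 0 c) e → lo c ≤ lo 0
        go a@(isA f n) C = ℕₚ.≤-pred (ℕₚ.≤-trans (conflict-VH⁻ f (cell-H (cell-tr y)) (conflict-sym C)) (ℕₚ.≤-reflexive (A-hi a)))

    -- Freeness of (c , q) is visible in the conflict of `V c 0` with `H 0 q`, and these go to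
    -- `H 0 c` and `V q 0` if they enter cells. If one of them enters none, its exact image is
    -- unknown, and the occurrences of the extreme parts decide instead.
    free-tr : ∀ c q → suc (c + q) ≡ N → Free c q → Free q c
    free-tr c q e fr with cell? c 0 | cell? 0 q
    ... | yes y | yes z = conflict-VH⁻ (cell-V (cell-tr z)) (cell-H (cell-tr y)) (conflict-sym
            (subst₂ Conflict (im-V y) (im-H z) (conflict-π G (cell-V y) (cell-H z) (conflict-VH fr))))
    ... | no n | _ = ℕₚ.≰⇒> λ le → ℕₚ.<⇒≱ (ℕₚ.≤-reflexive (sym (trans (sym (hi-diag (trans (ℕₚ.+-suc c q) e))) hic)))
            (high⇒low (suc q) (ℕₚ.≤-trans (ℕₚ.≤-trans (low⇒high q loq≤) le)
              (ℕₚ.≤-reflexive (sym (hi-diag (trans (cong suc (ℕₚ.+-comm q c)) e))))))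
      where
      hic : hi c ≡ suc (lo 0)
      hic = thin (free-down ℕₚ.≤-refl z≤n fr) n
      loq≤ : lo q ≤ lo 0
      loq≤ = ℕₚ.≤-pred (ℕₚ.≤-trans fr (ℕₚ.≤-reflexive hic))
    ... | yes _ | no n = ℕₚ.≰⇒> λ le → ℕₚ.<⇒≱ (ℕₚ.≤-reflexive (sym hi0))
            (ℕₚ.≤-trans (low⇒high (suc c) (ℕₚ.≤-trans (ℕₚ.≤-reflexive (sym (hi-diag (trans (ℕₚ.+-suc q c) (trans (cong suc (ℕₚ.+-comm q c)) e)))))
              (ℕₚ.≤-trans le (high⇒low c (ℕₚ.≤-trans (ℕₚ.≤-reflexive hi0) fr))))) (ℕₚ.≤-reflexive (hi-diag e)))
      where
      hi0 : hi 0 ≡ suc (lo q)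
      hi0 = thin (free-down z≤n ℕₚ.≤-refl fr) n

-- Generators

⟦+⟧ : ∀ a b → ⟦ a + b ⟧ ≡ ⟦ a ⟧ ℚ.+ ⟦ b ⟧
⟦+⟧ a zero rewrite ℕₚ.+-identityʳ a = sym (trans (cong (⟦ a ⟧ ℚ.+_) (⟦⟧-def 0)) (ℚₚ.+-identityʳ ⟦ a ⟧))
⟦+⟧ a (suc b) rewrite ℕₚ.+-suc a b | ⟦suc⟧ (a + b) | ⟦suc⟧ b | ⟦+⟧ a b = ℚₚ.+-assoc ⟦ a ⟧ ⟦ b ⟧ ℚ.1ℚ

mirror-ℕ : ∀ l h {x y} → x + y ≡ l + h → mirror ⟦ l ⟧ ⟦ h ⟧ ⟦ x ⟧ ≡ ⟦ y ⟧
mirror-ℕ l h {x} {y} e = trans (cong (ℚ._- ⟦ x ⟧) (trans (sym (⟦+⟧ l h)) (trans (cong ⟦_⟧ (trans (sym e) (ℕₚ.+-comm x y))) (⟦+⟧ y x))))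
  (x+y-y ⟦ y ⟧ ⟦ x ⟧)

Pos : Set
Pos = ℕ × ℕ

srcP tgtP : Edge → Pos
srcP (V p q) = suc p , q
srcP (H p q) = p , q
tgtP (V p q) = p , q
tgtP (H p q) = p , suc q

src-at : ∀ {A : Set} (X : Array A) e → src X e ≡ uncurry X (srcP e)
src-at X (V p q) = refl
src-at X (H p q) = refl

tgt-at : ∀ {A : Set} (X : Array A) e → tgt X e ≡ uncurry X (tgtP e)
tgt-at X (V p q) = refl
tgt-at X (H p q) = refl

module Generators (S : Shape) where
  open Shape S
  open Poly S
  open Symmetry S

  -- If only one facet enters and only one leaves a position, reflecting its value between the two
  -- neighbouring values exchanges these facets and preserves all other inequalities.
  record Flips : Set₁ where
    field
      Fl       : Pos → Set
      fl?      : ∀ v → Dec (Fl v)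
      inE outE : Pos → Edge
      free     : ∀ v → Fl v → uncurry Free v
      in-F     : ∀ v → Fl v → Facet (inE v)
      out-F    : ∀ v → Fl v → Facet (outE v)
      in-tgt   : ∀ v → Fl v → tgtP (inE v) ≡ v
      out-src  : ∀ v → Fl v → srcP (outE v) ≡ v
      in-src   : ∀ v → Fl v → ¬ Fl (srcP (inE v))
      out-tgt  : ∀ v → Fl v → ¬ Fl (tgtP (outE v))
      only-in  : ∀ e → Facet e → Fl (tgtP e) → e ≡ inE (tgtP e)
      only-out : ∀ e → Facet e → Fl (srcP e) → e ≡ outE (srcP e)

  module Flip (𝔽 : Flips) where
    open Flips 𝔽

    private
      φ′ : ∀ e → Dec (Fl (tgtP e)) → Dec (Fl (srcP e)) → Edge
      φ′ e (yes _) _       = outE (tgtP e)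
      φ′ e (no _)  (yes _) = inE (srcP e)
      φ′ e (no _)  (no _)  = e

    φ : Edge → Edge
    φ e = φ′ e (fl? (tgtP e)) (fl? (srcP e))

    φ-tgt : ∀ e → Fl (tgtP e) → φ e ≡ outE (tgtP e)
    φ-tgt e f with fl? (tgtP e)
    ... | yes _ = refl
    ... | no n = ⊥-elim (n f)

    φ-src : ∀ e → ¬ Fl (tgtP e) → Fl (srcP e) → φ e ≡ inE (srcP e)
    φ-src e n f with fl? (tgtP e) | fl? (srcP e)
    ... | yes x | _ = ⊥-elim (n x)
    ... | no _ | yes _ = refl
    ... | no _ | no m = ⊥-elim (m f)

    φ-off : ∀ e → ¬ Fl (tgtP e) → ¬ Fl (srcP e) → φ e ≡ e
    φ-off e n m with fl? (tgtP e) | fl? (srcP e)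
    ... | yes x | _ = ⊥-elim (n x)
    ... | no _ | yes x = ⊥-elim (m x)
    ... | no _ | no _ = refl

    φ-in : ∀ v → Fl v → φ (inE v) ≡ outE v
    φ-in v f = trans (φ-tgt (inE v) (subst Fl (sym (in-tgt v f)) f)) (cong outE (in-tgt v f))

    φ-out : ∀ v → Fl v → φ (outE v) ≡ inE v
    φ-out v f = trans (φ-src (outE v) (out-tgt v f) (subst Fl (sym (out-src v f)) f)) (cong inE (out-src v f))

    data Role (e : Edge) : Set where
      enters : ∀ v → Fl v → e ≡ inE v → Role e
      leaves : ∀ v → Fl v → e ≡ outE v → Role e
      avoids : ¬ Fl (tgtP e) → ¬ Fl (srcP e) → Role e

    role : ∀ e → Facet e → Role e
    role e fe with fl? (tgtP e) | fl? (srcP e)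
    ... | yes f | _ = enters (tgtP e) f (only-in e fe f)
    ... | no _ | yes f = leaves (srcP e) f (only-out e fe f)
    ... | no n | no m = avoids n m

    φ-F : ∀ {e} → Facet e → Facet (φ e)
    φ-F {e} fe with role e fe
    ... | enters v f refl = subst Facet (sym (φ-in v f)) (out-F v f)
    ... | leaves v f refl = subst Facet (sym (φ-out v f)) (in-F v f)
    ... | avoids n m = subst Facet (sym (φ-off e n m)) fe

    φφ : ∀ {e} → Facet e → φ (φ e) ≡ e
    φφ {e} fe with role e fe
    ... | enters v f refl = trans (cong φ (φ-in v f)) (φ-out v f)
    ... | leaves v f refl = trans (cong φ (φ-out v f)) (φ-in v f)
    ... | avoids n m = trans (cong φ (φ-off e n m)) (φ-off e n m)

    module _ (F : Face′) where
      private
        X = proj₁ F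

        val′ : ∀ v → Dec (Fl v) → ℚ
        val′ v (yes _) = mirror (src X (inE v)) (tgt X (outE v)) (uncurry X v)
        val′ v (no _)  = uncurry X v

      val : Array ℚ
      val p q = val′ (p , q) (fl? (p , q))

      private
        val-fl : ∀ v → Fl v → uncurry val v ≡ mirror (src X (inE v)) (tgt X (outE v)) (uncurry X v)
        val-fl v f with fl? v
        ... | yes _ = refl
        ... | no n = ⊥-elim (n f)

        val-off : ∀ v → ¬ Fl v → uncurry val v ≡ uncurry X v
        val-off v n with fl? v
        ... | yes f = ⊥-elim (n f)
        ... | no _ = refl

        tgt-in : ∀ v → Fl v → tgt X (inE v) ≡ uncurry X v
        tgt-in v f = trans (tgt-at X (inE v)) (cong (uncurry X) (in-tgt v f))

        src-out : ∀ v → Fl v → src X (outE v) ≡ uncurry X v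
        src-out v f = trans (src-at X (outE v)) (cong (uncurry X) (out-src v f))

        l h : Pos → ℚ
        l v = src X (inE v)
        h v = tgt X (outE v)

        val-src-in : ∀ v → Fl v → src val (inE v) ≡ l v
        val-src-in v f = trans (src-at val (inE v)) (trans (val-off _ (in-src v f)) (sym (src-at X (inE v))))

        val-tgt-in : ∀ v → Fl v → tgt val (inE v) ≡ mirror (l v) (h v) (uncurry X v)
        val-tgt-in v f = trans (tgt-at val (inE v)) (trans (cong (uncurry val) (in-tgt v f)) (val-fl v f))

        val-src-out : ∀ v → Fl v → src val (outE v) ≡ mirror (l v) (h v) (uncurry X v)
        val-src-out v f = trans (src-at val (outE v)) (trans (cong (uncurry val) (out-src v f)) (val-fl v f))

        val-tgt-out : ∀ v → Fl v → tgt val (outE v) ≡ h v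
        val-tgt-out v f = trans (tgt-at val (outE v)) (trans (val-off _ (out-tgt v f)) (sym (tgt-at X (outE v))))

        val-src-off : ∀ e → ¬ Fl (srcP e) → src val e ≡ src X e
        val-src-off e n = trans (src-at val e) (trans (val-off _ n) (sym (src-at X e)))

        val-tgt-off : ∀ e → ¬ Fl (tgtP e) → tgt val e ≡ tgt X e
        val-tgt-off e n = trans (tgt-at val e) (trans (val-off _ n) (sym (tgt-at X e)))

        val-mono : ∀ e → Facet e → src val e ℚ.≤ tgt val e
        val-mono e fe with role e fe
        ... | enters v f refl = subst₂ ℚ._≤_ (trans (mirror-low (l v) (h v)) (sym (val-src-in v f))) (sym (val-tgt-in v f))
                (mirror-anti (l v) (h v) (subst (ℚ._≤ h v) (src-out v f) (mono (proj₂ F) (outE v) (out-F v f))))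
        ... | leaves v f refl = subst₂ ℚ._≤_ (sym (val-src-out v f)) (trans (mirror-high (l v) (h v)) (sym (val-tgt-out v f)))
                (mirror-anti (l v) (h v) (subst (l v ℚ.≤_) (tgt-in v f) (mono (proj₂ F) (inE v) (in-F v f))))
        ... | avoids n m = subst₂ ℚ._≤_ (sym (val-src-off e m)) (sym (val-tgt-off e n)) (mono (proj₂ F) e fe)

      flipFace : Face′
      flipFace = val , record
        { fixed = λ p q hN e → trans (val-off (p , q) (λ f → ℕₚ.<⇒≢ (free (p , q) f) e)) (fixed (proj₂ F) p q hN e)
        ; mono = val-mono }

      flip-T : ∀ {e} → Facet e → T F e → T flipFace (φ e)
      flip-T {e} fe t with role e fe
      ... | enters v f refl = subst (T flipFace) (sym (φ-in v f)) (trans (val-src-out v f)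
              (trans (cong (mirror (l v) (h v)) (sym (trans t (tgt-in v f)))) (trans (mirror-high (l v) (h v)) (sym (val-tgt-out v f)))))
      ... | leaves v f refl = subst (T flipFace) (sym (φ-out v f)) (sym (trans (val-tgt-in v f)
              (trans (cong (mirror (l v) (h v)) (trans (sym (src-out v f)) t)) (trans (mirror-low (l v) (h v)) (sym (val-src-in v f))))))
      ... | avoids n m = subst (T flipFace) (sym (φ-off e n m)) (trans (val-src-off e m) (trans t (sym (val-tgt-off e n))))

      flip-T⁻ : ∀ {e} → Facet e → T flipFace (φ e) → T F e
      flip-T⁻ {e} fe t with role e fe
      ... | enters v f refl = trans (mirror-inj (l v) (h v) (trans (mirror-high (l v) (h v))
              (sym (trans (sym (val-src-out v f)) (trans (subst (T flipFace) (φ-in v f) t) (val-tgt-out v f)))))) (sym (tgt-in v f))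
      ... | leaves v f refl = trans (src-out v f) (mirror-inj (l v) (h v) (trans (sym (val-tgt-in v f))
              (trans (sym (subst (T flipFace) (φ-out v f) t)) (trans (val-src-in v f) (sym (mirror-low (l v) (h v)))))))
      ... | avoids n m = trans (sym (val-src-off e m)) (trans (subst (T flipFace) (φ-off e n m) t) (val-tgt-off e n))

    flipSym : Sym
    flipSym = record
      { π = φ ; π⁻ = φ ; π-F = φ-F ; π⁻-F = φ-F ; ππ⁻ = φφ ; π⁻π = φφ ; ρ = flipFace ; ρ⁻ = flipFace
      ; ρ-T = flip-T ; ρ⁻-T = flip-T ; ρ-T⁻ = flip-T⁻ ; ρ⁻-T⁻ = flip-T⁻ }

  _≟ᴾ_ : (v w : Pos) → Dec (v ≡ w)
  _≟ᴾ_ = ≡-dec ℕ._≟_ ℕ._≟_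

  module Single (v : Pos) (e f : Edge) (v-free : uncurry Free v) (fe : Facet e) (ff : Facet f)
    (e-tgt : tgtP e ≡ v) (f-src : srcP f ≡ v)
    (uniq-in : ∀ x → Facet x → tgtP x ≡ v → x ≡ e) (uniq-out : ∀ x → Facet x → srcP x ≡ v → x ≡ f) where

    private
      irrefl : ∀ x → srcP x ≢ tgtP x
      irrefl (V p q) ()
      irrefl (H p q) ()

    single : Flips
    single = record
      { Fl = _≡ v ; fl? = _≟ᴾ v ; inE = λ _ → e ; outE = λ _ → f
      ; free = λ { _ refl → v-free } ; in-F = λ _ _ → fe ; out-F = λ _ _ → ff
      ; in-tgt = λ { _ refl → e-tgt } ; out-src = λ { _ refl → f-src }
      ; in-src = λ _ _ s → irrefl e (trans s (sym e-tgt)) ; out-tgt = λ _ _ s → irrefl f (trans f-src (sym s))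
      ; only-in = λ x fx t → uniq-in x fx t ; only-out = λ x fx s → uniq-out x fx s }

    open Flip single

    swapSym : Sym
    swapSym = flipSym

    swap-e : π swapSym e ≡ f
    swap-e = φ-in v refl

    swap-f : π swapSym f ≡ e
    swap-f = φ-out v refl

    swap-off : ∀ x → Facet x → x ≢ e → x ≢ f → π swapSym x ≡ x
    swap-off x fx n m = φ-off x (n ∘ uniq-in x fx) (m ∘ uniq-out x fx)

  module _ (free00 : Free 0 0) where
    private
      only-in : ∀ x → Facet x → tgtP x ≡ (0 , 0) → x ≡ V 0 0
      only-in (V _ _) _ refl = refl
      only-out : ∀ x → Facet x → srcP x ≡ (0 , 0) → x ≡ H 0 0
      only-out (H _ _) _ refl = refl
      module C = Single (0 , 0) (V 0 0) (H 0 0) free00 free00 free00 refl refl only-in only-out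

    open C public using () renaming (swapSym to cornerSym; swap-e to corner-V; swap-f to corner-H; swap-off to corner-off)

  -- By `thin-A` the square above (r , 0) is no cell, so no horizontal facet leaves (r + 1 , 0) and
  -- a flip there exchanges two neighbouring edges of the first column.
  module _ {r : ℕ} (f : Free (suc r) 0) (thin-A : hi r ≤ lo 1) where
    private
      only-in : ∀ x → Facet x → tgtP x ≡ (suc r , 0) → x ≡ V (suc r) 0
      only-in (V _ _) _ refl = refl
      only-out : ∀ x → Facet x → srcP x ≡ (suc r , 0) → x ≡ V r 0
      only-out (V _ _) _ refl = refl
      only-out (H _ _) (_ , b) refl = ⊥-elim (ℕₚ.<⇒≱ b thin-A)
      module C = Single (suc r , 0) (V (suc r) 0) (V r 0) f f (free-down (ℕₚ.n≤1+n r) ℕₚ.≤-refl f) refl refl only-in only-out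

    open C public using () renaming (swapSym to adjA; swap-e to adjA-e; swap-f to adjA-f; swap-off to adjA-off)

  module _ {r : ℕ} (f : Free 0 (suc r)) (thin-B : hi 1 ≤ lo r) where
    private
      only-in : ∀ x → Facet x → tgtP x ≡ (0 , suc r) → x ≡ H 0 r
      only-in (V _ _) (a , _) refl = ⊥-elim (ℕₚ.<⇒≱ a thin-B)
      only-in (H _ _) _ refl = refl
      only-out : ∀ x → Facet x → srcP x ≡ (0 , suc r) → x ≡ H 0 (suc r)
      only-out (H _ _) _ refl = refl
      module C = Single (0 , suc r) (H 0 r) (H 0 (suc r)) f (free-down ℕₚ.≤-refl (ℕₚ.n≤1+n r) f) f refl refl only-in only-out

    open C public using () renaming (swapSym to adjB; swap-e to adjB-e; swap-f to adjB-f; swap-off to adjB-off)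

  -- The cells (p , q) next to the diagonal whose out-edges are parallel.
  Kink : ℕ → ℕ → Set
  Kink p q = 3 + (p + q) ≡ N × lo q ≡ lo (suc q) × lo (suc q) < lo (2 + q) × lo (2 + q) ≡ lo (3 + q)

  kink? : ∀ p q → Dec (Kink p q)
  kink? p q = (_ ℕ.≟ _) ×-dec ((_ ℕ.≟ _) ×-dec ((_ ℕₚ.<? _) ×-dec (_ ℕ.≟ _)))

  module _ {p q : ℕ} (k : Kink p q) where
    private
      e = proj₁ k
      +-suc² : ∀ a b → a + suc (suc b) ≡ suc (suc (a + b))
      +-suc² a b = trans (ℕₚ.+-suc a (suc b)) (cong suc (ℕₚ.+-suc a b))

    kink-hi₀ : hi p ≡ lo (3 + q)
    kink-hi₀ = hi-diag (trans (ℕₚ.+-suc p (2 + q)) (trans (cong suc (+-suc² p q)) e))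

    kink-hi₁ : hi (suc p) ≡ lo (2 + q)
    kink-hi₁ = hi-diag (trans (cong suc (+-suc² p q)) e)

    kink-hi₂ : hi (2 + p) ≡ lo (suc q)
    kink-hi₂ = hi-diag (trans (cong (2 +_) (ℕₚ.+-suc p q)) e)

    kink-free : Free (suc p) (suc q)
    kink-free = ℕₚ.≤-trans (proj₁ (proj₂ (proj₂ k))) (ℕₚ.≤-reflexive (sym kink-hi₁))

    kink-cell : Cell p q
    kink-cell = free-down ℕₚ.≤-refl (ℕₚ.n≤1+n q) kink-free , free-down (ℕₚ.n≤1+n p) ℕₚ.≤-refl kink-free

    kink-¬up : ¬ Cell (suc p) q
    kink-¬up (a , _) = ℕₚ.<⇒≢ a (trans (proj₁ (proj₂ k)) (sym kink-hi₂))

    kink-¬right : ¬ Cell p (suc q)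
    kink-¬right (_ , b) = ℕₚ.<⇒≢ b (trans (proj₂ (proj₂ (proj₂ k))) (sym kink-hi₀))

  module Kinks (z : ℕ → Bool) where

    data Fl : Pos → Set where
      fl : ∀ {p q} → Kink p q → z q ≡ true → Fl (suc p , suc q)

    private
      fl? : ∀ v → Dec (Fl v)
      fl? (zero , q) = no λ ()
      fl? (suc p , zero) = no λ ()
      fl? (suc p , suc q) = map′ (λ { (a , b) → fl a b }) (λ { (fl a b) → a , b }) (kink? p q ×-dec (z q Boolₚ.≟ true))

      inE outE : Pos → Edge
      inE (p , q) = H p (q ∸ 1)
      outE (p , q) = V (p ∸ 1) q

      -- The flipped positions lie on one antidiagonal, next to the main one, so no two of them are
      -- neighbours and all can be flipped at once.
      clash : ∀ p q → 3 + (p + q) ≡ N → 3 + (p + suc q) ≡ N → ⊥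
      clash p q a b = ℕₚ.m≢1+m+n (p + q) {0} (trans (ℕₚ.suc-injective (ℕₚ.suc-injective (ℕₚ.suc-injective (trans a (sym b)))))
        (trans (ℕₚ.+-suc p q) (cong suc (sym (ℕₚ.+-identityʳ (p + q))))))

    kinks : Flips
    kinks = record
      { Fl = Fl ; fl? = fl? ; inE = inE ; outE = outE
      ; free = λ { _ (fl k _) → kink-free k }
      ; in-F = λ { _ (fl k _) → kink-cell k } ; out-F = λ { _ (fl k _) → kink-cell k }
      ; in-tgt = λ { _ (fl _ _) → refl } ; out-src = λ { _ (fl _ _) → refl }
      ; in-src = λ { _ (fl {p} {zero} k _) () ; _ (fl {p} {suc q} k _) (fl k′ _) → clash p q (proj₁ k′) (proj₁ k) }
      ; out-tgt = λ { _ (fl {zero} {q} k _) () ; _ (fl {suc p} {q} k _) (fl k′ _) → clash p q (proj₁ k′) (trans (cong (3 +_) (ℕₚ.+-suc p q)) (proj₁ k)) }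
      ; only-in = λ { (V _ _) fe (fl k _) → ⊥-elim (kink-¬up k fe) ; (H _ _) fe (fl k _) → refl }
      ; only-out = λ { (V _ _) fe (fl k _) → refl ; (H _ _) fe (fl k _) → ⊥-elim (kink-¬right k fe) } }

    open Flip kinks

    kinkSym : Sym
    kinkSym = flipSym

    kink-H : ∀ {p q} → Kink p q → z q ≡ true → π kinkSym (H (suc p) q) ≡ V p (suc q)
    kink-H k b = φ-in _ (fl k b)

    kink-V : ∀ {p q} → Kink p q → z q ≡ true → π kinkSym (V p (suc q)) ≡ H (suc p) q
    kink-V k b = φ-out _ (fl k b)

    kink-off : ∀ e → Facet e → (∀ {p q} → Kink p q → z q ≡ true → e ≢ H (suc p) q) →
      (∀ {p q} → Kink p q → z q ≡ true → e ≢ V p (suc q)) → π kinkSym e ≡ e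
    kink-off e fe n m with role e fe
    ... | enters _ (fl k b) eq = ⊥-elim (n k b eq)
    ... | leaves _ (fl k b) eq = ⊥-elim (m k b eq)
    ... | avoids x y = φ-off e x y

  -- For a symmetric shape, transposing the array and reversing the order of the values is an affine
  -- symmetry of the polytope.
  module Reflect (lo+hi : ∀ p → lo p + hi p ≡ lo 0 + hi 0) where

    private
      lo<⇒ : ∀ {p q} → Free p q → Free q p
      lo<⇒ {p} {q} f = ℕₚ.≰⇒> λ le → ℕₚ.<-irrefl (trans (lo+hi q) (sym (trans (ℕₚ.+-comm (hi p) (lo p)) (lo+hi p))))
        (ℕₚ.+-mono-<-≤ f le)

    tr-facet : ∀ {e} → Facet e → Facet (tr e)
    tr-facet {V p zero} f = lo<⇒ {p} {0} f
    tr-facet {V p (suc q)} (a , b) = lo<⇒ {p} {suc q} b , lo<⇒ {suc p} {q} a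
    tr-facet {H zero q} f = lo<⇒ {0} {q} f
    tr-facet {H (suc p) q} (a , b) = lo<⇒ {p} {suc q} b , lo<⇒ {suc p} {q} a

    private
      μ : ℚ → ℚ
      μ = mirror ⟦ lo 0 ⟧ ⟦ hi 0 ⟧

      module _ (F : Face′) where
        X Y : Array ℚ
        X = proj₁ F
        Y p q = μ (X q p)

        Y-src : ∀ e → src Y (tr e) ≡ μ (tgt X e)
        Y-src (V p q) = refl
        Y-src (H p q) = refl

        Y-tgt : ∀ e → tgt Y (tr e) ≡ μ (src X e)
        Y-tgt (V p q) = refl
        Y-tgt (H p q) = refl

        Y-mono : ∀ e → Facet (tr e) → src Y (tr e) ℚ.≤ tgt Y (tr e)
        Y-mono e f = subst₂ ℚ._≤_ (sym (Y-src e)) (sym (Y-tgt e)) (mirror-anti ⟦ lo 0 ⟧ ⟦ hi 0 ⟧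
          (mono (proj₂ F) e (subst Facet (tr-tr e) (tr-facet f))))

        Y-fixed : ∀ p q → p + q ≤ N → lo q ≡ hi p → Y p q ≡ ⟦ lo q ⟧
        Y-fixed p q h e = trans (cong μ (fixed (proj₂ F) q p (subst (_≤ N) (ℕₚ.+-comm p q) h) e′))
          (mirror-ℕ (lo 0) (hi 0) (trans (cong (lo p +_) e) (lo+hi p)))
          where
          e′ : lo p ≡ hi q
          e′ = ℕₚ.+-cancelˡ-≡ (lo q) (lo p) (hi q) (trans (trans (cong (_+ lo p) e) (trans (ℕₚ.+-comm (hi p) (lo p)) (lo+hi p))) (sym (lo+hi q)))

        reflectFace : Face′
        reflectFace = Y , record
          { fixed = Y-fixed ; mono = λ e f → subst (λ x → src Y x ℚ.≤ tgt Y x) (tr-tr e) (Y-mono (tr e) (subst Facet (sym (tr-tr e)) f)) }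

        reflect-T : ∀ {e} → Facet e → T F e → T reflectFace (tr e)
        reflect-T {e} fe t = trans (Y-src e) (trans (cong μ (sym t)) (sym (Y-tgt e)))

        reflect-T⁻ : ∀ {e} → Facet e → T reflectFace (tr e) → T F e
        reflect-T⁻ {e} fe t = sym (mirror-inj ⟦ lo 0 ⟧ ⟦ hi 0 ⟧ (trans (sym (Y-src e)) (trans t (Y-tgt e))))

    reflectSym : Sym
    reflectSym = record
      { π = tr ; π⁻ = tr ; π-F = tr-facet ; π⁻-F = tr-facet ; ππ⁻ = λ {e} _ → tr-tr e ; π⁻π = λ {e} _ → tr-tr e
      ; ρ = reflectFace ; ρ⁻ = reflectFace ; ρ-T = reflect-T ; ρ⁻-T = reflect-T ; ρ-T⁻ = reflect-T⁻ ; ρ⁻-T⁻ = reflect-T⁻ }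

  -- An induction on the derivation of xs ↭ ys reduces permutations of parallel edges to exchanges of neighbours.
  module Parallel (k : ℕ) (c : ℕ → Edge) (c-inj : ∀ {i j} → c i ≡ c j → i ≡ j) (c-F : ∀ {i} → i < k → Facet (c i))
    (adj : ∀ i → suc i < k → Sym)
    (adj-e : ∀ i h → π (adj i h) (c i) ≡ c (suc i)) (adj-f : ∀ i h → π (adj i h) (c (suc i)) ≡ c i)
    (adj-off : ∀ i h x → Facet x → x ≢ c i → x ≢ c (suc i) → π (adj i h) x ≡ x) where

    -- The map `θ` follows each entry of `xs` to its place in `ys`. If `ys` lists 0, 1, 2 and so on,
    -- the entry at place `θ i` is `θ i`, so `θ` is `xs` read as a function. The offset `o` tells
    -- where the lists begin among the edges.
    record Permuting (xs ys : List ℕ) (o : ℕ) : Set where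
      field
        sym′  : Sym
        θ     : ℕ → ℕ
        θ-<   : ∀ {i} → i < length xs → θ i < length ys
        θ-at  : ∀ {i} → i < length xs → at ys (θ i) ≡ at xs i
        on    : ∀ {i} → i < length xs → π sym′ (c (o + i)) ≡ c (o + θ i)
        off   : ∀ {x} → Facet x → (∀ i → i < length xs → x ≢ c (o + i)) → π sym′ x ≡ x

    private
      c≢ : ∀ {i j} → i ≢ j → c i ≢ c j
      c≢ n h = n (c-inj h)

    permuting : ∀ {xs ys} → xs ↭ ys → ∀ o → o + length xs ≤ k → Permuting xs ys o
    permuting Perm.refl o h = record { sym′ = idSym ; θ = λ i → i ; θ-< = λ i< → i< ; θ-at = λ _ → refl ; on = λ _ → refl ; off = λ _ _ → refl }
    permuting (Perm.trans {xs} {ys} p r) o h with permuting p o h | permuting r o (subst (λ n → o + n ≤ k) (↭-length p) h)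
    ... | P | R = record
      { sym′ = R.sym′ ⊙ P.sym′ ; θ = R.θ ∘ P.θ ; θ-< = R.θ-< ∘ P.θ-<
      ; θ-at = λ i< → trans (R.θ-at (P.θ-< i<)) (P.θ-at i<)
      ; on = λ i< → trans (cong (π R.sym′) (P.on i<)) (R.on (P.θ-< i<))
      ; off = λ fx n → trans (cong (π R.sym′) (P.off fx n)) (R.off fx λ i i< → n i (subst (i <_) (sym (↭-length p)) i<)) }
      where module P = Permuting P
            module R = Permuting R
    permuting (Perm.prep {xs} {ys} x p) o h with permuting p (suc o) (subst (_≤ k) (ℕₚ.+-suc o (length xs)) h)
    ... | P = record
      { sym′ = P.sym′ ; θ = θ′
      ; θ-< = λ { {zero} _ → s≤s z≤n ; {suc i} (s≤s i<) → s≤s (P.θ-< i<) }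
      ; θ-at = λ { {zero} _ → refl ; {suc i} (s≤s i<) → P.θ-at i< }
      ; on = λ { {zero} _ → P.off (c-F (ℕₚ.<-≤-trans (ℕₚ.+-monoʳ-< o (s≤s z≤n)) h)) λ i _ → c≢ λ e → ℕₚ.m≢1+m+n o (trans (sym (ℕₚ.+-identityʳ o)) e)
               ; {suc i} (s≤s i<) → trans (cong (π P.sym′) (cong c (ℕₚ.+-suc o i))) (trans (P.on i<) (cong c (sym (ℕₚ.+-suc o (P.θ i))))) }
      ; off = λ fx n → P.off fx λ i i< e → n (suc i) (s≤s i<) (trans e (cong c (sym (ℕₚ.+-suc o i)))) }
      where
      module P = Permuting P
      θ′ : ℕ → ℕ
      θ′ zero = zero
      θ′ (suc i) = suc (P.θ i)
    permuting (Perm.swap {xs} {ys} x y p) o h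
      with permuting p (2 + o) (subst (_≤ k) (trans (ℕₚ.+-suc o (suc (length xs))) (cong suc (ℕₚ.+-suc o (length xs)))) h)
    ... | P = record
      { sym′ = adj o so<k ⊙ P.sym′ ; θ = θ′
      ; θ-< = λ { {zero} _ → s≤s (s≤s z≤n) ; {suc zero} _ → s≤s z≤n ; {suc (suc i)} (s≤s (s≤s i<)) → s≤s (s≤s (P.θ-< i<)) }
      ; θ-at = λ { {zero} _ → refl ; {suc zero} _ → refl ; {suc (suc i)} (s≤s (s≤s i<)) → P.θ-at i< }
      ; on = λ { {zero} _ → trans (cong A (off₀ 0 (ℕₚ.+-identityʳ o))) (trans (adj-e o so<k) (cong c (sym (trans (ℕₚ.+-suc o 0) (cong suc (ℕₚ.+-identityʳ o))))))
               ; {suc zero} _ → trans (cong A off₁) (trans (adj-f o so<k) (cong c (sym (ℕₚ.+-identityʳ o))))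
               ; {suc (suc i)} (s≤s (s≤s i<)) → trans (cong (A ∘ π P.sym′ ∘ c) (+2 i)) (trans (cong A (P.on i<))
                   (trans (adj-off o so<k _ (c-F (ℕₚ.<-≤-trans (ℕₚ.+-monoʳ-< (2 + o) (P.θ-< i<))
                        (subst (λ n → 2 + o + n ≤ k) (↭-length p) h′)))
                     (c≢ λ e → ℕₚ.m≢1+m+n o (sym (trans (ℕₚ.+-suc (suc o) _) e)))
                     (c≢ λ e → ℕₚ.m≢1+m+n (suc o) (sym e)))
                     (cong c (sym (+2 (P.θ i)))))) }
      ; off = λ fx n → trans (cong A (P.off fx λ i i< e → n (2 + i) (s≤s (s≤s i<)) (trans e (cong c (sym (+2 i))))))
          (adj-off o so<k _ fx (λ e → n 0 (s≤s z≤n) (trans e (cong c (sym (ℕₚ.+-identityʳ o)))))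
            (λ e → n 1 (s≤s (s≤s z≤n)) (trans e (cong c (sym (trans (ℕₚ.+-suc o 0) (cong suc (ℕₚ.+-identityʳ o)))))))) }
      where
      module P = Permuting P
      θ′ : ℕ → ℕ
      θ′ zero = 1
      θ′ (suc zero) = 0
      θ′ (suc (suc i)) = suc (suc (P.θ i))
      +2 : ∀ i → o + suc (suc i) ≡ 2 + o + i
      +2 i = trans (ℕₚ.+-suc o (suc i)) (cong suc (ℕₚ.+-suc o i))
      h′ : 2 + o + length xs ≤ k
      h′ = subst (_≤ k) (+2 (length xs)) h
      so<k : suc o < k
      so<k = ℕₚ.≤-trans (ℕₚ.m≤m+n (2 + o) (length xs)) h′
      A : Edge → Edge
      A = π (adj o so<k)
      off₀ : ∀ i → o + i ≡ o → π P.sym′ (c (o + i)) ≡ c o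
      off₀ i e = trans (cong (π P.sym′ ∘ c) e) (P.off (c-F (ℕₚ.<-trans (ℕₚ.n<1+n o) so<k))
        λ j _ → c≢ λ e′ → ℕₚ.m≢1+m+n o (trans e′ (cong suc (sym (ℕₚ.+-suc o j)))))
      off₁ : π P.sym′ (c (o + 1)) ≡ c (suc o)
      off₁ = trans (cong (π P.sym′ ∘ c) (trans (ℕₚ.+-suc o 0) (cong suc (ℕₚ.+-identityʳ o)))) (P.off (c-F so<k)
        λ j _ → c≢ λ e′ → ℕₚ.m≢1+m+n (suc o) e′)

-- The group and its action

nth : List Bool → ℕ → Bool
nth []       _       = false
nth (b ∷ bs) zero    = b
nth (b ∷ bs) (suc i) = nth bs i

nth-++ˡ : ∀ bs {cs i} → i < length bs → nth (bs ++ cs) i ≡ nth bs i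
nth-++ˡ (b ∷ bs) {i = zero}  _       = refl
nth-++ˡ (b ∷ bs) {i = suc i} (s≤s h) = nth-++ˡ bs h

nth-last : ∀ bs {b} → nth (bs ++ b ∷ []) (length bs) ≡ b
nth-last []       = refl
nth-last (b ∷ bs) = nth-last bs

nth-reverse : ∀ bs {i j} → suc (i + j) ≡ length bs → nth (reverse bs) i ≡ nth bs j
nth-reverse (b ∷ bs) {i} {j} h rewrite Listₚ.unfold-reverse b bs with j
... | zero = trans (cong (nth (reverse bs ++ b ∷ [])) (trans (sym (ℕₚ.+-identityʳ i)) (trans (ℕₚ.suc-injective h) (sym (Listₚ.length-reverse bs)))))
               (nth-last (reverse bs))
... | suc j′ = trans (nth-++ˡ (reverse bs) (ℕₚ.≤-trans (ℕₚ.≤-trans (s≤s (ℕₚ.m≤m+n i j′)) (ℕₚ.≤-reflexive e)) (ℕₚ.≤-reflexive (sym (Listₚ.length-reverse bs)))))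
                 (nth-reverse bs e)
  where e : suc (i + j′) ≡ length bs
        e = trans (sym (ℕₚ.+-suc i j′)) (ℕₚ.suc-injective h)

nth-xor : ∀ bs cs {i} → length bs ≡ length cs → nth (zipWith _xor_ bs cs) i ≡ nth bs i xor nth cs i
nth-xor []       []       h = refl
nth-xor (b ∷ bs) (c ∷ cs) {zero}  h = refl
nth-xor (b ∷ bs) (c ∷ cs) {suc i} h = nth-xor bs cs (ℕₚ.suc-injective h)

nth-ext : ∀ bs cs → length bs ≡ length cs → (∀ i → i < length bs → nth bs i ≡ nth cs i) → bs ≡ cs
nth-ext []       []       _ _ = refl
nth-ext (b ∷ bs) (c ∷ cs) e h = cong₂ _∷_ (h 0 (s≤s z≤n)) (nth-ext bs cs (ℕₚ.suc-injective e) λ i i< → h (suc i) (s≤s i<))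

at-ext : ∀ xs ys → length xs ≡ length ys → (∀ i → i < length xs → at xs i ≡ at ys i) → xs ≡ ys
at-ext []       []       _ _ = refl
at-ext (x ∷ xs) (y ∷ ys) e h = cong₂ _∷_ (h 0 (s≤s z≤n)) (at-ext xs ys (ℕₚ.suc-injective e) λ i i< → h (suc i) (s≤s i<))

at-map : ∀ (f : ℕ → ℕ) xs {i} → i < length xs → at (map f xs) i ≡ f (at xs i)
at-map f (x ∷ xs) {zero}  _       = refl
at-map f (x ∷ xs) {suc i} (s≤s h) = at-map f xs h

at-applyUpTo : ∀ (f : ℕ → ℕ) n {i} → i < n → at (applyUpTo f n) i ≡ f i
at-applyUpTo f (suc n) {zero}  _       = refl
at-applyUpTo f (suc n) {suc i} (s≤s h) = at-applyUpTo (f ∘ suc) n h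

map-at-upTo : ∀ xs → map (at xs) (upTo (length xs)) ≡ xs
map-at-upTo xs = at-ext _ _ len λ i h → let i< = subst (i <_) len h in
    trans (at-map (at xs) (upTo (length xs)) (subst (i <_) (sym (Listₚ.length-upTo (length xs))) i<))
          (cong (at xs) (at-applyUpTo (λ j → j) (length xs) i<))
  where len : length (map (at xs) (upTo (length xs))) ≡ length xs
        len = trans (Listₚ.length-map (at xs) (upTo (length xs))) (Listₚ.length-upTo (length xs))

perm-length : ∀ {k σ} → σ ↭ upTo k → length σ ≡ k
perm-length {k} p = trans (↭-length p) (Listₚ.length-upTo k)

∘ₚ-perm : ∀ {k σ τ} → σ ↭ upTo k → τ ↭ upTo k → (σ ∘ₚ τ) ↭ upTo k
∘ₚ-perm {k} {σ} {τ} p q = ↭-trans (map⁺ (at σ) q)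
  (↭-trans (↭-reflexive (trans (cong (λ n → map (at σ) (upTo n)) (sym (perm-length p))) (map-at-upTo σ))) p)

-- Serves as the number of kinks and also, evaluated at the column of a kink, as its rank, which is
-- its index in `zs`.
count : (ℕ → Bool) → ℕ → ℕ
count w zero    = 0
count w (suc n) = if w n then suc (count w n) else count w n

count-true : ∀ w {n} → w n ≡ true → count w (suc n) ≡ suc (count w n)
count-true w h rewrite h = refl

count-mono : ∀ w {m n} → m ≤ n → count w m ≤ count w n
count-mono w {m} {n} h = go (ℕₚ.≤⇒≤′ h)
  where
  go : ∀ {n} → m ℕ.≤′ n → count w m ≤ count w n
  go ℕ.≤′-refl = ℕₚ.≤-refl
  go (ℕ.≤′-step {n} h) with w n
  ... | true  = ℕₚ.m≤n⇒m≤1+n (go h)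
  ... | false = go h

count-< : ∀ w {m n} → m < n → w m ≡ true → count w m < count w n
count-< w h e = ℕₚ.≤-trans (ℕₚ.≤-reflexive (sym (count-true w e))) (count-mono w h)

count-cong : ∀ {v w} n → (∀ i → i < n → v i ≡ w i) → count v n ≡ count w n
count-cong zero h = refl
count-cong {v} {w} (suc n) h rewrite h n ℕₚ.≤-refl | count-cong {v} {w} n (λ i i< → h i (ℕₚ.m<n⇒m<1+n i<)) = refl

count-+ : ∀ w m n → count w (m + n) ≡ count w m + count (λ i → w (m + i)) n
count-+ w m zero rewrite ℕₚ.+-identityʳ m = sym (ℕₚ.+-identityʳ _)
count-+ w m (suc n) rewrite ℕₚ.+-suc m n with w (m + n)
... | true  = trans (cong suc (count-+ w m n)) (sym (ℕₚ.+-suc _ _))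
... | false = count-+ w m n

count-reverse : ∀ w n → count (λ i → w (n ∸ suc i)) n ≡ count w n
count-reverse w zero = refl
count-reverse w (suc n) = trans (count-+ (λ i → w (n ∸ i)) 1 n) (trans (cong (count (λ i → w (n ∸ i)) 1 +_) (count-reverse w n)) last)
  where
  last : (if w n then 1 else 0) + count w n ≡ (if w n then suc (count w n) else count w n)
  last with w n
  ... | true  = refl
  ... | false = refl

count-find : ∀ w n {r} → r < count w n → ∃ λ i → i < n × w i ≡ true × count w i ≡ r
count-find w (suc n) {r} h with w n in eq | r ℕ.≟ count w n
... | true  | yes refl = n , ℕₚ.≤-refl , eq , refl
... | true  | no ne with count-find w n (ℕₚ.≤∧≢⇒< (ℕₚ.≤-pred h) ne)
...   | i , i< , a , b = i , ℕₚ.m<n⇒m<1+n i< , a , b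
count-find w (suc n) {r} h | false | _ with count-find w n h
...   | i , i< , a , b = i , ℕₚ.m<n⇒m<1+n i< , a , b

gather : (ℕ → Bool) → (ℕ → Bool) → ℕ → List Bool
gather w b zero    = []
gather w b (suc n) = if w n then gather w b n ++ b n ∷ [] else gather w b n

gather-length : ∀ w b n → length (gather w b n) ≡ count w n
gather-length w b zero = refl
gather-length w b (suc n) with w n
... | true  = trans (Listₚ.length-++ (gather w b n)) (trans (ℕₚ.+-comm _ 1) (cong suc (gather-length w b n)))
... | false = gather-length w b n

gather-nth : ∀ w b n {i} → i < n → w i ≡ true → nth (gather w b n) (count w i) ≡ b i
gather-nth w b (suc n) {i} h e with i ℕ.≟ n
... | yes refl rewrite e = trans (cong (nth (gather w b n ++ b n ∷ [])) (sym (gather-length w b n))) (nth-last (gather w b n))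
... | no ne with w n | gather-nth w b n (ℕₚ.≤∧≢⇒< (ℕₚ.≤-pred h) ne) e
...   | false | ih = ih
...   | true | ih = trans (nth-++ˡ (gather w b n) (subst (count w i <_) (sym (gather-length w b n))
                      (count-< w (ℕₚ.≤∧≢⇒< (ℕₚ.≤-pred h) ne) e))) ih

-- Symmetries that realise the elements of the group

module Action (S : Shape) where
  open Shape S
  open Poly S
  open Symmetry S
  open Rigidity S
  open Conflicts S using (lo0<hi0)
  open Generators S

  Pal : Set
  Pal = ∀ p → lo p + hi p ≡ lo 0 + hi 0

  -- If the first block is a single entry, k₁ is the length of the second block, and otherwise k₁ = 0.
  EndA EndB : ℕ → Set
  EndA k = (lo 1 ≡ lo 0 × k ≡ 0) ⊎
    (lo 1 ≡ suc (lo 0) × k < N × (∀ p → p < N → (hi p ≤ lo 1 → N ∸ k ≤ p) × (N ∸ k ≤ p → hi p ≤ lo 1)))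
  EndB k = (hi 0 ≡ hi 1 × k ≡ 0) ⊎
    (hi 0 ≡ suc (hi 1) × k < N × (∀ q → q < N → (hi 1 ≤ lo q → N ∸ k ≤ q) × (N ∸ k ≤ q → hi 1 ≤ lo q)))

  module Ends (k₁ k₂ : ℕ) (endA : EndA k₁) (endB : EndB k₂) where

    cA cB : ℕ → Edge
    cA i = V (N ∸ k₁ + i) 0
    cB i = H 0 (N ∸ k₂ + i)

    opaque
      endsA : EndA k₁
      endsA = endA

      endsB : EndB k₂
      endsB = endB

    private
      in-range : ∀ {k i} → k < N → i < k → N ∸ k + i < N
      in-range {k} {i} k<N i<k = ℕₚ.<-≤-trans (ℕₚ.+-monoʳ-< (N ∸ k) i<k) (ℕₚ.≤-reflexive (ℕₚ.m∸n+n≡m (ℕₚ.<⇒≤ k<N)))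

      rangeA : ∀ {i} → i < k₁ → N ∸ k₁ + i < N × hi (N ∸ k₁ + i) ≤ lo 1 × lo 1 ≡ suc (lo 0)
      rangeA i<k with endsA
      ... | inj₁ (_ , e) = ⊥-elim (ℕₚ.n≮0 (subst (_ <_) e i<k))
      ... | inj₂ (e , k<N , h) = in-range k<N i<k , proj₂ (h _ (in-range k<N i<k)) (ℕₚ.m≤m+n _ _) , e

      rangeB : ∀ {i} → i < k₂ → N ∸ k₂ + i < N × hi 1 ≤ lo (N ∸ k₂ + i) × hi 0 ≡ suc (hi 1)
      rangeB i<k with endsB
      ... | inj₁ (_ , e) = ⊥-elim (ℕₚ.n≮0 (subst (_ <_) e i<k))
      ... | inj₂ (e , k<N , h) = in-range k<N i<k , proj₂ (h _ (in-range k<N i<k)) (ℕₚ.m≤m+n _ _) , e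

      last<hi : ∀ {p} → p < N → lo 1 ≤ hi p
      last<hi {p} p<N = ℕₚ.≤-trans (lo≤hi {p} {1} (subst (_≤ N) (sym (ℕₚ.+-comm p 1)) p<N)) ℕₚ.≤-refl

    cA-isA : ∀ {i} → i < k₁ → IsA (cA i)
    cA-isA i<k with rangeA i<k
    ... | p<N , hi≤ , e = isA (ℕₚ.≤-trans (ℕₚ.≤-reflexive (sym e)) (last<hi p<N)) λ c → ℕₚ.<⇒≱ (proj₂ c) hi≤

    cB-isB : ∀ {i} → i < k₂ → IsB (cB i)
    cB-isB {i} i<k with rangeB i<k
    ... | q<N , ≤lo , e = isB (ℕₚ.≤-trans (s≤s (lo≤hi {1} {N ∸ k₂ + i} q<N)) (ℕₚ.≤-reflexive (sym e))) λ c → ℕₚ.<⇒≱ (proj₁ c) ≤lo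

    -- If `lo 1 ≡ lo 0`, a free square of the first column fails to be a cell only in the last free
    -- row. Then A is a single edge, and there is nothing to permute.
    A-index : ∀ {e} → IsA e → (∃ λ i → i < k₁ × e ≡ cA i) ⊎ (k₁ ≡ 0 × ∀ {e′} → IsA e′ → e′ ≡ e)
    A-index {V p 0} (isA f n) with endsA
    ... | inj₂ (e , k<N , h) = inj₁ (p ∸ (N ∸ k₁) , i<k , cong (λ x → V x 0) (sym (ℕₚ.m+[n∸m]≡n b≤p)))
      where
      p<N : p < N
      p<N = ℕₚ.≤-<-trans (ℕₚ.m≤m+n p 0) (free⇒< f)
      b≤p : N ∸ k₁ ≤ p
      b≤p = proj₁ (h p p<N) (ℕₚ.≤-reflexive (trans (A-hi (isA f n)) (sym e)))
      i<k : p ∸ (N ∸ k₁) < k₁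
      i<k = ℕₚ.+-cancelˡ-< (N ∸ k₁) _ _ (ℕₚ.≤-<-trans (ℕₚ.≤-reflexive (ℕₚ.m+[n∸m]≡n b≤p))
        (ℕₚ.<-≤-trans p<N (ℕₚ.≤-reflexive (sym (ℕₚ.m∸n+n≡m (ℕₚ.<⇒≤ k<N))))))
    ... | inj₁ (e , k≡0) = inj₂ (k≡0 , λ { {V p′ 0} (isA f′ n′) → cong (λ x → V x 0) (ℕₚ.≤-antisym (le f′ f n) (le f f′ n′)) })
      where
      next-low : ∀ {p} → Free p 0 → ¬ Cell p 0 → hi (suc p) ≤ lo 0
      next-low {p} f n = ℕₚ.≮⇒≥ λ lt → n (lt , subst (_< hi p) (sym e) f)
      le : ∀ {p p′} → Free p′ 0 → Free p 0 → ¬ Cell p 0 → p′ ≤ p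
      le f′ f n = ℕₚ.≮⇒≥ λ lt → ℕₚ.<⇒≱ f′ (ℕₚ.≤-trans (hi-anti lt) (next-low f n))

    B-index : ∀ {e} → IsB e → (∃ λ i → i < k₂ × e ≡ cB i) ⊎ (k₂ ≡ 0 × ∀ {e′} → IsB e′ → e′ ≡ e)
    B-index {H 0 q} (isB f n) with endsB
    ... | inj₂ (e , k<N , h) = inj₁ (q ∸ (N ∸ k₂) , i<k , cong (H 0) (sym (ℕₚ.m+[n∸m]≡n b≤q)))
      where
      q<N : q < N
      q<N = free⇒< f
      b≤q : N ∸ k₂ ≤ q
      b≤q = proj₁ (h q q<N) (ℕₚ.≤-reflexive (ℕₚ.suc-injective (trans (sym e) (B-lo (isB f n)))))
      i<k : q ∸ (N ∸ k₂) < k₂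
      i<k = ℕₚ.+-cancelˡ-< (N ∸ k₂) _ _ (ℕₚ.≤-<-trans (ℕₚ.≤-reflexive (ℕₚ.m+[n∸m]≡n b≤q))
        (ℕₚ.<-≤-trans q<N (ℕₚ.≤-reflexive (sym (ℕₚ.m∸n+n≡m (ℕₚ.<⇒≤ k<N))))))
    ... | inj₁ (e , k≡0) = inj₂ (k≡0 , λ { {H 0 q′} (isB f′ n′) → cong (H 0) (ℕₚ.≤-antisym (le f′ f n) (le f f′ n′)) })
      where
      next-high : ∀ {q} → Free 0 q → ¬ Cell 0 q → hi 0 ≤ lo (suc q)
      next-high {q} f n = ℕₚ.≮⇒≥ λ lt → n (subst (lo q <_) e f , lt)
      le : ∀ {q q′} → Free 0 q′ → Free 0 q → ¬ Cell 0 q → q′ ≤ q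
      le f′ f n = ℕₚ.≮⇒≥ λ lt → ℕₚ.<⇒≱ f′ (ℕₚ.≤-trans (next-high f n) (lo-mono lt))

    cA-inj : ∀ {i j} → cA i ≡ cA j → i ≡ j
    cA-inj {i} {j} h = ℕₚ.+-cancelˡ-≡ (N ∸ k₁) i j (proj₁ (V-inj h))

    cB-inj : ∀ {i j} → cB i ≡ cB j → i ≡ j
    cB-inj {i} {j} h = ℕₚ.+-cancelˡ-≡ (N ∸ k₂) i j (proj₂ (H-inj h))

    private
      -- Since `k₁ < N`, the corner edge `V 0 0` is not among the permuted edges of A, and the two
      -- kinds of generators do not interfere.
      baseA>0 : ∀ {i} → i < k₁ → N ∸ k₁ + i ≢ 0
      baseA>0 {i} i<k with endsA
      ... | inj₁ (_ , e) = ⊥-elim (ℕₚ.n≮0 (subst (_ <_) e i<k))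
      ... | inj₂ (_ , k<N , _) = ℕₚ.<⇒≢ (ℕₚ.<-≤-trans (ℕₚ.m<n⇒0<n∸m k<N) (ℕₚ.m≤m+n _ i)) ∘ sym

      baseB>0 : ∀ {i} → i < k₂ → N ∸ k₂ + i ≢ 0
      baseB>0 {i} i<k with endsB
      ... | inj₁ (_ , e) = ⊥-elim (ℕₚ.n≮0 (subst (_ <_) e i<k))
      ... | inj₂ (_ , k<N , _) = ℕₚ.<⇒≢ (ℕₚ.<-≤-trans (ℕₚ.m<n⇒0<n∸m k<N) (ℕₚ.m≤m+n _ i)) ∘ sym

      cA-suc : ∀ i → cA (suc i) ≡ V (suc (N ∸ k₁ + i)) 0
      cA-suc i = cong (λ x → V x 0) (ℕₚ.+-suc (N ∸ k₁) i)

      cB-suc : ∀ i → cB (suc i) ≡ H 0 (suc (N ∸ k₂ + i))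
      cB-suc i = cong (H 0) (ℕₚ.+-suc (N ∸ k₂) i)

      cA-free : ∀ i → suc i < k₁ → Free (suc (N ∸ k₁ + i)) 0
      cA-free i h = subst Facet (cA-suc i) (A-facet (cA-isA h))

      cB-free : ∀ i → suc i < k₂ → Free 0 (suc (N ∸ k₂ + i))
      cB-free i h = subst Facet (cB-suc i) (B-facet (cB-isB h))

      thinA : ∀ i → suc i < k₁ → hi (N ∸ k₁ + i) ≤ lo 1
      thinA i h = proj₁ (proj₂ (rangeA (ℕₚ.<⇒≤ h)))

      thinB : ∀ i → suc i < k₂ → hi 1 ≤ lo (N ∸ k₂ + i)
      thinB i h = proj₁ (proj₂ (rangeB (ℕₚ.<⇒≤ h)))

      module PA = Parallel k₁ cA cA-inj (λ h → A-facet (cA-isA h))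
        (λ i h → adjA (cA-free i h) (thinA i h))
        (λ i h → trans (adjA-f (cA-free i h) (thinA i h)) (sym (cA-suc i)))
        (λ i h → trans (cong (π (adjA (cA-free i h) (thinA i h))) (cA-suc i)) (adjA-e (cA-free i h) (thinA i h)))
        (λ i h x fx n m → adjA-off (cA-free i h) (thinA i h) x fx (λ e → m (trans e (sym (cA-suc i)))) n)

      module PB = Parallel k₂ cB cB-inj (λ h → B-facet (cB-isB h))
        (λ i h → adjB (cB-free i h) (thinB i h))
        (λ i h → trans (adjB-e (cB-free i h) (thinB i h)) (sym (cB-suc i)))
        (λ i h → trans (cong (π (adjB (cB-free i h) (thinB i h))) (cB-suc i)) (adjB-f (cB-free i h) (thinB i h)))
        (λ i h x fx n m → adjB-off (cB-free i h) (thinB i h) x fx n (λ e → m (trans e (sym (cB-suc i)))))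

    module _ {σ : List ℕ} (p : σ ↭ upTo k₁) where
      private
        P = PA.permuting p 0 (ℕₚ.≤-reflexive (perm-length p))
        module P = PA.Permuting P
        <len : ∀ {i} → i < k₁ → i < length σ
        <len {i} = subst (i <_) (sym (perm-length p))
        θ< : ∀ {i} → i < k₁ → P.θ i < k₁
        θ< h = subst (P.θ _ <_) (Listₚ.length-upTo k₁) (P.θ-< (<len h))
        θ≡ : ∀ {i} → i < k₁ → P.θ i ≡ at σ i
        θ≡ h = trans (sym (at-applyUpTo (λ j → j) k₁ (θ< h))) (P.θ-at (<len h))

      opaque
        permA : Sym
        permA = P.sym′

        permA-< : ∀ {i} → i < k₁ → at σ i < k₁
        permA-< h = subst (_< k₁) (θ≡ h) (θ< h)

        permA-on : ∀ {i} → i < k₁ → π permA (cA i) ≡ cA (at σ i)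
        permA-on h = trans (P.on (<len h)) (cong cA (θ≡ h))

        permA-off : ∀ {e} → Facet e → (∀ i → i < k₁ → e ≢ cA i) → π permA e ≡ e
        permA-off fe n = P.off fe λ i h → n i (subst (i <_) (perm-length p) h)

    module _ {σ : List ℕ} (p : σ ↭ upTo k₂) where
      private
        P = PB.permuting p 0 (ℕₚ.≤-reflexive (perm-length p))
        module P = PB.Permuting P
        <len : ∀ {i} → i < k₂ → i < length σ
        <len {i} = subst (i <_) (sym (perm-length p))
        θ< : ∀ {i} → i < k₂ → P.θ i < k₂
        θ< h = subst (P.θ _ <_) (Listₚ.length-upTo k₂) (P.θ-< (<len h))
        θ≡ : ∀ {i} → i < k₂ → P.θ i ≡ at σ i
        θ≡ h = trans (sym (at-applyUpTo (λ j → j) k₂ (θ< h))) (P.θ-at (<len h))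

      opaque
        permB : Sym
        permB = P.sym′

        permB-< : ∀ {i} → i < k₂ → at σ i < k₂
        permB-< h = subst (_< k₂) (θ≡ h) (θ< h)

        permB-on : ∀ {i} → i < k₂ → π permB (cB i) ≡ cB (at σ i)
        permB-on h = trans (P.on (<len h)) (cong cB (θ≡ h))

        permB-off : ∀ {e} → Facet e → (∀ i → i < k₂ → e ≢ cB i) → π permB e ≡ e
        permB-off fe n = P.off fe λ i h → n i (subst (i <_) (perm-length p) h)

    private
      kink-row : ∀ {p q} → Kink p q → p ≡ N ∸ 3 ∸ q
      kink-row {p} {q} (e , _) = sym (trans (cong (λ n → n ∸ 3 ∸ q) (sym e)) (ℕₚ.m+n∸n≡m p q))

      does-true : ∀ {P : Set} (d : Dec P) → does d ≡ true → P
      does-true (yes p) _ = p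

    opaque
      kinkAt : ℕ → Bool
      kinkAt q = does (kink? (N ∸ 3 ∸ q) q)

      kink-true : ∀ {p q} → Kink p q → kinkAt q ≡ true
      kink-true {p} {q} k = dec-true (kink? (N ∸ 3 ∸ q) q) (subst (λ x → Kink x q) (kink-row k) k)

      true-kink : ∀ {q} → kinkAt q ≡ true → Kink (N ∸ 3 ∸ q) q
      true-kink {q} = does-true (kink? (N ∸ 3 ∸ q) q)

    kinks# : ℕ
    kinks# = count kinkAt (N ∸ 2)

    kink-< : ∀ {p q} → Kink p q → q < N ∸ 2
    kink-< {p} {q} (e , _) = subst (λ n → q < n ∸ 2) e (s≤s (ℕₚ.m≤n+m q p))

    opaque
      toggle : Bool → Sym
      toggle false = idSym
      toggle true  = cornerSym lo0<hi0

      toggle-V : ∀ b → π (toggle b) (V 0 0) ≡ (if b then H 0 0 else V 0 0)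
      toggle-V true  = corner-V lo0<hi0
      toggle-V false = refl

      toggle-H : ∀ b → π (toggle b) (H 0 0) ≡ (if b then V 0 0 else H 0 0)
      toggle-H true  = corner-H lo0<hi0
      toggle-H false = refl

      toggle-off : ∀ b {e} → Facet e → e ≢ V 0 0 → e ≢ H 0 0 → π (toggle b) e ≡ e
      toggle-off false fe n m = refl
      toggle-off true  fe n m = corner-off lo0<hi0 _ fe n m

      toggle-toggle : ∀ {e} → Facet e → π (toggle true) (π (toggle true) e) ≡ e
      toggle-toggle = ππ⁻ (cornerSym lo0<hi0)

      toggle-false : ∀ e → π (toggle false) e ≡ e
      toggle-false e = refl

    bit-at : List Bool → ℕ → Bool
    bit-at zs q = nth zs (count kinkAt q)

    opaque
      kinkAct : List Bool → Sym
      kinkAct zs = Kinks.kinkSym (bit-at zs)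

      kinkAct-H : ∀ zs {p q} → Kink p q → bit-at zs q ≡ true → π (kinkAct zs) (H (suc p) q) ≡ V p (suc q)
      kinkAct-H zs = Kinks.kink-H (bit-at zs)

      kinkAct-V : ∀ zs {p q} → Kink p q → bit-at zs q ≡ true → π (kinkAct zs) (V p (suc q)) ≡ H (suc p) q
      kinkAct-V zs = Kinks.kink-V (bit-at zs)

      kinkAct-off : ∀ zs e → Facet e → (∀ {p q} → Kink p q → bit-at zs q ≡ true → e ≢ H (suc p) q) →
        (∀ {p q} → Kink p q → bit-at zs q ≡ true → e ≢ V p (suc q)) → π (kinkAct zs) e ≡ e
      kinkAct-off zs = Kinks.kink-off (bit-at zs)

    -- The generators have disjoint supports, except that both edges of a kink belong to one of
    -- them. Identities between products of generators are verified class by class.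
    data Class : Edge → Set where
      clA  : ∀ {i} → i < k₁ → Class (cA i)
      clB  : ∀ {i} → i < k₂ → Class (cB i)
      cl0V : Class (V 0 0)
      cl0H : Class (H 0 0)
      clKH : ∀ {p q} → Kink p q → Class (H (suc p) q)
      clKV : ∀ {p q} → Kink p q → Class (V p (suc q))
      cl-  : ∀ {e} → (∀ i → i < k₁ → e ≢ cA i) → (∀ i → i < k₂ → e ≢ cB i) → e ≢ V 0 0 → e ≢ H 0 0 →
        (∀ {p q} → Kink p q → e ≢ H (suc p) q) → (∀ {p q} → Kink p q → e ≢ V p (suc q)) → Class e

    classify : ∀ e → Facet e → Class e
    classify (V zero zero) fe = cl0V
    classify (H zero zero) fe = cl0H
    classify (V (suc p) zero) fe with cell? (suc p) 0
    ... | no n with A-index (isA fe n)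
    ...   | inj₁ (i , h , e) = subst Class (sym e) (clA h)
    ...   | inj₂ (k≡0 , _) = cl- (λ i h → ⊥-elim (ℕₚ.n≮0 (subst (i <_) k≡0 h))) (λ _ _ ()) (λ ()) (λ ()) (λ _ ()) (λ _ ())
    classify (V (suc p) zero) fe | yes c = cl- (λ i h e → go (cA-isA h) e) (λ _ _ ()) (λ ()) (λ ()) (λ _ ()) (λ _ ())
      where go : ∀ {x} → IsA x → V (suc p) 0 ≡ x → ⊥
            go (isA _ n) refl = n c
    classify (H zero (suc q)) fe with cell? 0 (suc q)
    ... | no n with B-index (isB fe n)
    ...   | inj₁ (i , h , e) = subst Class (sym e) (clB h)
    ...   | inj₂ (k≡0 , _) = cl- (λ _ _ ()) (λ i h → ⊥-elim (ℕₚ.n≮0 (subst (i <_) k≡0 h))) (λ ()) (λ ()) (λ _ ()) (λ _ ())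
    classify (H zero (suc q)) fe | yes c = cl- (λ _ _ ()) (λ i h e → go (cB-isB h) e) (λ ()) (λ ()) (λ _ ()) (λ _ ())
      where go : ∀ {x} → IsB x → H 0 (suc q) ≡ x → ⊥
            go (isB _ n) refl = n c
    classify (V p (suc q)) fe with kink? p q
    ... | yes k = clKV k
    ... | no n = cl- (λ _ _ ()) (λ _ _ ()) (λ ()) (λ ()) (λ _ ()) (λ { k refl → n k })
    classify (H (suc p) q) fe with kink? p q
    ... | yes k = clKH k
    ... | no n = cl- (λ _ _ ()) (λ _ _ ()) (λ ()) (λ ()) (λ { k refl → n k }) (λ _ ())

    module _ {σ₁ σ₂ : List ℕ} (p₁ : σ₁ ↭ upTo k₁) (p₂ : σ₂ ↭ upTo k₂) (zs : List Bool) where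

      opaque
        inner : Sym
        inner = permA p₁ ⊙ permB p₂ ⊙ kinkAct zs

        private
          kfix : ∀ {e} → Facet e → (∀ {p q} → Kink p q → e ≢ H (suc p) q) → (∀ {p q} → Kink p q → e ≢ V p (suc q)) → π (kinkAct zs) e ≡ e
          kfix fe n m = kinkAct-off zs _ fe (λ k _ → n k) (λ k _ → m k)

          abfix : ∀ {e} → Facet e → (∀ i → i < k₁ → e ≢ cA i) → (∀ i → i < k₂ → e ≢ cB i) → π (permA p₁) (π (permB p₂) e) ≡ e
          abfix fe n m = trans (cong (π (permA p₁)) (permB-off p₂ fe m)) (permA-off p₁ fe n)

        inner-A : ∀ {i} → i < k₁ → π inner (cA i) ≡ cA (at σ₁ i)
        inner-A {i} h = trans (cong (π (permA p₁) ∘ π (permB p₂)) (kfix f (λ _ ()) (λ _ ())))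
            (trans (cong (π (permA p₁)) (permB-off p₂ f (λ _ _ ()))) (permA-on p₁ h))
          where f : Facet (cA i)
                f = A-facet (cA-isA h)

        inner-B : ∀ {i} → i < k₂ → π inner (cB i) ≡ cB (at σ₂ i)
        inner-B h = trans (cong (π (permA p₁) ∘ π (permB p₂)) (kfix (B-facet (cB-isB h)) (λ _ ()) (λ _ ())))
            (trans (cong (π (permA p₁)) (permB-on p₂ h)) (permA-off p₁ (B-facet (cB-isB (permB-< p₂ h))) (λ _ _ ())))

        inner-V : Facet (V 0 0) → π inner (V 0 0) ≡ V 0 0
        inner-V f = trans (cong (π (permA p₁) ∘ π (permB p₂)) (kfix {V 0 0} f (λ _ ()) (λ _ ())))
          (abfix {V 0 0} f (λ i h e → baseA>0 h (sym (proj₁ (V-inj e)))) (λ _ _ ()))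

        inner-H : Facet (H 0 0) → π inner (H 0 0) ≡ H 0 0
        inner-H f = trans (cong (π (permA p₁) ∘ π (permB p₂)) (kfix {H 0 0} f (λ _ ()) (λ _ ())))
          (abfix {H 0 0} f (λ _ _ ()) (λ i h e → baseB>0 h (sym (proj₂ (H-inj e)))))

        inner-KH : ∀ {p q} → Kink p q → π inner (H (suc p) q) ≡ (if bit-at zs q then V p (suc q) else H (suc p) q)
        inner-KH {p} {q} k with bit-at zs q in eq
        ... | true = trans (cong (π (permA p₁) ∘ π (permB p₂)) (kinkAct-H zs k eq))
                       (abfix {V p (suc q)} (kink-cell k) (λ _ _ ()) (λ _ _ ()))
        ... | false = trans (cong (π (permA p₁) ∘ π (permB p₂)) (kinkAct-off zs (H (suc p) q) (kink-cell k)
                          (λ { k′ b refl → false≢true (trans (sym eq) b) }) (λ _ _ ())))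
                        (abfix {H (suc p) q} (kink-cell k) (λ _ _ ()) (λ _ _ ()))
          where false≢true : false ≡ true → ⊥
                false≢true ()

        inner-KV : ∀ {p q} → Kink p q → π inner (V p (suc q)) ≡ (if bit-at zs q then H (suc p) q else V p (suc q))
        inner-KV {p} {q} k with bit-at zs q in eq
        ... | true = trans (cong (π (permA p₁) ∘ π (permB p₂)) (kinkAct-V zs k eq))
                       (abfix {H (suc p) q} (kink-cell k) (λ _ _ ()) (λ _ _ ()))
        ... | false = trans (cong (π (permA p₁) ∘ π (permB p₂)) (kinkAct-off zs (V p (suc q)) (kink-cell k)
                          (λ _ _ ()) (λ { k′ b refl → false≢true (trans (sym eq) b) })))
                        (abfix {V p (suc q)} (kink-cell k) (λ _ _ ()) (λ _ _ ()))
          where false≢true : false ≡ true → ⊥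
                false≢true ()

        inner-off : ∀ {e} → Facet e → (∀ i → i < k₁ → e ≢ cA i) → (∀ i → i < k₂ → e ≢ cB i) →
          (∀ {p q} → Kink p q → e ≢ H (suc p) q) → (∀ {p q} → Kink p q → e ≢ V p (suc q)) → π inner e ≡ e
        inner-off fe a b n m = trans (cong (π (permA p₁) ∘ π (permB p₂)) (kfix fe n m)) (abfix fe a b)

      module _ (z₀ : Bool) where
        opaque
          normal : Sym
          normal = toggle z₀ ⊙ inner

          normal-inner : ∀ e → π normal e ≡ π (toggle z₀) (π inner e)
          normal-inner e = refl

          private
            tfix : ∀ {e e′} → π inner e ≡ e′ → Facet e′ → e′ ≢ V 0 0 → e′ ≢ H 0 0 → π normal e ≡ e′
            tfix h fe n m = trans (cong (π (toggle z₀)) h) (toggle-off z₀ fe n m)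

          normal-A : ∀ {i} → i < k₁ → π normal (cA i) ≡ cA (at σ₁ i)
          normal-A h = tfix (inner-A h) (A-facet (cA-isA (permA-< p₁ h))) (λ e → baseA>0 (permA-< p₁ h) (proj₁ (V-inj e))) (λ ())

          normal-B : ∀ {i} → i < k₂ → π normal (cB i) ≡ cB (at σ₂ i)
          normal-B h = tfix (inner-B h) (B-facet (cB-isB (permB-< p₂ h))) (λ ()) (λ e → baseB>0 (permB-< p₂ h) (proj₂ (H-inj e)))

          normal-V : Facet (V 0 0) → π normal (V 0 0) ≡ (if z₀ then H 0 0 else V 0 0)
          normal-V f = trans (cong (π (toggle z₀)) (inner-V f)) (toggle-V z₀)

          normal-H : Facet (H 0 0) → π normal (H 0 0) ≡ (if z₀ then V 0 0 else H 0 0)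
          normal-H f = trans (cong (π (toggle z₀)) (inner-H f)) (toggle-H z₀)

          normal-KH : ∀ {p q} → Kink p q → π normal (H (suc p) q) ≡ (if bit-at zs q then V p (suc q) else H (suc p) q)
          normal-KH {p} {q} k with bit-at zs q | inner-KH k
          ... | true  | h = tfix h (kink-cell k) (λ ()) (λ ())
          ... | false | h = tfix h (kink-cell k) (λ ()) (λ ())

          normal-KV : ∀ {p q} → Kink p q → π normal (V p (suc q)) ≡ (if bit-at zs q then H (suc p) q else V p (suc q))
          normal-KV {p} {q} k with bit-at zs q | inner-KV k
          ... | true  | h = tfix h (kink-cell k) (λ ()) (λ ())
          ... | false | h = tfix h (kink-cell k) (λ ()) (λ ())

          normal-off : ∀ {e} → Facet e → (∀ i → i < k₁ → e ≢ cA i) → (∀ i → i < k₂ → e ≢ cB i) → e ≢ V 0 0 → e ≢ H 0 0 →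
            (∀ {p q} → Kink p q → e ≢ H (suc p) q) → (∀ {p q} → Kink p q → e ≢ V p (suc q)) → π normal e ≡ e
          normal-off fe a b c d n m = tfix (inner-off fe a b n m) fe c d

-- Both lists are free of repetitions, the first because `f` is injective, and they have the same
-- members because it is surjective.
applyUpTo-↭ : ∀ k (f f⁻ : ℕ → ℕ) → (∀ {i} → i < k → f i < k) → (∀ {i} → i < k → f⁻ i < k) →
  (∀ {i} → i < k → f (f⁻ i) ≡ i) → (∀ {i} → i < k → f⁻ (f i) ≡ i) → applyUpTo f k ↭ upTo k
applyUpTo-↭ k f f⁻ f< f⁻< ff⁻ f⁻f = ∼bag⇒↭ (unique∧set⇒bag
  (applyUpTo⁺₁ f k λ i<j j<k e → ℕₚ.<⇒≢ i<j (trans (sym (f⁻f (ℕₚ.<-trans i<j j<k))) (trans (cong f⁻ e) (f⁻f j<k))))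
  (upTo⁺ k)
  (mk⇔ (λ x∈ → to (∈-applyUpTo⁻ f x∈)) (λ x∈ → from (∈-applyUpTo⁻ (λ j → j) x∈))))
  where
  to : ∀ {x} → (∃ λ i → i < k × x ≡ f i) → x ∈ upTo k
  to (i , i<k , refl) = ∈-applyUpTo⁺ (λ j → j) (f< i<k)
  from : ∀ {x} → (∃ λ i → i < k × x ≡ i) → x ∈ applyUpTo f k
  from (i , i<k , refl) = subst (_∈ applyUpTo f k) (ff⁻ i<k) (∈-applyUpTo⁺ f (f⁻< i<k))

bool-ext : ∀ {a b} → (a ≡ true → b ≡ true) → (b ≡ true → a ≡ true) → a ≡ b
bool-ext {true} {b} f g = sym (f refl)
bool-ext {false} {true} f g = g refl
bool-ext {false} {false} f g = refl

vertical : Edge → Bool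
vertical (V _ _) = true
vertical (H _ _) = false

-- The action is a homomorphism, injective and surjective

module Laws (S : Shape) (k₁ k₂ : ℕ) (endA : Action.EndA S k₁) (endB : Action.EndB S k₂)
  (pal⇒k : Action.Pal S → k₁ ≡ k₂) where
  open Shape S
  open Poly S
  open Symmetry S
  open Pairs S
  open Rigidity S
  open Conflicts S using (lo0<hi0)
  open Generators S
  open Action S
  open Ends k₁ k₂ endA endB

  -- Next to the diagonal, `Free c q` says that `lo` jumps between `q` and `q + 1`. Symmetry of the
  -- jumps means that `hi` falls exactly when `lo` rises, so the sum stays constant.
  step-pal : (∀ c q → suc (c + q) ≡ N → Free c q → Free q c) → Pal
  step-pal h zero = refl
  step-pal h (suc p) with p ℕₚ.<? N
  ... | no p≮N = trans (cong₂ _+_ (trans (lo-top (ℕₚ.m≤n⇒m≤1+n (ℕₚ.≮⇒≥ p≮N))) (sym (lo-top (ℕₚ.≮⇒≥ p≮N))))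
                   (trans (hi-def (suc p)) (trans (cong lo (trans (ℕₚ.m≤n⇒m∸n≡0 (ℕₚ.m≤n⇒m≤1+n (ℕₚ.≮⇒≥ p≮N)))
                     (sym (ℕₚ.m≤n⇒m∸n≡0 (ℕₚ.≮⇒≥ p≮N))))) (sym (hi-def p))))) (step-pal h p)
  ... | yes p<N = trans same (step-pal h p)
    where
    c = N ∸ suc p
    e : suc (c + p) ≡ N
    e = trans (sym (ℕₚ.+-suc c p)) (ℕₚ.m∸n+n≡m p<N)
    e′ : suc (p + c) ≡ N
    e′ = trans (cong suc (ℕₚ.+-comm p c)) e
    hi-c : hi c ≡ lo (suc p)
    hi-c = hi-diag (trans (ℕₚ.+-suc c p) e)
    hi-p : hi p ≡ lo (suc c)
    hi-p = hi-diag (trans (ℕₚ.+-suc p c) e′)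
    hi-sp : hi (suc p) ≡ lo c
    hi-sp = hi-diag e′
    same : lo (suc p) + hi (suc p) ≡ lo p + hi p
    same rewrite hi-sp | hi-p with lo p ℕₚ.<? lo (suc p)
    ... | yes up = trans (cong (_+ lo c) (ℕₚ.≤-antisym (lo-step p) up)) (trans (sym (ℕₚ.+-suc (lo p) (lo c)))
            (cong (lo p +_) (ℕₚ.≤-antisym (subst (lo c <_) hi-p (h c p e (subst (lo p <_) (sym hi-c) up))) (lo-step c))))
    ... | no ¬up = cong₂ _+_ (ℕₚ.≤-antisym (ℕₚ.≮⇒≥ ¬up) (lo-mono (ℕₚ.n≤1+n p)))
            (ℕₚ.≤-antisym (lo-mono (ℕₚ.n≤1+n c)) (ℕₚ.≮⇒≥ λ up → ¬up (subst (lo p <_) hi-c (h p c e′ (subst (lo c <_) (sym hi-p) up)))))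

  -- `Valid` in terms of the shape: kinks instead of pairs of long blocks, and symmetric bounds
  -- instead of a palindrome.
  record Good (g : GElt) : Set where
    constructor good
    field
      perm₁ : g-σ₁ g ↭ upTo k₁
      perm₂ : g-σ₂ g ↭ upTo k₂
      len   : length (g-zs g) ≡ kinks#
      pal   : g-t g ≡ true → Pal

  turn : (b : Bool) → (b ≡ true → Pal) → Sym
  turn false h = idSym
  turn true  h = Reflect.reflectSym (h refl)

  symOf : ∀ g → Good g → Sym
  symOf g (good p₁ p₂ _ pal) = normal p₁ p₂ (g-zs g) (g-z₀ g) ⊙ turn (g-t g) pal

  private
    f00 : Facet (V 0 0)
    f00 = lo0<hi0

    g00 : Facet (H 0 0)
    g00 = lo0<hi0

  module _ {σ₁ σ₂ τ₁ τ₂ : List ℕ} (p₁ : σ₁ ↭ upTo k₁) (p₂ : σ₂ ↭ upTo k₂) (q₁ : τ₁ ↭ upTo k₁) (q₂ : τ₂ ↭ upTo k₂)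
    (r₁ : (σ₁ ∘ₚ τ₁) ↭ upTo k₁) (r₂ : (σ₂ ∘ₚ τ₂) ↭ upTo k₂) (zs ys : List Bool) (len : length zs ≡ length ys) (z y : Bool) where

    private
      P = normal p₁ p₂ zs z
      Q = normal q₁ q₂ ys y
      R = normal r₁ r₂ (zipWith _xor_ zs ys) (z xor y)

      apply-if : ∀ b {e f e′ f′} → π P e ≡ e′ → π P f ≡ f′ → π P (if b then e else f) ≡ (if b then e′ else f′)
      apply-if true  h _ = h
      apply-if false _ h = h

      swap-if : ∀ {A : Set} y z (a b : A) → (if y then (if z then a else b) else (if z then b else a)) ≡ (if z xor y then b else a)
      swap-if y false a b with y
      ... | true = refl
      ... | false = refl
      swap-if y true a b with y
      ... | true = refl
      ... | false = refl

      bits : ∀ q → bit-at (zipWith _xor_ zs ys) q ≡ bit-at zs q xor bit-at ys q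
      bits q = nth-xor zs ys len

      two-step : ∀ {e a b} → (b′ b″ : Bool) → π Q e ≡ (if b″ then b else a) → π P b ≡ (if b′ then a else b) → π P a ≡ (if b′ then b else a) →
        π R e ≡ (if b′ xor b″ then b else a) → π P (π Q e) ≡ π R e
      two-step {e} {a} {b} b′ b″ hq hb ha hr = trans (cong (π P) hq) (trans (apply-if b″ hb ha) (trans (swap-if b″ b′ a b) (sym hr)))

    normal-∘ : ∀ {e} → Facet e → π P (π Q e) ≡ π R e
    normal-∘ {e} fe with classify e fe
    ... | clA {i} h = trans (cong (π P) (normal-A q₁ q₂ ys y h)) (trans (normal-A p₁ p₂ zs z (permA-< q₁ h))
            (trans (cong cA (sym (at-map (at σ₁) τ₁ (subst (i <_) (sym (perm-length q₁)) h)))) (sym (normal-A r₁ r₂ _ _ h))))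
    ... | clB {i} h = trans (cong (π P) (normal-B q₁ q₂ ys y h)) (trans (normal-B p₁ p₂ zs z (permB-< q₂ h))
            (trans (cong cB (sym (at-map (at σ₂) τ₂ (subst (i <_) (sym (perm-length q₂)) h)))) (sym (normal-B r₁ r₂ _ _ h))))
    ... | cl0V = two-step z y (normal-V q₁ q₂ ys y f00) (normal-H p₁ p₂ zs z g00) (normal-V p₁ p₂ zs z f00) (normal-V r₁ r₂ _ _ f00)
    ... | cl0H = two-step z y (normal-H q₁ q₂ ys y g00) (normal-V p₁ p₂ zs z f00) (normal-H p₁ p₂ zs z g00) (normal-H r₁ r₂ _ _ g00)
    ... | clKH {p} {q} k = two-step (bit-at zs q) (bit-at ys q) (normal-KH q₁ q₂ ys y k) (normal-KV p₁ p₂ zs z k) (normal-KH p₁ p₂ zs z k)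
            (subst (λ b → π R (H (suc p) q) ≡ (if b then V p (suc q) else H (suc p) q)) (bits q) (normal-KH r₁ r₂ _ _ k))
    ... | clKV {p} {q} k = two-step (bit-at zs q) (bit-at ys q) (normal-KV q₁ q₂ ys y k) (normal-KH p₁ p₂ zs z k) (normal-KV p₁ p₂ zs z k)
            (subst (λ b → π R (V p (suc q)) ≡ (if b then H (suc p) q else V p (suc q))) (bits q) (normal-KV r₁ r₂ _ _ k))
    ... | cl- a b c d n m = trans (cong (π P) (normal-off q₁ q₂ ys y fe a b c d n m))
            (trans (normal-off p₁ p₂ zs z fe a b c d n m) (sym (normal-off r₁ r₂ _ _ fe a b c d n m)))

  module _ (pal : Pal) where

    private
      lo≡ : ∀ {a b} → hi a ≡ hi b → lo a ≡ lo b
      lo≡ {a} {b} e = ℕₚ.+-cancelʳ-≡ (hi a) (lo a) (lo b) (trans (pal a) (trans (sym (pal b)) (cong (lo b +_) (sym e))))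

      lo< : ∀ {a b} → hi b < hi a → lo a < lo b
      lo< {a} {b} h = ℕₚ.≰⇒> λ le → ℕₚ.<-irrefl (trans (pal b) (sym (pal a))) (ℕₚ.+-mono-≤-< le h)

    kink-tr : ∀ {p q} → Kink p q → Kink q p
    kink-tr {p} {q} k@(e , a , b , c) = trans (cong (3 +_) (ℕₚ.+-comm q p)) e ,
      lo≡ (trans (kink-hi₀ k) (trans (sym c) (sym (kink-hi₁ k)))) ,
      lo< (subst₂ _<_ (sym (kink-hi₂ k)) (sym (kink-hi₁ k)) b) ,
      lo≡ (trans (kink-hi₂ k) (trans (sym a) (sym (hi-diag e))))

    private
      kinkAt-tr : ∀ a b → 3 + (a + b) ≡ N → kinkAt a ≡ kinkAt b
      kinkAt-tr a b e = bool-ext (half a b e) (half b a (trans (cong (3 +_) (ℕₚ.+-comm b a)) e))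
        where
        half : ∀ a b → 3 + (a + b) ≡ N → kinkAt a ≡ true → kinkAt b ≡ true
        half a b e h = kink-true (kink-tr (subst (λ x → Kink x a)
          (trans (cong (λ n → n ∸ 3 ∸ a) (sym e)) (ℕₚ.m+n∸m≡n a b)) (true-kink h)))

    -- Transposition sends the kink in column `q` to the kink in column `p` and thus reverses the
    -- order of the kinks. This is where the reversal of the bits in the twist comes from.
    rank-sum : ∀ {p q} → Kink p q → suc (count kinkAt p + count kinkAt q) ≡ kinks#
    rank-sum {p} {q} k@(e , _) = sym (begin
      count kinkAt (N ∸ 2)                                               ≡⟨ cong (λ n → count kinkAt (n ∸ 2)) (sym e) ⟩
      count kinkAt (suc (p + q))                                         ≡⟨ cong (count kinkAt ∘ suc) (ℕₚ.+-comm p q) ⟩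
      count kinkAt (suc q + p)                                           ≡⟨ count-+ kinkAt (suc q) p ⟩
      count kinkAt (suc q) + count (λ i → kinkAt (suc q + i)) p          ≡⟨ cong₂ _+_ (count-true kinkAt (kink-true k)) (count-cong p λ i i<p → kinkAt-tr _ _ (sum i i<p)) ⟩
      suc (count kinkAt q) + count (λ i → kinkAt (p ∸ suc i)) p          ≡⟨ cong (suc (count kinkAt q) +_) (count-reverse kinkAt p) ⟩
      suc (count kinkAt q + count kinkAt p)                              ≡⟨ cong suc (ℕₚ.+-comm (count kinkAt q) _) ⟩
      suc (count kinkAt p + count kinkAt q)                              ∎)
      where
      open ≡-Reasoning
      sum : ∀ i → i < p → 3 + ((suc q + i) + (p ∸ suc i)) ≡ N
      sum i i<p = trans (cong (3 +_) (trans (cong (_+ (p ∸ suc i)) (sym (ℕₚ.+-suc q i)))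
        (trans (ℕₚ.+-assoc q (suc i) (p ∸ suc i)) (trans (cong (q +_) (ℕₚ.m+[n∸m]≡n i<p)) (ℕₚ.+-comm q p))))) e

    private
      k≡ : k₁ ≡ k₂
      k≡ = pal⇒k pal

      tr-A : ∀ i → tr (cA i) ≡ cB i
      tr-A i = cong (λ k → H 0 (N ∸ k + i)) k≡

      tr-B : ∀ i → tr (cB i) ≡ cA i
      tr-B i = cong (λ k → V (N ∸ k + i) 0) (sym k≡)

      un-tr : ∀ {e f} → tr e ≡ f → e ≡ tr f
      un-tr {e} refl = sym (tr-tr e)

    module _ {τ₁ τ₂ : List ℕ} (q₁ : τ₁ ↭ upTo k₁) (q₂ : τ₂ ↭ upTo k₂) (q₂′ : τ₂ ↭ upTo k₁) (q₁′ : τ₁ ↭ upTo k₂)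
      (ys : List Bool) (len : length ys ≡ kinks#) (y : Bool) where

      private
        Q = normal q₁ q₂ ys y
        R = normal q₂′ q₁′ (reverse ys) y

        tr-if : ∀ b {e f} → tr (if b then e else f) ≡ (if b then tr e else tr f)
        tr-if true = refl
        tr-if false = refl

        bits : ∀ {p q} → Kink p q → bit-at (reverse ys) p ≡ bit-at ys q
        bits {p} {q} k = nth-reverse ys {count kinkAt p} {count kinkAt q} (trans (rank-sum k) (sym len))

      -- Commuting with the transposition realises the twist: the ends A and B exchange their
      -- permutations, the bits of the kinks are reversed, and the corner bit stays because both
      -- corner edges are transposed.
      normal-tr : ∀ {e} → Facet e → tr (π Q e) ≡ π R (tr e)
      normal-tr {e} fe with classify e fe
      ... | clA {i} h = trans (cong tr (normal-A q₁ q₂ ys y h)) (trans (tr-A _)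
              (trans (sym (normal-B q₂′ q₁′ (reverse ys) y (subst (i <_) k≡ h))) (cong (π R) (sym (tr-A i)))))
      ... | clB {i} h = trans (cong tr (normal-B q₁ q₂ ys y h)) (trans (tr-B _)
              (trans (sym (normal-A q₂′ q₁′ (reverse ys) y (subst (i <_) (sym k≡) h))) (cong (π R) (sym (tr-B i)))))
      ... | cl0V = trans (cong tr (normal-V q₁ q₂ ys y f00)) (trans (tr-if y) (sym (normal-H q₂′ q₁′ (reverse ys) y g00)))
      ... | cl0H = trans (cong tr (normal-H q₁ q₂ ys y g00)) (trans (tr-if y) (sym (normal-V q₂′ q₁′ (reverse ys) y f00)))
      ... | clKH {p} {q} k = trans (cong tr (normal-KH q₁ q₂ ys y k)) (trans (tr-if (bit-at ys q))
              (sym (subst (λ b → π R (V q (suc p)) ≡ (if b then H (suc q) p else V q (suc p))) (bits k) (normal-KV q₂′ q₁′ (reverse ys) y (kink-tr k)))))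
      ... | clKV {p} {q} k = trans (cong tr (normal-KV q₁ q₂ ys y k)) (trans (tr-if (bit-at ys q))
              (sym (subst (λ b → π R (H (suc q) p) ≡ (if b then V q (suc p) else H (suc q) p)) (bits k) (normal-KH q₂′ q₁′ (reverse ys) y (kink-tr k)))))
      ... | cl- a b c d n m = trans (cong tr (normal-off q₁ q₂ ys y fe a b c d n m)) (sym (normal-off q₂′ q₁′ (reverse ys) y
              (Reflect.tr-facet pal fe)
              (λ i h eq → b i (subst (i <_) k≡ h) (trans (un-tr eq) (tr-A i)))
              (λ i h eq → a i (subst (i <_) (sym k≡) h) (trans (un-tr eq) (tr-B i)))
              (λ eq → d (un-tr eq)) (λ eq → c (un-tr eq))
              (λ k eq → m (kink-tr k) (un-tr eq)) (λ k eq → n (kink-tr k) (un-tr eq))))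

  -- The symmetry is built along a derivation of `σ ↭ upTo k`, of which there are many; the induced
  -- permutation of the facets depends only on `σ`.
  normal-irr : ∀ {σ₁ σ₂} (p₁ q₁ : σ₁ ↭ upTo k₁) (p₂ q₂ : σ₂ ↭ upTo k₂) zs z {e} → Facet e →
    π (normal p₁ p₂ zs z) e ≡ π (normal q₁ q₂ zs z) e
  normal-irr p₁ q₁ p₂ q₂ zs z {e} fe with classify e fe
  ... | clA h  = trans (normal-A p₁ p₂ zs z h) (sym (normal-A q₁ q₂ zs z h))
  ... | clB h  = trans (normal-B p₁ p₂ zs z h) (sym (normal-B q₁ q₂ zs z h))
  ... | cl0V   = trans (normal-V p₁ p₂ zs z f00) (sym (normal-V q₁ q₂ zs z f00))
  ... | cl0H   = trans (normal-H p₁ p₂ zs z g00) (sym (normal-H q₁ q₂ zs z g00))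
  ... | clKH k = trans (normal-KH p₁ p₂ zs z k) (sym (normal-KH q₁ q₂ zs z k))
  ... | clKV k = trans (normal-KV p₁ p₂ zs z k) (sym (normal-KV q₁ q₂ zs z k))
  ... | cl- a b c d n m = trans (normal-off p₁ p₂ zs z fe a b c d n m) (sym (normal-off q₁ q₂ zs z fe a b c d n m))

  symOf-irr : ∀ g (ok ok′ : Good g) {e} → Facet e → π (symOf g ok) e ≡ π (symOf g ok′) e
  symOf-irr (gelt _ _ zs z false) (good p₁ p₂ _ _) (good q₁ q₂ _ _) fe = normal-irr p₁ q₁ p₂ q₂ zs z fe
  symOf-irr (gelt _ _ zs z true) (good p₁ p₂ _ pal) (good q₁ q₂ _ _) fe = normal-irr p₁ q₁ p₂ q₂ zs z (Reflect.tr-facet (pal refl) fe)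

  length-zipWith : ∀ {n} (zs ys : List Bool) → length zs ≡ n → length ys ≡ n → length (zipWith _xor_ zs ys) ≡ n
  length-zipWith {n} zs ys a b = trans (Listₚ.length-zipWith _xor_ zs ys) (trans (cong₂ ℕ._⊓_ a b) (ℕₚ.⊓-idem n))

  good-· : ∀ g h → Good g → Good h → Good (g · h)
  good-· (gelt s₁ s₂ zs z false) (gelt u₁ u₂ ys y t) (good p₁ p₂ l pal) (good q₁ q₂ l′ pal′) =
    good (∘ₚ-perm p₁ q₁) (∘ₚ-perm p₂ q₂) (length-zipWith zs ys l l′) pal′
  good-· (gelt s₁ s₂ zs z true) (gelt u₁ u₂ ys y t) (good p₁ p₂ l pal) (good q₁ q₂ l′ pal′) =
    good (∘ₚ-perm p₁ (subst (λ k → u₂ ↭ upTo k) (sym k≡) q₂)) (∘ₚ-perm p₂ (subst (λ k → u₁ ↭ upTo k) k≡ q₁))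
      (length-zipWith zs (reverse ys) l (trans (Listₚ.length-reverse ys) l′)) (λ _ → pal refl)
    where k≡ = pal⇒k (pal refl)

  turn-F : ∀ b h {e} → Facet e → Facet (π (turn b h) e)
  turn-F b h = π-F (turn b h)

  hom : ∀ g h (G : Good g) (H : Good h) (GH : Good (g · h)) {e} → Facet e →
    π (symOf (g · h) GH) e ≡ π (symOf g G) (π (symOf h H) e)
  hom (gelt s₁ s₂ zs z false) (gelt u₁ u₂ ys y false) (good p₁ p₂ l pal) (good q₁ q₂ l′ pal′) (good r₁ r₂ _ pal″) fe =
    sym (normal-∘ p₁ p₂ q₁ q₂ r₁ r₂ zs ys (trans l (sym l′)) z y fe)
  hom (gelt s₁ s₂ zs z false) (gelt u₁ u₂ ys y true) (good p₁ p₂ l pal) (good q₁ q₂ l′ pal′) (good r₁ r₂ _ pal″) fe =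
    sym (normal-∘ p₁ p₂ q₁ q₂ r₁ r₂ zs ys (trans l (sym l′)) z y (turn-F true pal′ fe))
  hom (gelt s₁ s₂ zs z true) (gelt u₁ u₂ ys y t) (good p₁ p₂ l pal) (good q₁ q₂ l′ pal′) (good r₁ r₂ _ pal″) {e} fe =
    trans (turned t pal′ pal″) (trans (sym (normal-∘ p₁ p₂ q₂′ q₁′ r₁ r₂ zs (reverse ys) (trans l (sym (trans (Listₚ.length-reverse ys) l′))) z y
        (Reflect.tr-facet (pal refl) (turn-F t pal′ fe))))
      (cong (π (normal p₁ p₂ zs z)) (sym (normal-tr (pal refl) q₁ q₂ q₂′ q₁′ ys l′ y (turn-F t pal′ fe)))))
    where
    k≡ = pal⇒k (pal refl)
    q₂′ = subst (λ k → u₂ ↭ upTo k) (sym k≡) q₂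
    q₁′ = subst (λ k → u₁ ↭ upTo k) k≡ q₁
    R = normal r₁ r₂ (zipWith _xor_ zs (reverse ys)) (z xor y)
    turned : ∀ t (h : t ≡ true → Pal) (h″ : (true xor t) ≡ true → Pal) → π R (π (turn (true xor t) h″) e) ≡ π R (tr (π (turn t h) e))
    turned false h h″ = refl
    turned true h h″ = cong (π R) (sym (tr-tr e))

  -- Applied to `V 1 0` and its transpose `H 0 1`, this separates elements with different last
  -- coordinate.
  normal-vertical : ∀ {σ₁ σ₂} (p₁ : σ₁ ↭ upTo k₁) (p₂ : σ₂ ↭ upTo k₂) zs z {e} → Facet e → e ≢ V 0 0 → e ≢ H 0 0 →
    (∀ p q → e ≢ H (suc p) q) → (∀ p q → e ≢ V p (suc q)) → vertical (π (normal p₁ p₂ zs z) e) ≡ vertical e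
  normal-vertical p₁ p₂ zs z {e} fe a b c d with classify e fe
  ... | clA h  = cong vertical (normal-A p₁ p₂ zs z h)
  ... | clB h  = cong vertical (normal-B p₁ p₂ zs z h)
  ... | cl0V   = ⊥-elim (a refl)
  ... | cl0H   = ⊥-elim (b refl)
  ... | clKH k = ⊥-elim (c _ _ refl)
  ... | clKV k = ⊥-elim (d _ _ refl)
  ... | cl- n₁ n₂ n₃ n₄ n₅ n₆ = cong vertical (normal-off p₁ p₂ zs z fe n₁ n₂ n₃ n₄ n₅ n₆)

  module _ {σ₁ σ₂ τ₁ τ₂ : List ℕ} (p₁ : σ₁ ↭ upTo k₁) (p₂ : σ₂ ↭ upTo k₂) (q₁ : τ₁ ↭ upTo k₁) (q₂ : τ₂ ↭ upTo k₂)
    (zs ys : List Bool) (l : length zs ≡ kinks#) (l′ : length ys ≡ kinks#) (z y : Bool)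
    (eq : ∀ e → Facet e → π (normal p₁ p₂ zs z) e ≡ π (normal q₁ q₂ ys y) e) where

    private
      if-inj : ∀ {e f : Edge} b c → f ≢ e → (if b then e else f) ≡ (if c then e else f) → b ≡ c
      if-inj true true n h = refl
      if-inj false false n h = refl
      if-inj true false n h = ⊥-elim (n (sym h))
      if-inj false true n h = ⊥-elim (n h)

      kinked : ∀ {p q} → Kink p q → bit-at zs q ≡ bit-at ys q
      kinked {p} {q} k = if-inj _ _ (λ ()) (trans (sym (normal-KH p₁ p₂ zs z k)) (trans (eq (H (suc p) q) (kink-cell k)) (normal-KH q₁ q₂ ys y k)))

    normal-inj : σ₁ ≡ τ₁ × σ₂ ≡ τ₂ × zs ≡ ys × z ≡ y
    normal-inj =
      at-ext σ₁ τ₁ (trans (perm-length p₁) (sym (perm-length q₁))) (λ i h → let h′ = subst (i <_) (perm-length p₁) h in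
        cA-inj (trans (sym (normal-A p₁ p₂ zs z h′)) (trans (eq (cA i) (A-facet (cA-isA h′))) (normal-A q₁ q₂ ys y h′)))) ,
      at-ext σ₂ τ₂ (trans (perm-length p₂) (sym (perm-length q₂))) (λ i h → let h′ = subst (i <_) (perm-length p₂) h in
        cB-inj (trans (sym (normal-B p₁ p₂ zs z h′)) (trans (eq (cB i) (B-facet (cB-isB h′))) (normal-B q₁ q₂ ys y h′)))) ,
      nth-ext zs ys (trans l (sym l′)) bits ,
      if-inj z y (λ ()) (trans (sym (normal-V p₁ p₂ zs z f00)) (trans (eq (V 0 0) f00) (normal-V q₁ q₂ ys y f00)))
      where
      bits : ∀ i → i < length zs → nth zs i ≡ nth ys i
      bits i h with count-find kinkAt (N ∸ 2) (subst (i <_) l h)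
      ... | q , _ , w , refl = kinked (true-kink w)

  injective : ∀ g h (G : Good g) (H : Good h) → (∀ e → Facet e → π (symOf g G) e ≡ π (symOf h H) e) → g ≡ h
  injective (gelt s₁ s₂ zs z false) (gelt u₁ u₂ ys y false) (good p₁ p₂ l pal) (good q₁ q₂ l′ pal′) eq
    with normal-inj p₁ p₂ q₁ q₂ zs ys l l′ z y eq
  ... | refl , refl , refl , refl = refl
  injective (gelt s₁ s₂ zs z true) (gelt u₁ u₂ ys y true) (good p₁ p₂ l pal) (good q₁ q₂ l′ pal′) eq
    with normal-inj p₁ p₂ q₁ q₂ zs ys l l′ z y
      (λ e fe → subst (λ x → π (normal p₁ p₂ zs z) x ≡ π (normal q₁ q₂ ys y) x) (tr-tr e) (eq (tr e) (Reflect.tr-facet (pal refl) fe)))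
  ... | refl , refl , refl , refl = refl
  injective (gelt s₁ s₂ zs z false) (gelt u₁ u₂ ys y true) (good p₁ p₂ l pal) (good q₁ q₂ l′ pal′) eq
    with trans (sym (normal-vertical p₁ p₂ zs z {V 1 0} free10 (λ ()) (λ ()) (λ _ _ ()) (λ _ _ ())))
           (trans (cong vertical (eq (V 1 0) free10)) (normal-vertical q₁ q₂ ys y {H 0 1} (Reflect.tr-facet (pal′ refl) {V 1 0} free10) (λ ()) (λ ()) (λ _ _ ()) (λ _ _ ())))
  ... | ()
  injective (gelt s₁ s₂ zs z true) (gelt u₁ u₂ ys y false) (good p₁ p₂ l pal) (good q₁ q₂ l′ pal′) eq
    with trans (sym (normal-vertical q₁ q₂ ys y {V 1 0} free10 (λ ()) (λ ()) (λ _ _ ()) (λ _ _ ())))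
           (trans (cong vertical (sym (eq (V 1 0) free10))) (normal-vertical p₁ p₂ zs z {H 0 1} (Reflect.tr-facet (pal refl) {V 1 0} free10) (λ ()) (λ ()) (λ _ _ ()) (λ _ _ ())))
  ... | ()

  -- The free position (p + 1 , q + 1) must be next to the diagonal: further inside, `lo (2 + q)`
  -- would be at most `hi (2 + p)`, whereas the two missing cells make these bounds cross.
  swap-kink : ∀ {p q} → Cell p q → Free (suc p) (suc q) → ¬ Cell (suc p) q → ¬ Cell p (suc q) → Kink p q
  swap-kink {p} {q} y fr ¬up ¬right = sum , lo≡ ,
      subst (lo (suc q) <_) hi₁ fr , trans (sym hi₁) (trans hi≡ hi₀)
    where
    open Points S using (thin)
    +² : ∀ a b → a + suc (suc b) ≡ suc (suc (a + b))
    +² a b = trans (ℕₚ.+-suc a (suc b)) (cong suc (ℕₚ.+-suc a b))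
    thin₁ : hi (suc p) ≡ suc (lo q)
    thin₁ = thin (proj₁ y) ¬up
    thin₂ : hi p ≡ suc (lo (suc q))
    thin₂ = thin (proj₂ y) ¬right
    lo≡ : lo q ≡ lo (suc q)
    lo≡ = ℕₚ.≤-antisym (lo-mono (ℕₚ.n≤1+n q)) (ℕₚ.≤-pred (ℕₚ.≤-trans fr (ℕₚ.≤-reflexive thin₁)))
    hi≡ : hi (suc p) ≡ hi p
    hi≡ = trans thin₁ (trans (cong suc lo≡) (sym thin₂))
    low : hi (2 + p) ≤ lo q
    low = ℕₚ.≮⇒≥ λ lt → ¬up (lt , fr)
    high : hi p ≤ lo (2 + q)
    high = ℕₚ.≮⇒≥ λ lt → ¬right (fr , lt)
    sum : 3 + (p + q) ≡ N
    sum with ℕₚ.m≤n⇒m<n∨m≡n (ℕₚ.≤-trans (ℕₚ.≤-reflexive (cong (2 +_) (sym (ℕₚ.+-suc p q)))) (free⇒< fr))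
    ... | inj₂ e = e
    ... | inj₁ lt = ⊥-elim (ℕₚ.<⇒≱ (ℕₚ.≤-reflexive (sym thin₁)) (ℕₚ.≤-trans (ℕₚ.≤-reflexive hi≡)
            (ℕₚ.≤-trans high (ℕₚ.≤-trans (lo≤hi {2 + p} {2 + q} (ℕₚ.≤-trans (ℕₚ.≤-reflexive (cong (2 +_) (+² p q))) lt)) low))))
    hi₁ : hi (suc p) ≡ lo (2 + q)
    hi₁ = hi-diag (trans (cong suc (+² p q)) sum)
    hi₀ : hi p ≡ lo (3 + q)
    hi₀ = hi-diag (trans (ℕₚ.+-suc p (2 + q)) (trans (cong suc (+² p q)) sum))

  keeps-inv : ∀ {G} → Keeps G → Keeps (inv G)
  keeps-inv {G} (kA , kB) with keeps-or-swaps (inv G)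
  ... | inj₁ k = k
  ... | inj₂ (sA , _) = ⊥-elim (A≢B a₀-A (subst IsB (ππ⁻ G (A-facet a₀-A)) (kB (sA a₀-A))))

  private
    indexA indexB : Sym → ℕ → ℕ
    indexA G i = row (π G (cA i)) ∸ (N ∸ k₁)
    indexB G i = col (π G (cB i)) ∸ (N ∸ k₂)

    indexA-spec : ∀ G → Keeps G → ∀ {i} → i < k₁ → indexA G i < k₁ × π G (cA i) ≡ cA (indexA G i)
    indexA-spec G (kA , _) {i} h with A-index (kA (cA-isA h))
    ... | inj₂ (k≡0 , _) = ⊥-elim (ℕₚ.n≮0 (subst (i <_) k≡0 h))
    ... | inj₁ (j , j<k , e) = subst (_< k₁) (sym ix) j<k , trans e (cong cA (sym ix))
      where ix : indexA G i ≡ j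
            ix = trans (cong (λ x → row x ∸ (N ∸ k₁)) e) (ℕₚ.m+n∸m≡n (N ∸ k₁) j)

    indexB-spec : ∀ G → Keeps G → ∀ {i} → i < k₂ → indexB G i < k₂ × π G (cB i) ≡ cB (indexB G i)
    indexB-spec G (_ , kB) {i} h with B-index (kB (cB-isB h))
    ... | inj₂ (k≡0 , _) = ⊥-elim (ℕₚ.n≮0 (subst (i <_) k≡0 h))
    ... | inj₁ (j , j<k , e) = subst (_< k₂) (sym ix) j<k , trans e (cong cB (sym ix))
      where ix : indexB G i ≡ j
            ix = trans (cong (λ x → col x ∸ (N ∸ k₂)) e) (ℕₚ.m+n∸m≡n (N ∸ k₂) j)

    indexA-inv : ∀ G → Keeps G → ∀ {i} → i < k₁ → indexA (inv G) (indexA G i) ≡ i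
    indexA-inv G k h = cA-inj (trans (sym (proj₂ (indexA-spec (inv G) (keeps-inv {G} k) (proj₁ (indexA-spec G k h)))))
      (trans (cong (π⁻ G) (sym (proj₂ (indexA-spec G k h)))) (π⁻π G (A-facet (cA-isA h)))))

    indexB-inv : ∀ G → Keeps G → ∀ {i} → i < k₂ → indexB (inv G) (indexB G i) ≡ i
    indexB-inv G k h = cB-inj (trans (sym (proj₂ (indexB-spec (inv G) (keeps-inv {G} k) (proj₁ (indexB-spec G k h)))))
      (trans (cong (π⁻ G) (sym (proj₂ (indexB-spec G k h)))) (π⁻π G (B-facet (cB-isB h)))))

    indexA-inv′ : ∀ G → Keeps G → ∀ {i} → i < k₁ → indexA G (indexA (inv G) i) ≡ i
    indexA-inv′ G k h = cA-inj (trans (sym (proj₂ (indexA-spec G k (proj₁ (indexA-spec (inv G) (keeps-inv {G} k) h)))))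
      (trans (cong (π G) (sym (proj₂ (indexA-spec (inv G) (keeps-inv {G} k) h)))) (ππ⁻ G (A-facet (cA-isA h)))))

    indexB-inv′ : ∀ G → Keeps G → ∀ {i} → i < k₂ → indexB G (indexB (inv G) i) ≡ i
    indexB-inv′ G k h = cB-inj (trans (sym (proj₂ (indexB-spec G k (proj₁ (indexB-spec (inv G) (keeps-inv {G} k) h)))))
      (trans (cong (π G) (sym (proj₂ (indexB-spec (inv G) (keeps-inv {G} k) h)))) (ππ⁻ G (B-facet (cB-isB h)))))

  module Factor (G : Sym) (πV : π G (V 0 0) ≡ V 0 0) (πH : π G (H 0 0) ≡ H 0 0) (π↑ : π G (H 1 0) ≡ H 1 0) where
    open Straight G πV πH π↑

    opaque
      σ₁ σ₂ : List ℕ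
      σ₁ = applyUpTo (indexA G) k₁
      σ₂ = applyUpTo (indexB G) k₂

      perm₁ : σ₁ ↭ upTo k₁
      perm₁ = applyUpTo-↭ k₁ (indexA G) (indexA (inv G)) (proj₁ ∘ indexA-spec G keeps)
        (proj₁ ∘ indexA-spec (inv G) (keeps-inv {G} keeps)) (indexA-inv′ G keeps) (indexA-inv G keeps)

      perm₂ : σ₂ ↭ upTo k₂
      perm₂ = applyUpTo-↭ k₂ (indexB G) (indexB (inv G)) (proj₁ ∘ indexB-spec G keeps)
        (proj₁ ∘ indexB-spec (inv G) (keeps-inv {G} keeps)) (indexB-inv′ G keeps) (indexB-inv G keeps)

      flipped : ℕ → Bool
      -- The row of a kink in column `q` is `N ∸ 3 ∸ q`. The top edge of its cell stays or becomes
      -- the vertical out-edge, so the direction of its image is the bit.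
      flipped q = vertical (π G (H (suc (N ∸ 3 ∸ q)) q))

      zs : List Bool
      zs = gather kinkAt flipped (N ∸ 2)

      len : length zs ≡ kinks#
      len = gather-length kinkAt flipped (N ∸ 2)

      bits : ∀ {p q} → Kink p q → bit-at zs q ≡ vertical (π G (H (suc p) q))
      bits {p} {q} k = trans (gather-nth kinkAt flipped (N ∸ 2) (kink-< k) (kink-true k))
          (cong (λ x → vertical (π G (H (suc x) q))) (trans (cong (λ n → n ∸ 3 ∸ q) (sym (proj₁ k))) (ℕₚ.m+n∸n≡m p q)))

      at-σ₁ : ∀ {i} → i < k₁ → at σ₁ i ≡ indexA G i
      at-σ₁ = at-applyUpTo (indexA G) k₁

      at-σ₂ : ∀ {i} → i < k₂ → at σ₂ i ≡ indexB G i
      at-σ₂ = at-applyUpTo (indexB G) k₂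

    factors : ∀ e → Facet e → π G e ≡ π (inner perm₁ perm₂ zs) e
    factors e fe with classify e fe
    ... | clA h = trans (proj₂ (indexA-spec G keeps h)) (trans (cong cA (sym (at-σ₁ h))) (sym (inner-A perm₁ perm₂ zs h)))
    ... | clB h = trans (proj₂ (indexB-spec G keeps h)) (trans (cong cB (sym (at-σ₂ h))) (sym (inner-B perm₁ perm₂ zs h)))
    ... | cl0V = trans πV (sym (inner-V perm₁ perm₂ zs f00))
    ... | cl0H = trans πH (sym (inner-H perm₁ perm₂ zs g00))
    factors _ _ | clKH {p} {q} k with out-image (kink-cell k) (fixed-in p q (kink-cell k))
    ... | same a b = trans a (sym (subst (λ x → π (inner perm₁ perm₂ zs) (H (suc p) q) ≡ (if x then V p (suc q) else H (suc p) q))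
            (trans (bits k) (cong vertical a)) (inner-KH perm₁ perm₂ zs k)))
    ... | swap a b = trans a (sym (subst (λ x → π (inner perm₁ perm₂ zs) (H (suc p) q) ≡ (if x then V p (suc q) else H (suc p) q))
            (trans (bits k) (cong vertical a)) (inner-KH perm₁ perm₂ zs k)))
    factors _ _ | clKV {p} {q} k with out-image (kink-cell k) (fixed-in p q (kink-cell k))
    ... | same a b = trans b (sym (subst (λ x → π (inner perm₁ perm₂ zs) (V p (suc q)) ≡ (if x then H (suc p) q else V p (suc q)))
            (trans (bits k) (cong vertical a)) (inner-KV perm₁ perm₂ zs k)))
    ... | swap a b = trans b (sym (subst (λ x → π (inner perm₁ perm₂ zs) (V p (suc q)) ≡ (if x then H (suc p) q else V p (suc q)))
            (trans (bits k) (cong vertical a)) (inner-KV perm₁ perm₂ zs k)))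
    factors e fe | cl- a b c d n m = trans (fixes e fe a b n m) (sym (inner-off perm₁ perm₂ zs fe a b n m))
      where
      fixes : ∀ e → Facet e → (∀ i → i < k₁ → e ≢ cA i) → (∀ i → i < k₂ → e ≢ cB i) →
        (∀ {p q} → Kink p q → e ≢ H (suc p) q) → (∀ {p q} → Kink p q → e ≢ V p (suc q)) → π G e ≡ e
      fixes (V p zero) fe a b n m with cell? p 0
      ... | yes y = proj₁ (fixed-in p 0 y)
      ... | no ¬y with A-index (isA fe ¬y)
      ...   | inj₁ (i , h , eq) = ⊥-elim (a i h eq)
      ...   | inj₂ (_ , uniq) = uniq (proj₁ keeps (isA fe ¬y))
      fixes (H zero q) fe a b n m with cell? 0 q
      ... | yes y = proj₂ (fixed-in 0 q y)
      ... | no ¬y with B-index (isB fe ¬y)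
      ...   | inj₁ (i , h , eq) = ⊥-elim (b i h eq)
      ...   | inj₂ (_ , uniq) = uniq (proj₂ keeps (isB fe ¬y))
      fixes (V p (suc q)) fe a b n m with out-image {p} {q} fe (fixed-in p q fe)
      ... | same _ y = y
      ... | swap x y with swap-corner {p} {q} fe x y
      ...   | fr , ¬up , ¬right = ⊥-elim (m (swap-kink {p} {q} fe fr ¬up ¬right) refl)
      fixes (H (suc p) q) fe a b n m with out-image {p} {q} fe (fixed-in p q fe)
      ... | same x _ = x
      ... | swap x y with swap-corner {p} {q} fe x y
      ...   | fr , ¬up , ¬right = ⊥-elim (n (swap-kink {p} {q} fe fr ¬up ¬right) refl)

    factors-normal : ∀ z e → Facet e → π (toggle z) (π G e) ≡ π (normal perm₁ perm₂ zs z) e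
    factors-normal z e fe = trans (cong (π (toggle z)) (factors e fe)) (sym (normal-inner perm₁ perm₂ zs z e))

  -- Four cases, by the images of the in-edges and of the out-edges of the corner. An exchange of
  -- the out-edges proves the shape symmetric; composition with the reflection and the corner
  -- exchange then leads to `Factor`.
  surjective : ∀ G → Σ GElt λ g → Σ (Good g) λ ok → ∀ e → Facet e → π G e ≡ π (symOf g ok) e
  surjective G = go (corner G) top
    where
    K : Sym
    K = toggle true

    f10 : Facet (H 1 0)
    f10 = cell00

    f01 : Facet (V 0 1)
    f01 = cell00

    KV : π K (V 0 0) ≡ H 0 0
    KV = toggle-V true
    KH : π K (H 0 0) ≡ V 0 0
    KH = toggle-H true
    K10 : π K (H 1 0) ≡ H 1 0
    K10 = toggle-off true {H 1 0} f10 (λ ()) (λ ())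
    K01 : π K (V 0 1) ≡ V 0 1
    K01 = toggle-off true {V 0 1} f01 (λ ()) (λ ())
    KK : ∀ {e} → Facet e → π K (π K e) ≡ e
    KK = toggle-toggle

    corner-In : In 0 0 (π G (V 0 0)) (π G (H 0 0))
    corner-In with corner G
    ... | inj₁ (a , b) = subst₂ (In 0 0) (sym a) (sym b) vh
    ... | inj₂ (a , b) = subst₂ (In 0 0) (sym a) (sym b) hv

    out-of : ∀ {e f g} → In 0 0 e f → Quad e f g → g ≡ H 1 0 ⊎ g ≡ V 0 1
    out-of vh (inQ _ vh hv) = inj₁ refl
    out-of vh (inQ _ vh vh) = inj₂ refl
    out-of hv (inQ _ hv hv) = inj₁ refl
    out-of hv (inQ _ hv vh) = inj₂ refl
    out-of vh (outQ _ () _)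
    out-of hv (outQ _ () _)

    quad₀ : ∀ {g h} → Out 0 0 g h → Quad (π G (V 0 0)) (π G (H 0 0)) (π G g)
    quad₀ o = in-quad G cell00 vh o

    Outs : Set
    Outs = (π G (H 1 0) ≡ H 1 0 × π G (V 0 1) ≡ V 0 1) ⊎ (π G (H 1 0) ≡ V 0 1 × π G (V 0 1) ≡ H 1 0)

    top : Outs
    top with out-of corner-In (quad₀ hv) | out-of corner-In (quad₀ vh)
    ... | inj₁ a | inj₂ b = inj₁ (a , b)
    ... | inj₂ a | inj₁ b = inj₂ (a , b)
    ... | inj₁ a | inj₁ b with π-inj G {H 1 0} {V 0 1} f10 f01 (trans a (sym b))
    ...   | ()
    top | inj₂ a | inj₂ b with π-inj G {H 1 0} {V 0 1} f10 f01 (trans a (sym b))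
    ...   | ()

    go : (π G (V 0 0) ≡ V 0 0 × π G (H 0 0) ≡ H 0 0) ⊎ (π G (V 0 0) ≡ H 0 0 × π G (H 0 0) ≡ V 0 0) → Outs →
      Σ GElt λ g → Σ (Good g) λ ok → ∀ e → Facet e → π G e ≡ π (symOf g ok) e
    go (inj₁ (a , b)) (inj₁ (c , _)) = gelt F.σ₁ F.σ₂ F.zs false false , good F.perm₁ F.perm₂ F.len (λ ()) ,
        λ e fe → trans (sym (toggle-false _)) (F.factors-normal false e fe)
      where module F = Factor G a b c
    go (inj₂ (a , b)) (inj₁ (c , _)) = gelt F.σ₁ F.σ₂ F.zs true false , good F.perm₁ F.perm₂ F.len (λ ()) ,
        λ e fe → trans (sym (KK (π-F G fe))) (F.factors-normal true e fe)
      where module F = Factor (K ⊙ G) (trans (cong (π K) a) KH) (trans (cong (π K) b) KV) (trans (cong (π K) c) K10)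
    -- The reflection itself exchanges the in-edges of the corner, so no separate exchange is
    -- recorded here, but one is in the next case.
    go (inj₂ (a , b)) (inj₂ (c , d)) = gelt F.σ₁ F.σ₂ F.zs false true , good F.perm₁ F.perm₂ F.len (λ _ → pal) ,
        λ e fe → trans (cong (π G) (sym (tr-tr e))) (trans (sym (toggle-false _)) (F.factors-normal false (tr e) (Reflect.tr-facet pal fe)))
      where
      pal : Pal
      pal = step-pal (Reflected.free-tr G a b c)
      module F = Factor (G ⊙ Reflect.reflectSym pal) b a d
    go (inj₁ (a , b)) (inj₂ (c , d)) = gelt F.σ₁ F.σ₂ F.zs true true , good F.perm₁ F.perm₂ F.len (λ _ → pal) ,
        λ e fe → trans (cong (π G) (sym (tr-tr e))) (trans (sym (KK (π-F G (Reflect.tr-facet pal (Reflect.tr-facet pal fe)))))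
          (F.factors-normal true (tr e) (Reflect.tr-facet pal fe)))
      where
      pal : Pal
      pal = step-pal (Reflected.free-tr (K ⊙ G) (trans (cong (π K) a) KV) (trans (cong (π K) b) KH) (trans (cong (π K) c) K01))
      module F = Factor (K ⊙ G ⊙ Reflect.reflectSym pal) (trans (cong (π K) b) KH) (trans (cong (π K) a) KV) (trans (cong (π K) d) K10)

-- The partition

open import Defs hiding (to; from)

at-++ʳ : ∀ xs ys i → at (xs ++ ys) (length xs + i) ≡ at ys i
at-++ʳ []       ys i = refl
at-++ʳ (x ∷ xs) ys i = at-++ʳ xs ys i

at-++ˡ : ∀ xs ys {i} → i < length xs → at (xs ++ ys) i ≡ at xs i
at-++ˡ (x ∷ xs) ys {zero}  _       = refl
at-++ˡ (x ∷ xs) ys {suc i} (s≤s h) = at-++ˡ xs ys h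

at-replicate : ∀ a k {i} → i < a → at (replicate a k) i ≡ k
at-replicate (suc a) k {zero}  _       = refl
at-replicate (suc a) k {suc i} (s≤s h) = at-replicate a k h

at-reverse : ∀ xs {i j} → suc (i + j) ≡ length xs → at (reverse xs) i ≡ at xs j
at-reverse (x ∷ xs) {i} {j} h rewrite Listₚ.unfold-reverse x xs with j
... | zero = trans (cong (at (reverse xs ++ x ∷ [])) (trans (sym (ℕₚ.+-identityʳ i)) (trans (ℕₚ.suc-injective h)
                 (trans (sym (Listₚ.length-reverse xs)) (sym (ℕₚ.+-identityʳ _)))))) (at-++ʳ (reverse xs) (x ∷ []) 0)
... | suc j′ = trans (at-++ˡ (reverse xs) _ (ℕₚ.≤-trans (ℕₚ.≤-trans (s≤s (ℕₚ.m≤m+n i j′)) (ℕₚ.≤-reflexive e))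
                 (ℕₚ.≤-reflexive (sym (Listₚ.length-reverse xs))))) (at-reverse xs e)
  where e : suc (i + j′) ≡ length xs
        e = trans (sym (ℕₚ.+-suc i j′)) (ℕₚ.suc-injective h)

Positive : List ℕ → Set
Positive = All (1 ≤_)

-- The list continues a sequence whose last value was `k`, in steps of 0 or 1.
data Stair : ℕ → List ℕ → Set where
  end  : ∀ {k} → Stair k []
  same : ∀ {k xs} → Stair k xs → Stair k (k ∷ xs)
  next : ∀ {k xs} → Stair (suc k) xs → Stair k (suc k ∷ xs)

stair-replicate : ∀ {k xs} a → Stair k xs → Stair k (replicate a k ++ xs)
stair-replicate zero    s = s
stair-replicate (suc a) s = same (stair-replicate a s)

lam-stair : ∀ k as → Positive as → Stair k (lamFrom (suc k) as)
lam-stair k []           _         = end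
lam-stair k (suc a ∷ as) (_ ∷ pos) = next (stair-replicate a (lam-stair (suc k) as pos))

stair-step : ∀ {k xs} → Stair k xs → ∀ i → i < length xs → at (k ∷ xs) i ≤ at xs i × at xs i ≤ suc (at (k ∷ xs) i)
stair-step (same s) zero    _       = ℕₚ.≤-refl , ℕₚ.n≤1+n _
stair-step (next s) zero    _       = ℕₚ.n≤1+n _ , ℕₚ.≤-refl
stair-step (same s) (suc i) (s≤s h) = stair-step s i h
stair-step (next s) (suc i) (s≤s h) = stair-step s i h

lam-step : ∀ as → Positive as → ∀ i → suc i < length (lam as) → at (lam as) i ≤ at (lam as) (suc i) × at (lam as) (suc i) ≤ suc (at (lam as) i)
lam-step as pos i h = stair-step (lam-stair 0 as pos) (suc i) h

lam-last : ∀ k as → Positive as → 1 ≤ length as → at (lamFrom k as) (length (lamFrom k as) ∸ 1) ≡ k + length as ∸ 1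
lam-last k (suc a ∷ []) (_ ∷ _) _ = trans (cong (at (replicate (suc a) k ++ [])) (trans (cong (_∸ 1) len) refl))
    (trans (at-++ˡ (replicate (suc a) k) [] (subst (a <_) (sym (Listₚ.length-replicate (suc a))) ℕₚ.≤-refl))
      (trans (at-replicate (suc a) k ℕₚ.≤-refl) (sym (ℕₚ.m+n∸n≡m k 1))))
  where len : length (replicate (suc a) k ++ []) ≡ suc a
        len = trans (cong length (Listₚ.++-identityʳ (replicate (suc a) k))) (Listₚ.length-replicate (suc a))
lam-last k (suc a ∷ suc b ∷ as) (_ ∷ pos) _ = trans (cong (at (replicate (suc a) k ++ L)) len)
    (trans (at-++ʳ (replicate (suc a) k) L (length L ∸ 1)) (trans (lam-last (suc k) (suc b ∷ as) pos (s≤s z≤n))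
      (cong (_∸ 1) (sym (ℕₚ.+-suc k (suc (length as)))))))
  where L = lamFrom (suc k) (suc b ∷ as)
        len : length (replicate (suc a) k ++ L) ∸ 1 ≡ length (replicate (suc a) k) + (length L ∸ 1)
        len = trans (cong (_∸ 1) (Listₚ.length-++ (replicate (suc a) k))) (trans (cong (_∸ 1) (ℕₚ.+-suc (length (replicate (suc a) k)) _)) refl)

lam-last k (suc a ∷ zero ∷ as) (_ ∷ () ∷ _) _

lamFrom-++ : ∀ k as bs → lamFrom k (as ++ bs) ≡ lamFrom k as ++ lamFrom (length as + k) bs
lamFrom-++ k []       bs = refl
lamFrom-++ k (a ∷ as) bs = trans (cong (replicate a k ++_) (trans (lamFrom-++ (suc k) as bs)
  (cong (λ n → lamFrom (suc k) as ++ lamFrom n bs) (ℕₚ.+-suc (length as) k)))) (sym (Listₚ.++-assoc (replicate a k) _ _))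

reverse-replicate : ∀ a (k : ℕ) → reverse (replicate a k) ≡ replicate a k
reverse-replicate zero    k = refl
reverse-replicate (suc a) k = trans (Listₚ.unfold-reverse k (replicate a k)) (trans (cong (_++ k ∷ []) (reverse-replicate a k)) (snoc a))
  where snoc : ∀ a → replicate a k ++ k ∷ [] ≡ k ∷ replicate a k
        snoc zero    = refl
        snoc (suc a) = cong (k ∷_) (snoc a)

-- For `k` equal to 0: reversing the multiplicities reverses λ and complements its parts in m + 1.
-- The offset lets the bound of the complement stay constant while the list is consumed.
lam-reverse : ∀ k as → lam (reverse as) ≡ map (λ v → suc (k + length as) ∸ v) (reverse (lamFrom (suc k) as))
lam-reverse k []       = refl
lam-reverse k (a ∷ as) = begin
  lam (reverse (a ∷ as))                                             ≡⟨ cong lam (Listₚ.unfold-reverse a as) ⟩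
  lam (reverse as ++ a ∷ [])                                         ≡⟨ lamFrom-++ 1 (reverse as) (a ∷ []) ⟩
  lam (reverse as) ++ (replicate a (length (reverse as) + 1) ++ [])  ≡⟨ cong₂ _++_ (lam-reverse (suc k) as) (Listₚ.++-identityʳ _) ⟩
  map f′ (reverse L) ++ replicate a (length (reverse as) + 1)        ≡⟨ cong₂ _++_ (Listₚ.map-cong (λ v → cong (λ n → suc n ∸ v) (sym (ℕₚ.+-suc k (length as)))) (reverse L)) (cong (replicate a) val) ⟩
  map f (reverse L) ++ replicate a (f (suc k))                       ≡⟨ cong (map f (reverse L) ++_) (sym (Listₚ.map-replicate f a (suc k))) ⟩
  map f (reverse L) ++ map f (replicate a (suc k))                   ≡⟨ sym (Listₚ.map-++ f (reverse L) (replicate a (suc k))) ⟩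
  map f (reverse L ++ replicate a (suc k))                           ≡⟨ cong (λ xs → map f (reverse L ++ xs)) (sym (reverse-replicate a (suc k))) ⟩
  map f (reverse L ++ reverse (replicate a (suc k)))                 ≡⟨ cong (map f) (sym (Listₚ.reverse-++ (replicate a (suc k)) L)) ⟩
  map f (reverse (replicate a (suc k) ++ L))                         ∎
  where
  open ≡-Reasoning
  L = lamFrom (suc (suc k)) as
  f f′ : ℕ → ℕ
  f v = suc (k + length (a ∷ as)) ∸ v
  f′ v = suc (suc k + length as) ∸ v
  val : length (reverse as) + 1 ≡ f (suc k)
  val = trans (cong (_+ 1) (Listₚ.length-reverse as)) (trans (ℕₚ.+-comm _ 1) (sym (ℕₚ.m+n∸m≡n k (suc (length as)))))

private
  strip : ∀ {k X Y} a b → Stair k X → Stair k Y → (∀ {Z} → X ≢ k ∷ Z) → (∀ {Z} → Y ≢ k ∷ Z) →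
    replicate a k ++ X ≡ replicate b k ++ Y → a ≡ b × X ≡ Y
  strip zero    zero    _ _ _ _ e = refl , e
  strip zero    (suc b) _ _ n _ e = ⊥-elim (n e)
  strip (suc a) zero    _ _ _ m e = ⊥-elim (m (sym e))
  strip (suc a) (suc b) s t n m e with strip a b s t n m (Listₚ.∷-injectiveʳ e)
  ... | refl , h = refl , h

  no-head : ∀ k as → Positive as → ∀ {Z} → lamFrom (suc k) as ≢ k ∷ Z
  no-head k []           _ ()
  no-head k (zero ∷ as) (() ∷ _)
  no-head k (suc a ∷ as) _ e = ℕₚ.1+n≢n (Listₚ.∷-injectiveˡ e)

lamFrom-injective : ∀ k as bs → Positive as → Positive bs → lamFrom k as ≡ lamFrom k bs → as ≡ bs
lamFrom-injective k []           []           _        _        e = refl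
lamFrom-injective k []           (zero ∷ bs)  _        (() ∷ _) _
lamFrom-injective k (zero ∷ as)  _            (() ∷ _) _        _
lamFrom-injective k (suc a ∷ as) (zero ∷ bs)  _        (() ∷ _) _
lamFrom-injective k (suc a ∷ as) (suc b ∷ bs) (_ ∷ ps) (_ ∷ qs) e
  with strip a b (lam-stair k as ps) (lam-stair k bs qs) (no-head k as ps) (no-head k bs qs) (Listₚ.∷-injectiveʳ e)
... | refl , h = cong (suc a ∷_) (lamFrom-injective (suc k) as bs ps qs h)

module _ (as : List ℕ) (3≤m : 3 ≤ length as) (pos : Positive as) where

  private
    L = lam as
    N = nOf as ∸ 1

    lam≥ : ∀ k as → Positive as → length as ≤ length (lamFrom k as)
    lam≥ k [] _ = z≤n
    lam≥ k (suc a ∷ as) (_ ∷ ps) = s≤s (ℕₚ.≤-trans (lam≥ (suc k) as ps)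
      (ℕₚ.≤-trans (ℕₚ.m≤n+m _ (length (replicate a k))) (ℕₚ.≤-reflexive (sym (Listₚ.length-++ (replicate a k))))))

  nOf-suc : nOf as ≡ suc N
  nOf-suc = sym (ℕₚ.m+[n∸m]≡n (ℕₚ.≤-trans (s≤s z≤n) (ℕₚ.≤-trans 3≤m (lam≥ 1 as pos))))

  private
    f : ℕ → ℕ
    -- Truncated at the last index, because `at` returns 0 beyond the list, which would break
    -- monotonicity.
    f q = at L (q ℕ.⊓ N)

    f-in : ∀ {q} → q ≤ N → f q ≡ at L q
    f-in h = cong (at L) (ℕₚ.m≤n⇒m⊓n≡m h)

    f-out : ∀ {q} → N ≤ q → f q ≡ at L N
    f-out h = cong (at L) (ℕₚ.m≥n⇒m⊓n≡n h)

    f-step : ∀ a → f a ≤ f (suc a) × f (suc a) ≤ suc (f a)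
    f-step a with a ℕₚ.<? N
    ... | yes h rewrite f-in h | f-in (ℕₚ.<⇒≤ h) = lam-step as pos a (subst (suc a <_) (sym nOf-suc) (s≤s h))
    ... | no n rewrite f-out (ℕₚ.≮⇒≥ n) | f-out (ℕₚ.m≤n⇒m≤1+n (ℕₚ.≮⇒≥ n)) = ℕₚ.≤-refl , ℕₚ.n≤1+n _

    f-mono : ∀ {a b} → a ≤ b → f a ≤ f b
    f-mono {a} h = go (ℕₚ.≤⇒≤′ h)
      where
      go : ∀ {b} → a ℕ.≤′ b → f a ≤ f b
      go ℕ.≤′-refl = ℕₚ.≤-refl
      go (ℕ.≤′-step {b} h) = ℕₚ.≤-trans (go h) (proj₁ (f-step b))

  first-value : at L 0 ≡ 1
  first-value = go as 3≤m pos
    where go : ∀ as → 3 ≤ length as → Positive as → at (lam as) 0 ≡ 1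
          go (zero ∷ as) _ (() ∷ _)
          go (suc a ∷ as) _ _ = refl

  last-value : at L N ≡ length as
  last-value = lam-last 1 as pos (ℕₚ.≤-trans (s≤s z≤n) 3≤m)

  shape : Shape
  shape = record
    { N = N ; lo = f ; lo-mono = f-mono ; lo-step = λ a → proj₂ (f-step a)
    ; lo-top = λ h → trans (f-out h) (sym (f-in ℕₚ.≤-refl))
    ; hi = λ p → f (N ∸ p) ; hi-def = λ _ → refl
    ; wide = subst₂ _≤_ (cong (2 +_) (sym (trans (f-in {0} z≤n) first-value))) (sym (trans (f-in ℕₚ.≤-refl) last-value)) 3≤m }

  lo-at : ∀ {q} → q ≤ N → Shape.lo shape q ≡ at L q
  lo-at = f-in

  open Shape shape using (lo; hi)

  private
    -- The second block occupies the indices from 1 to `k`, and `hi p` is the entry at `N ∸ p`, so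
    -- `hi p ≤ lo 1` means that `N ∸ p` is at most `k`. The bound `above` comes from the third
    -- block.
    EndA-2 : ∀ k l → lo 1 ≡ suc (lo 0) → k < N → (∀ j → 1 ≤ j → j ≤ k → at L j ≤ lo 1) → lo 1 < at L (suc k) → l ≡ k →
      Action.EndA shape l
    EndA-2 k _ e k<N below above refl = inj₂ (e , k<N , λ p p<N → (λ h → ℕₚ.m≤n+o⇒m∸n≤o N k (upto p p<N h)) , down p p<N)
      where
      down : ∀ p → p < N → N ∸ k ≤ p → hi p ≤ lo 1
      down p p<N h = ℕₚ.≤-trans (ℕₚ.≤-reflexive (f-in (ℕₚ.m∸n≤m N p))) (below (N ∸ p) (ℕₚ.m<n⇒0<n∸m p<N)
        (ℕₚ.m≤n+o⇒m∸n≤o N p (ℕₚ.≤-trans (ℕₚ.m≤n+m∸n N k) (ℕₚ.≤-trans (ℕₚ.+-monoʳ-≤ k h) (ℕₚ.≤-reflexive (ℕₚ.+-comm k p))))))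
      upto : ∀ p → p < N → hi p ≤ lo 1 → N ≤ k + p
      upto p p<N h = ℕₚ.≮⇒≥ λ lt → ℕₚ.<⇒≱ above (ℕₚ.≤-trans (ℕₚ.≤-reflexive (sym (f-in k<N)))
        (ℕₚ.≤-trans (f-mono (ℕₚ.m+n≤o⇒m≤o∸n (suc k) lt)) h))

  endA : Action.EndA shape (k₁ as)
  endA = go as refl 3≤m pos
    where
    go : ∀ bs → as ≡ bs → 3 ≤ length bs → Positive bs → Action.EndA shape (k₁ as)
    go (_ ∷ []) _ (s≤s ()) _
    go (_ ∷ _ ∷ []) _ (s≤s (s≤s ())) _
    go (zero ∷ _) _ _ (() ∷ _)
    go (suc zero ∷ zero ∷ _) _ _ (_ ∷ () ∷ _)
    go (suc zero ∷ suc _ ∷ zero ∷ _) _ _ (_ ∷ _ ∷ () ∷ _)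
    go (suc (suc x) ∷ y ∷ z ∷ r) refl _ _ = inj₁ (trans (f-in 1≤N) (sym (f-in {0} z≤n)) , refl)
      where 1≤N : 1 ≤ N
            1≤N = s≤s z≤n
    go (suc zero ∷ suc y ∷ suc z ∷ r) refl _ _ = EndA-2 (suc y) (k₁ as) (trans (f-in 1≤N) (cong suc (sym (f-in {0} z≤n))))
        (subst (suc y <_) (sym len) (ℕₚ.m<m+n (suc y) (s≤s z≤n)))
        (λ { (suc j) _ (s≤s j≤y) → ℕₚ.≤-reflexive (trans (trans (at-++ˡ (replicate (suc y) 2) R (subst (j <_) (sym (Listₚ.length-replicate (suc y))) (s≤s j≤y)))
              (at-replicate (suc y) 2 (s≤s j≤y))) (sym (f-in 1≤N))) })
        (subst₂ _<_ (sym (f-in 1≤N)) (sym three) ℕₚ.≤-refl) (ℕₚ.+-identityʳ (suc y))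
      where
      R = lamFrom 3 (suc z ∷ r)
      1≤N : 1 ≤ N
      1≤N = s≤s z≤n
      len : N ≡ suc y + length R
      len = trans (Listₚ.length-++ (replicate (suc y) 2)) (cong (_+ length R) (Listₚ.length-replicate (suc y)))
      three : at L (2 + y) ≡ 3
      three = trans (cong (at (replicate (suc y) 2 ++ R)) (trans (sym (ℕₚ.+-identityʳ (suc y))) (cong (_+ 0) (sym (Listₚ.length-replicate (suc y))))))
        (at-++ʳ (replicate (suc y) 2) R 0)

-- Counting the kinks

Window : ℕ → ℕ → ℕ → ℕ → Set
Window a b c d = a ≡ b × b < c × c ≡ d

window? : ∀ a b c d → Dec (Window a b c d)
window? a b c d = (a ℕ.≟ b) ×-dec ((b ℕₚ.<? c) ×-dec (c ℕ.≟ d))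

windows : List ℕ → ℕ → Bool
windows xs i = does (window? (at xs i) (at xs (1 + i)) (at xs (2 + i)) (at xs (3 + i)))

#windows : List ℕ → ℕ
#windows xs = count (windows xs) (length xs ∸ 3)

#windows-∷ : ∀ a b c d xs → #windows (a ∷ b ∷ c ∷ d ∷ xs) ≡ (if does (window? a b c d) then 1 else 0) + #windows (b ∷ c ∷ d ∷ xs)
#windows-∷ a b c d xs = count-+ (windows (a ∷ b ∷ c ∷ d ∷ xs)) 1 (length xs)

private
  skip : ∀ {a b c d} xs → ¬ Window a b c d → #windows (a ∷ b ∷ c ∷ d ∷ xs) ≡ #windows (b ∷ c ∷ d ∷ xs)
  skip {a} {b} {c} {d} xs n = trans (#windows-∷ a b c d xs)
    (cong (λ w → (if w then 1 else 0) + #windows (b ∷ c ∷ d ∷ xs)) (dec-false (window? a b c d) n))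

  hit : ∀ {a b c d} xs → Window a b c d → #windows (a ∷ b ∷ c ∷ d ∷ xs) ≡ suc (#windows (b ∷ c ∷ d ∷ xs))
  hit {a} {b} {c} {d} xs y = trans (#windows-∷ a b c d xs)
    (cong (λ w → (if w then 1 else 0) + #windows (b ∷ c ∷ d ∷ xs)) (dec-true (window? a b c d) y))

  drop-one : ∀ k xs → #windows (k ∷ suc k ∷ xs) ≡ #windows (suc k ∷ xs)
  drop-one k []           = refl
  drop-one k (x ∷ [])     = refl
  drop-one k (x ∷ y ∷ xs) = skip xs λ w → ℕₚ.1+n≢n (sym (proj₁ w))

  drop-three : ∀ k xs → #windows (k ∷ k ∷ k ∷ xs) ≡ #windows (k ∷ k ∷ xs)
  drop-three k []       = refl
  drop-three k (x ∷ xs) = skip xs λ w → ℕₚ.<-irrefl refl (proj₁ (proj₂ w))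

  shorten : ∀ x k xs → #windows (replicate (2 + x) k ++ xs) ≡ #windows (k ∷ k ∷ xs)
  shorten zero    k xs = refl
  shorten (suc x) k xs = trans (drop-three k (replicate x k ++ xs)) (shorten x k xs)

-- A window is the border of two blocks of length at least 2. No window starts in a block of length
-- 1 or before the last two entries of a longer block, so long blocks may be shortened to two
-- entries.
#windows-lam : ∀ k as → Positive as → #windows (lamFrom k as) ≡ r₁ as
#windows-lam k [] _ = refl
#windows-lam k (zero ∷ []) (() ∷ _)
#windows-lam k (suc zero ∷ []) _ = refl
#windows-lam k (suc (suc x) ∷ []) _ = shorten x k []
#windows-lam k (zero ∷ _ ∷ as) (() ∷ _)
#windows-lam k (suc x ∷ zero ∷ as) (_ ∷ () ∷ _)
#windows-lam k (suc zero ∷ suc y ∷ as) (_ ∷ pos) =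
  trans (drop-one k (replicate y (suc k) ++ lamFrom (2 + k) as)) (#windows-lam (suc k) (suc y ∷ as) pos)
#windows-lam k (suc (suc x) ∷ suc (suc y) ∷ as) (_ ∷ pos) =
  trans (shorten x k (lamFrom (suc k) (suc (suc y) ∷ as))) (trans (hit (replicate y (suc k) ++ lamFrom (2 + k) as) (refl , ℕₚ.≤-refl , refl))
    (cong suc (trans (drop-one k (replicate (suc y) (suc k) ++ lamFrom (2 + k) as)) (#windows-lam (suc k) (suc (suc y) ∷ as) pos))))
#windows-lam k (suc (suc x) ∷ suc zero ∷ []) (_ ∷ pos) = shorten x k (suc k ∷ [])
#windows-lam k (suc (suc x) ∷ suc zero ∷ zero ∷ as) (_ ∷ _ ∷ () ∷ _)
#windows-lam k (suc (suc x) ∷ suc zero ∷ suc z ∷ as) (_ ∷ pos) =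
  trans (shorten x k (lamFrom (suc k) (1 ∷ suc z ∷ as))) (trans (skip (replicate z (2 + k) ++ lamFrom (3 + k) as) (λ w → ℕₚ.1+n≢n (sym (proj₂ (proj₂ w)))))
    (trans (drop-one k (replicate (suc z) (2 + k) ++ lamFrom (3 + k) as)) (#windows-lam (suc k) (1 ∷ suc z ∷ as) pos)))

k₂-reverse : ∀ as → 3 ≤ length as → k₂ as ≡ k₁ (reverse as)
k₂-reverse as h = cong₂ (λ x y → δ 1 x * y)
  (sym (at-reverse as (ℕₚ.m+[n∸m]≡n {1} (ℕₚ.≤-trans (s≤s z≤n) h))))
  (sym (at-reverse as (ℕₚ.m+[n∸m]≡n {2} (ℕₚ.≤-trans (s≤s (s≤s z≤n)) h))))

-- Duality under reversal of the multiplicities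

module Reversal (as : List ℕ) (3≤m : 3 ≤ length as) (pos : Positive as) where

  private
    sa = reverse as

    3≤m′ : 3 ≤ length sa
    3≤m′ = subst (3 ≤_) (sym (Listₚ.length-reverse as)) 3≤m

    pos′ : Positive sa
    pos′ = All-resp-↭ (↭-sym (↭-reverse as)) pos

    S = shape as 3≤m pos
    S′ = shape sa 3≤m′ pos′
    m = length as
    module S = Shape S
    module S′ = Shape S′
    open S using (N; lo; hi)

  nOf-reverse : nOf sa ≡ nOf as
  nOf-reverse = trans (cong length (lam-reverse 0 as)) (trans (Listₚ.length-map _ (reverse (lam as))) (Listₚ.length-reverse (lam as)))

  private
    N≡ : S′.N ≡ N
    N≡ = cong (_∸ 1) nOf-reverse

    len : length (lam as) ≡ suc N
    len = nOf-suc as 3≤m pos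

    complement : ∀ i → i ≤ N → at (lam sa) i + at (lam as) (N ∸ i) ≡ suc m
    complement i i≤N = trans (cong (_+ at (lam as) (N ∸ i)) val) (ℕₚ.m∸n+n≡m (ℕₚ.m≤n⇒m≤1+n bound))
      where
      val : at (lam sa) i ≡ suc m ∸ at (lam as) (N ∸ i)
      val = trans (cong (λ xs → at xs i) (lam-reverse 0 as))
        (trans (at-map (λ v → suc m ∸ v) (reverse (lam as)) (subst (i <_) (sym (trans (Listₚ.length-reverse (lam as)) len)) (s≤s i≤N)))
          (cong (suc m ∸_) (at-reverse (lam as) (trans (cong suc (ℕₚ.m+[n∸m]≡n i≤N)) (sym len)))))
      bound : at (lam as) (N ∸ i) ≤ m
      bound = subst₂ _≤_ (lo-at as 3≤m pos (ℕₚ.m∸n≤m N i)) (trans (lo-at as 3≤m pos ℕₚ.≤-refl) (last-value as 3≤m pos)) (S.lo-mono (ℕₚ.m∸n≤m N i))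

    dual-in : ∀ q → q ≤ N → S′.lo q + hi q ≡ suc m
    dual-in q h = trans (cong₂ _+_ (lo-at sa 3≤m′ pos′ (subst (q ≤_) (sym N≡) h)) (lo-at as 3≤m pos (ℕₚ.m∸n≤m N q))) (complement q h)

  -- Reversal mirrors the indices and complements the parts, so the lower bounds of one shape are
  -- the complements of the upper bounds of the other.
  dual-lo : ∀ q → S′.lo q + hi q ≡ suc m
  dual-lo q with q ℕₚ.≤? N
  ... | yes h = dual-in q h
  ... | no n = trans (cong₂ _+_ (trans (S′.lo-top (subst (_≤ q) (sym N≡) N≤q)) (cong S′.lo N≡))
                  (cong lo (trans (ℕₚ.m≤n⇒m∸n≡0 N≤q) (sym (ℕₚ.n∸n≡0 N))))) (dual-in N ℕₚ.≤-refl)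
    where N≤q = ℕₚ.<⇒≤ (ℕₚ.≰⇒> n)

  dual-hi : ∀ q → S′.hi q + lo q ≡ suc m
  dual-hi q with q ℕₚ.≤? N
  ... | yes h = trans (cong₂ _+_ (cong (λ n → S′.lo (n ∸ q)) N≡) (cong lo (sym (ℕₚ.m∸[m∸n]≡n h)))) (dual-in (N ∸ q) (ℕₚ.m∸n≤m N q))
  ... | no n = trans (cong₂ _+_ (cong S′.lo (ℕₚ.m≤n⇒m∸n≡0 (subst (_≤ q) (sym N≡) N≤q))) (S.lo-top N≤q)) (dual-in 0 z≤n)
    where N≤q = ℕₚ.<⇒≤ (ℕₚ.≰⇒> n)

  private
    anti : ∀ {a b c d} → a + b ≡ c + d → a ≤ c → d ≤ b
    anti e h = ℕₚ.≮⇒≥ λ b<d → ℕₚ.<-irrefl e (ℕₚ.+-mono-≤-< h b<d)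

    anti′ : ∀ {a b c d} → a + b ≡ c + d → d ≤ b → a ≤ c
    anti′ {a} {b} {c} {d} e h = anti (trans (ℕₚ.+-comm d c) (trans (sym e) (ℕₚ.+-comm a b))) h

  -- The end B is the end A of the reversed list, with all inequalities turned around by the
  -- duality.
  endB : Action.EndB S (k₂ as)
  endB = subst (Action.EndB S) (sym (k₂-reverse as 3≤m)) (go (endA sa 3≤m′ pos′))
    where
    go : Action.EndA S′ (k₁ sa) → Action.EndB S (k₁ sa)
    go (inj₁ (e , k≡0)) = inj₁ (ℕₚ.+-cancelˡ-≡ (S′.lo 0) _ _ (trans (dual-lo 0) (trans (sym (dual-lo 1)) (cong (_+ hi 1) e))) , k≡0)
    go (inj₂ (e , k<N , h)) = inj₂
      ( ℕₚ.+-cancelˡ-≡ (S′.lo 0) _ _ (trans (dual-lo 0) (trans (sym (dual-lo 1)) (trans (cong (_+ hi 1) e) (sym (ℕₚ.+-suc (S′.lo 0) (hi 1))))))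
      , subst (k₁ sa <_) N≡ k<N
      , λ q q<N → let H = h q (subst (q <_) (sym N≡) q<N)
                      e = trans (dual-hi q) (sym (dual-lo 1)) in
          (λ le → subst (λ n → n ∸ k₁ sa ≤ q) N≡ (proj₁ H (anti′ e le))) ,
          (λ le → anti e (proj₂ H (subst (λ n → n ∸ k₁ sa ≤ q) (sym N≡) le))))

  palindrome⇒pal : as ≡ reverse as → Action.Pal S
  palindrome⇒pal e p = trans (all p) (sym (all 0))
    where
    all : ∀ p → lo p + hi p ≡ suc m
    all p = trans (cong (λ xs → at (lam xs) (p ℕ.⊓ (nOf xs ∸ 1)) + hi p) e) (dual-lo p)

  -- Symmetric bounds give λ the same entries as the partition of the reversed list, and a partition
  -- determines its multiplicities.
  pal⇒palindrome : Action.Pal S → as ≡ reverse as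
  pal⇒palindrome pal = lamFrom-injective 1 as sa pos pos′ (at-ext (lam as) (lam sa) (sym nOf-reverse) λ i h →
      let i≤N = ℕₚ.≤-pred (ℕₚ.≤-trans h (ℕₚ.≤-reflexive len)) in
      trans (sym (lo-at as 3≤m pos i≤N)) (trans (lo≡ i) (lo-at sa 3≤m′ pos′ (subst (i ≤_) (sym N≡) i≤N))))
    where
    sum : lo 0 + hi 0 ≡ suc m
    sum = cong₂ _+_ (trans (lo-at as 3≤m pos z≤n) (first-value as 3≤m pos)) (trans (lo-at as 3≤m pos ℕₚ.≤-refl) (last-value as 3≤m pos))
    lo≡ : ∀ q → lo q ≡ S′.lo q
    lo≡ q = ℕₚ.+-cancelʳ-≡ (hi q) (lo q) (S′.lo q) (trans (pal q) (trans sum (sym (dual-lo q))))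

  pal⇒k : Action.Pal S → k₁ as ≡ k₂ as
  pal⇒k pal = trans (cong k₁ (pal⇒palindrome pal)) (sym (k₂-reverse as 3≤m))

  open Action.Ends S (k₁ as) (k₂ as) (endA as 3≤m pos) endB using (kinkAt; kinks#; kink-true; true-kink)
  open Generators S using (Kink)

  private
    N∸2 : length (lam as) ∸ 3 ≡ N ∸ 2
    N∸2 = sym (ℕₚ.∸-+-assoc (length (lam as)) 1 2)

    kinkAt-window : ∀ q → q < N ∸ 2 → kinkAt q ≡ windows (lam as) q
    kinkAt-window q q< = bool-ext
      (λ h → dec-true (window? (a 0) (a 1) (a 2) (a 3)) (to (proj₂ (true-kink h))))
      (λ h → kink-true {N ∸ 3 ∸ q} (sum , from (does-true (window? (a 0) (a 1) (a 2) (a 3)) h)))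
      where
      a : ℕ → ℕ
      a i = at (lam as) (i + q)
      3+q≤N : 3 + q ≤ N
      3+q≤N = ℕₚ.≤-trans (ℕₚ.+-monoʳ-≤ 2 q<) (ℕₚ.≤-reflexive (ℕₚ.m+[n∸m]≡n {2} (2≤ N q<)))
        where 2≤ : ∀ n {q} → q < n ∸ 2 → 2 ≤ n
              2≤ (suc (suc n)) _ = s≤s (s≤s z≤n)
      sum : 3 + ((N ∸ 3 ∸ q) + q) ≡ N
      sum = trans (cong (3 +_) (ℕₚ.m∸n+n≡m (ℕₚ.m+n≤o⇒m≤o∸n q (subst (_≤ N) (ℕₚ.+-comm 3 q) 3+q≤N))))
        (ℕₚ.m+[n∸m]≡n (ℕₚ.≤-trans (ℕₚ.m≤m+n 3 q) 3+q≤N))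
      lo≡ : ∀ i → i ≤ 3 → lo (i + q) ≡ a i
      lo≡ i h = lo-at as 3≤m pos (ℕₚ.≤-trans (ℕₚ.+-monoˡ-≤ q h) 3+q≤N)
      does-true : ∀ {P : Set} (d : Dec P) → does d ≡ true → P
      does-true (yes p) _ = p
      l0 = lo≡ 0 z≤n
      l1 = lo≡ 1 (s≤s z≤n)
      l2 = lo≡ 2 (s≤s (s≤s z≤n))
      l3 = lo≡ 3 ℕₚ.≤-refl
      to : Window (lo q) (lo (1 + q)) (lo (2 + q)) (lo (3 + q)) → Window (a 0) (a 1) (a 2) (a 3)
      to (x , y , z) = trans (sym l0) (trans x l1) , subst₂ _<_ l1 l2 y , trans (sym l2) (trans z l3)
      from : Window (a 0) (a 1) (a 2) (a 3) → Window (lo q) (lo (1 + q)) (lo (2 + q)) (lo (3 + q))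
      from (x , y , z) = trans l0 (trans x (sym l1)) , subst₂ _<_ (sym l1) (sym l2) y , trans l2 (trans z (sym l3))

  kinks#-r₁ : kinks# ≡ r₁ as
  kinks#-r₁ = trans (count-cong (N ∸ 2) kinkAt-window) (trans (cong (count (windows (lam as))) (sym N∸2)) (#windows-lam 1 as pos))

-- The theorem

open import Defs

_↭?_ : (xs ys : List ℕ) → Dec (xs ↭ ys)
[] ↭? [] = yes ↭-refl
[] ↭? (y ∷ ys) = no λ p → ℕₚ.0≢1+n (↭-length p)
(x ∷ xs) ↭? ys with DecMembership._∈?_ ℕ._≟_ x ys
... | no x∉ = no λ p → x∉ (∈-resp-↭ p (here refl))
... | yes x∈ with ∈-∃++ x∈
...   | us , vs , refl = map′ (λ p → ↭-trans (Perm.prep x p) (↭-sym (shift x us vs)))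
          (λ p → drop-∷ (↭-trans p (shift x us vs))) (xs ↭? (us ++ vs))

-- `Φ` is a function on all of `GElt`, whereas symmetries are built from valid elements; the others
-- are sent to the identity.
valid? : ∀ as g → Dec (Valid as g)
valid? as g = (σ₁ g ↭? upTo (k₁ as)) ×-dec ((σ₂ g ↭? upTo (k₂ as)) ×-dec
  ((length (zs g) ℕ.≟ r₁ as) ×-dec ((t g Boolₚ.≟ true) →-dec Listₚ.≡-dec ℕ._≟_ as (reverse as))))

-- Passing between the faces of the polytope and those of its shape

module Transport (as : List ℕ) (3≤m : 3 ≤ length as) (pos : Positive as) where

  private
    S : Shape
    S = shape as 3≤m pos

  open Shape S
  open Poly S
  open Symmetry S
  open Reversal as 3≤m pos

  private
    n≡ : nOf as ≡ suc N
    n≡ = nOf-suc as 3≤m pos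

    <n : ∀ {i} → i ≤ N → i < nOf as
    <n h = subst (_ <_) (sym n≡) (s≤s h)

    ≤N : ∀ {i} → i < nOf as → i ≤ N
    ≤N h = ℕₚ.≤-pred (subst (_ <_) n≡ h)

    lamℚ-lo : ∀ {i} → i ≤ N → lamℚ as i ≡ ⟦ lo i ⟧
    lamℚ-lo {i} h = trans (sym (⟦⟧-def (at (lam as) i))) (cong ⟦_⟧ (sym (lo-at as 3≤m pos h)))

    flip-∸ : ∀ {p} → suc p ≤ N → suc (N ∸ suc p) ≡ N ∸ p
    flip-∸ {p} h = sym (ℕₚ.+-∸-assoc 1 h)

  module _ (F : Face as) where
    private
      x = proj₁ F
      diag  = proj₁ (proj₂ F)
      vert  = proj₁ (proj₂ (proj₂ F))
      horiz = proj₂ (proj₂ (proj₂ F))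

      X : Array ℚ
      X p q = x (N ∸ p) q

      vert′ : ∀ p q → p + q < N → X (suc p) q ℚ.≤ X p q
      vert′ p q h = subst (λ i → x (N ∸ suc p) q ℚ.≤ x i q) (flip-∸ p<N)
          (vert (N ∸ suc p) q (ℕₚ.m+n≤o⇒m≤o∸n q (subst (_≤ N) (ℕₚ.+-comm (suc p) q) h))
            (<n (ℕₚ.≤-trans (ℕₚ.≤-reflexive (flip-∸ p<N)) (ℕₚ.m∸n≤m N p))))
        where p<N : suc p ≤ N
              p<N = ℕₚ.≤-trans (s≤s (ℕₚ.m≤m+n p q)) h

      horiz′ : ∀ p q → p + q < N → X p q ℚ.≤ X p (suc q)
      horiz′ p q h = horiz (N ∸ p) q (ℕₚ.m+n≤o⇒m≤o∸n (suc q) (subst (_≤ N) (cong suc (ℕₚ.+-comm p q)) h)) (<n (ℕₚ.m∸n≤m N p))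

      on-diag : ∀ p q → p + q ≡ N → X p q ≡ ⟦ lo q ⟧
      on-diag p q e = trans (cong (λ i → x i q) N∸p≡q) (trans (diag q (<n q≤N)) (lamℚ-lo q≤N))
        where N∸p≡q : N ∸ p ≡ q
              N∸p≡q = trans (cong (_∸ p) (sym e)) (ℕₚ.m+n∸m≡n p q)
              q≤N : q ≤ N
              q≤N = subst (q ≤_) e (ℕₚ.m≤n+m q p)

      below : ∀ d p q → d + (p + q) ≡ N → ⟦ lo q ⟧ ℚ.≤ X p q
      below zero p q e = ℚₚ.≤-reflexive (sym (on-diag p q e))
      below (suc d) p q e = ℚₚ.≤-trans (below d (suc p) q (trans (ℕₚ.+-suc d (p + q)) e))
        (vert′ p q (ℕₚ.≤-trans (s≤s (ℕₚ.m≤n+m (p + q) d)) (ℕₚ.≤-reflexive e)))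

      above : ∀ d p q → d + (p + q) ≡ N → X p q ℚ.≤ ⟦ hi p ⟧
      above zero p q e = ℚₚ.≤-reflexive (trans (on-diag p q e) (cong ⟦_⟧ (sym (hi-diag e))))
      above (suc d) p q e = ℚₚ.≤-trans (horiz′ p q (ℕₚ.≤-trans (s≤s (ℕₚ.m≤n+m (p + q) d)) (ℕₚ.≤-reflexive e)))
        (above d p (suc q) (trans (cong (d +_) (ℕₚ.+-suc p q)) (trans (ℕₚ.+-suc d (p + q)) e)))

    fromFace : Face′
    fromFace = X , record
      -- Pinned entries off the diagonal are squeezed between the diagonal entries of their column
      -- and of their row.
      { fixed = λ p q h e → ℚₚ.≤-antisym
          (ℚₚ.≤-trans (above (N ∸ (p + q)) p q (ℕₚ.m∸n+n≡m h)) (ℚₚ.≤-reflexive (cong ⟦_⟧ (sym e))))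
          (below (N ∸ (p + q)) p q (ℕₚ.m∸n+n≡m h))
      ; mono = λ { e@(V p q) fe → vert′ p q (free⇒< (facet⇒free e fe))
                 ; e@(H p q) fe → horiz′ p q (free⇒< (facet⇒free e fe)) } }

  private
    V-range : ∀ {i j} → j ≤ i → suc i < nOf as → (N ∸ suc i) + j < N
    V-range {i} {j} j≤i h = ℕₚ.≤-trans (s≤s (ℕₚ.+-monoʳ-≤ (N ∸ suc i) j≤i))
      (ℕₚ.≤-reflexive (trans (sym (ℕₚ.+-suc (N ∸ suc i) i)) (ℕₚ.m∸n+n≡m (≤N h))))

    H-range : ∀ {i j} → suc j ≤ i → i < nOf as → (N ∸ i) + j < N
    H-range {i} {j} j<i h = ℕₚ.<-≤-trans (ℕₚ.+-monoʳ-< (N ∸ i) j<i) (ℕₚ.≤-reflexive (ℕₚ.m∸n+n≡m (≤N h)))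

  toFace : Face′ → Face as
  toFace (X , pt) = (λ i j → X (N ∸ i) j) ,
    (λ i h → trans (fixed pt (N ∸ i) i (ℕₚ.≤-reflexive (ℕₚ.m∸n+n≡m (≤N h))) (sym (hi-diag (ℕₚ.m∸n+n≡m (≤N h))))) (sym (lamℚ-lo (≤N h)))) ,
    (λ i j j≤i h → subst (λ a → X a j ℚ.≤ X (N ∸ suc i) j) (flip-∸ (≤N h)) (V-mono pt (N ∸ suc i) j (V-range j≤i h))) ,
    (λ i j j<i h → H-mono pt (N ∸ i) j (H-range j<i h))

  -- Records, so that the two faces can be inferred.
  infix 4 _≼_ _≼′_
  record _≼_ (F G : Face as) : Set where
    constructor face≤
    field le : FaceLe as F G
  open _≼_

  record _≼′_ (F G : Face′) : Set where
    constructor tight⊑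
    field ⊑ : F ⊑ G
  open _≼′_

  ≼-trans : ∀ {F G K} → F ≼ G → G ≼ K → F ≼ K
  ≼-trans (face≤ (a , b)) (face≤ (c , d)) = face≤ ((λ i j x y u → a i j x y (c i j x y u)) , (λ i j x y u → b i j x y (d i j x y u)))

  ≼′-trans : ∀ {F G K} → F ≼′ G → G ≼′ K → F ≼′ K
  ≼′-trans (tight⊑ h) (tight⊑ k) = tight⊑ λ e fe t → h e fe (k e fe t)

  fromFace-mono : ∀ {F G} → F ≼ G → fromFace F ≼′ fromFace G
  fromFace-mono {x , _} {y , _} (face≤ (v , h)) = tight⊑ λ
    { e@(V p q) fe t →
        let lt = free⇒< (facet⇒free e fe)
            p<N = ℕₚ.≤-trans (s≤s (ℕₚ.m≤m+n p q)) lt in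
        subst (λ i → x (N ∸ suc p) q ≡ x i q) (flip-∸ p<N)
          (v (N ∸ suc p) q (ℕₚ.m+n≤o⇒m≤o∸n q (subst (_≤ N) (ℕₚ.+-comm (suc p) q) lt))
            (<n (ℕₚ.≤-trans (ℕₚ.≤-reflexive (flip-∸ p<N)) (ℕₚ.m∸n≤m N p)))
            (subst (λ i → y (N ∸ suc p) q ≡ y i q) (sym (flip-∸ p<N)) t))
    ; e@(H p q) fe t →
        h (N ∸ p) q (ℕₚ.m+n≤o⇒m≤o∸n (suc q) (subst (_≤ N) (cong suc (ℕₚ.+-comm p q)) (free⇒< (facet⇒free e fe)))) (<n (ℕₚ.m∸n≤m N p)) t }

  -- `FaceLe` tests all inequalities and the order of the shape only facets; the gap is closed by
  -- `V-tight` and `H-tight`.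
  toFace-mono : ∀ {F G} → F ≼′ G → toFace F ≼ toFace G
  toFace-mono {F} {G} (tight⊑ F⊑G) = face≤
    ((λ i j j≤i h u → subst (λ a → proj₁ F a j ≡ proj₁ F (N ∸ suc i) j) (flip-∸ (≤N h))
      (V-tight {F} {G} F⊑G (N ∸ suc i) j (V-range j≤i h) (subst (λ a → proj₁ G a j ≡ proj₁ G (N ∸ suc i) j) (sym (flip-∸ (≤N h))) u))) ,
    (λ i j j<i h u → H-tight {F} {G} F⊑G (N ∸ i) j (H-range j<i h) u))

  private
    N∸∸ : ∀ {p} → p ≤ N → N ∸ (N ∸ p) ≡ p
    N∸∸ = ℕₚ.m∸[m∸n]≡n

    same-T : ∀ F e → Facet e → T (fromFace (toFace F)) e ≡ T F e
    same-T (X , _) e@(V p q) fe = cong₂ (λ a b → X a q ≡ X b q) (N∸∸ p<N) (N∸∸ (ℕₚ.<⇒≤ p<N))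
      where p<N : suc p ≤ N
            p<N = ℕₚ.≤-trans (s≤s (ℕₚ.m≤m+n p q)) (free⇒< (facet⇒free e fe))
    same-T (X , _) e@(H p q) fe = cong (λ a → X a q ≡ X a (suc q)) (N∸∸ (ℕₚ.≤-trans (ℕₚ.m≤m+n p q) (ℕₚ.<⇒≤ (free⇒< (facet⇒free e fe)))))

    to-from-at : ∀ (F : Face as) {i} j → i < nOf as → proj₁ (toFace (fromFace F)) i j ≡ proj₁ F i j
    to-from-at (x , _) j h = cong (λ a → x a j) (N∸∸ (≤N h))

  from-to≼ : ∀ F → fromFace (toFace F) ≼′ F
  from-to≼ F = tight⊑ λ e fe t → subst (λ A → A) (sym (same-T F e fe)) t

  from-to≽ : ∀ F → F ≼′ fromFace (toFace F)
  from-to≽ F = tight⊑ λ e fe t → subst (λ A → A) (same-T F e fe) t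

  to-from≼ : ∀ F → toFace (fromFace F) ≼ F
  to-from≼ F = face≤
    ((λ i j _ h u → trans (to-from-at F j (ℕₚ.<-trans (ℕₚ.n<1+n i) h)) (trans u (sym (to-from-at F j h)))) ,
    (λ i j _ h u → trans (to-from-at F j h) (trans u (sym (to-from-at F (suc j) h)))))

  to-from≽ : ∀ F → F ≼ toFace (fromFace F)
  to-from≽ F = face≤
    ((λ i j _ h u → trans (sym (to-from-at F j (ℕₚ.<-trans (ℕₚ.n<1+n i) h))) (trans u (to-from-at F j h))) ,
    (λ i j _ h u → trans (sym (to-from-at F j h)) (trans u (to-from-at F (suc j) h))))

  ρ-≼ : ∀ A {F G} → F ≼′ G → ρ A F ≼′ ρ A G
  ρ-≼ A {F} {G} (tight⊑ h) = tight⊑ (ρ-mono A {F} {G} h)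

  -- The tight facets of an image are the images of the tight facets, so `π` determines `ρ` up to
  -- equality of faces.
  ρ-cong : ∀ A B → (∀ e → Facet e → π A e ≡ π B e) → ∀ F → ρ A F ≼′ ρ B F
  ρ-cong A B eq F = tight⊑ λ e fe t → subst (T (ρ A F)) (trans (eq _ (π⁻-F B fe)) (ππ⁻ B fe)) (ρ-T A F (π⁻-F B fe) (ρ-T⁻′ B F fe t))

  ρρ⁻≼ : ∀ A F → ρ A (ρ⁻ A F) ≼′ F
  ρρ⁻≼ A F = tight⊑ λ e fe t → ρ-T′ A (ρ⁻ A F) fe (ρ⁻-T A F fe t)

  ρρ⁻≽ : ∀ A F → F ≼′ ρ A (ρ⁻ A F)
  ρρ⁻≽ A F = tight⊑ λ e fe t → ρ⁻-T⁻ A F fe (ρ-T⁻′ A (ρ⁻ A F) fe t)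

  move : Sym → Face as → Face as
  move A F = toFace (ρ A (fromFace F))

  move-mono : ∀ A {F G} → F ≼ G → move A F ≼ move A G
  move-mono A h = toFace-mono (ρ-≼ A (fromFace-mono h))

  move-cancel≼ : ∀ A F → move A (move (inv A) F) ≼ F
  move-cancel≼ A F = ≼-trans (toFace-mono (≼′-trans (ρ-≼ A (from-to≼ (ρ⁻ A (fromFace F)))) (ρρ⁻≼ A (fromFace F)))) (to-from≼ F)

  move-cancel≽ : ∀ A F → F ≼ move A (move (inv A) F)
  move-cancel≽ A F = ≼-trans (to-from≽ F) (toFace-mono (≼′-trans (ρρ⁻≽ A (fromFace F)) (ρ-≼ A (from-to≽ (ρ⁻ A (fromFace F))))))

  autOf : Sym → Aut as
  autOf A = record
    { to = move A ; from = move (inv A)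
    ; to-from = λ F → le (move-cancel≼ A F) , le (move-cancel≽ A F)
    ; from-to = λ F → le (move-cancel≼ (inv A) F) , le (move-cancel≽ (inv A) F)
    ; mono = λ F G h → le (move-mono A {F} {G} (face≤ h))
    ; reflect = λ F G h → le (≼-trans (move-cancel≽ (inv A) F)
        (≼-trans (move-mono (inv A) {move A F} {move A G} (face≤ h)) (move-cancel≼ (inv A) G))) }

  autOf-cong : ∀ A B → (∀ e → Facet e → π A e ≡ π B e) → ∀ F → FaceEq as (move A F) (move B F)
  autOf-cong A B eq F = le (toFace-mono (ρ-cong A B eq (fromFace F))) , le (toFace-mono (ρ-cong B A (λ e fe → sym (eq e fe)) (fromFace F)))

  autOf-⊙ : ∀ A B F → FaceEq as (move (A ⊙ B) F) (move A (move B F))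
  autOf-⊙ A B F = le (toFace-mono (ρ-≼ A (from-to≽ X))) , le (toFace-mono (ρ-≼ A (from-to≼ X)))
    where X = ρ B (fromFace F)

  FaceEq-trans : ∀ F G K → FaceEq as F G → FaceEq as G K → FaceEq as F K
  FaceEq-trans F G K (a , b) (c , d) = le (≼-trans {F} {G} {K} (face≤ a) (face≤ c)) , le (≼-trans {K} {G} {F} (face≤ d) (face≤ b))

  -- Tested on the face that lies on `e` alone: its image under both symmetries lies on `π A e`, and
  -- pulling back along `B` gives a facet that contains this face, hence `e`.
  autOf-injective : ∀ A B → (∀ F → FaceEq as (move A F) (move B F)) → ∀ e → Facet e → π A e ≡ π B e
  autOf-injective A B eq e fe = trans (sym (ππ⁻ B fπ)) (cong (π B)
      (facetFace-only e (π⁻ B (π A e)) (π⁻-F B fπ) (⊑ (from-to≽ X) _ (π⁻-F B fπ) (ρ-T⁻′ B Y fπ moved))))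
    where
    X Y : Face′
    X = facetFace e
    Y = fromFace (toFace X)
    fπ : Facet (π A e)
    fπ = π-F A fe
    moved : T (ρ B Y) (π A e)
    moved = ⊑ (≼′-trans (from-to≽ (ρ B Y)) (≼′-trans (fromFace-mono (face≤ (proj₂ (eq (toFace X))))) (from-to≼ (ρ A Y)))) _ fπ
      (ρ-T A Y fe (⊑ (from-to≼ X) e fe (facetFace-T e fe)))

  module _ (α : Aut as) where
    private
      up : ∀ {F G} → F ≼ G → to α F ≼ to α G
      up (face≤ h) = face≤ (mono α _ _ h)

      to-from₁ : ∀ F → to α (from α F) ≼ F
      to-from₁ F = face≤ (proj₁ (to-from α F))

      to-from₂ : ∀ F → F ≼ to α (from α F)
      to-from₂ F = face≤ (proj₂ (to-from α F))

      down : ∀ {F G} → F ≼ G → from α F ≼ from α G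
      down {F} {G} h = face≤ (reflect α (from α F) (from α G) (le (≼-trans (to-from₁ F) (≼-trans h (to-from₂ G)))))

      from-to₁ : ∀ F → from α (to α F) ≼ F
      from-to₁ F = face≤ (proj₁ (from-to α F))

      from-to₂ : ∀ F → F ≼ from α (to α F)
      from-to₂ F = face≤ (proj₂ (from-to α F))

      conj : (Face as → Face as) → Face′ → Face′
      conj f F = fromFace (f (toFace F))

      round≼ : ∀ (f g : Face as → Face as) → (∀ {F G} → F ≼ G → f F ≼ f G) → (∀ F → f (g F) ≼ F) → ∀ F → conj f (conj g F) ≼′ F
      round≼ f g f-mono fg F = ≼′-trans (fromFace-mono (≼-trans (f-mono (to-from≼ (g (toFace F)))) (fg (toFace F)))) (from-to≼ F)

      round≽ : ∀ (f g : Face as → Face as) → (∀ {F G} → F ≼ G → f F ≼ f G) → (∀ F → F ≼ f (g F)) → ∀ F → F ≼′ conj f (conj g F)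
      round≽ f g f-mono fg F = ≼′-trans (from-to≽ F) (fromFace-mono (≼-trans (fg (toFace F)) (f-mono (to-from≽ (g (toFace F))))))

    symOfAut : Sym
    symOfAut = FromAut.autSym (conj (to α)) (conj (from α))
      (λ F G h → ⊑ (fromFace-mono (up (toFace-mono {F} {G} (tight⊑ h)))))
      (λ F G h → ⊑ (fromFace-mono (down (toFace-mono {F} {G} (tight⊑ h)))))
      (λ F → ⊑ (round≼ (to α) (from α) up to-from₁ F) , ⊑ (round≽ (to α) (from α) up to-from₂ F))
      (λ F → ⊑ (round≼ (from α) (to α) down from-to₁ F) , ⊑ (round≽ (from α) (to α) down from-to₂ F))

    symOfAut-to : ∀ F → FaceEq as (to α F) (move symOfAut F)
    symOfAut-to F = le (≼-trans (up (to-from≽ F)) (to-from≽ _)) , le (≼-trans (to-from≼ _) (up (to-from≼ F)))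

  open Laws S (k₁ as) (k₂ as) (endA as 3≤m pos) endB pal⇒k

  valid⇒good : ∀ {g} → Valid as g → Good g
  valid⇒good (p₁ , p₂ , l , pal) = good p₁ p₂ (trans l (sym kinks#-r₁)) (palindrome⇒pal ∘ pal)

  good⇒valid : ∀ {g} → Good g → Valid as g
  good⇒valid (good p₁ p₂ l pal) = p₁ , p₂ , trans l kinks#-r₁ , pal⇒palindrome ∘ pal

  symFor : ∀ g → Dec (Valid as g) → Sym
  symFor g (yes v) = symOf g (valid⇒good v)
  symFor g (no _)  = idSym

  symFor-valid : ∀ g (v : Valid as g) (d : Dec (Valid as g)) → ∀ e → Facet e → π (symFor g d) e ≡ π (symOf g (valid⇒good v)) e
  symFor-valid g v (yes v′) e fe = symOf-irr g (valid⇒good v′) (valid⇒good v) fe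
  symFor-valid g v (no n)   e fe = ⊥-elim (n v)

  Φ-sym : GElt → Sym
  Φ-sym g = symFor g (valid? as g)

  Φ-sym-valid : ∀ g (v : Valid as g) e → Facet e → π (Φ-sym g) e ≡ π (symOf g (valid⇒good v)) e
  Φ-sym-valid g v = symFor-valid g v (valid? as g)

  Φ : GElt → Aut as
  Φ g = autOf (Φ-sym g)

  Φ-hom : ∀ g h → Valid as g → Valid as h → ∀ F → FaceEq as (to (Φ (g · h)) F) (to (Φ g) (to (Φ h) F))
  Φ-hom g h valid-g valid-h F = FaceEq-trans (to (Φ (g · h)) F) (move (Φ-sym g ⊙ Φ-sym h) F) (to (Φ g) (to (Φ h) F))
      (autOf-cong (Φ-sym (g · h)) (Φ-sym g ⊙ Φ-sym h) eq F) (autOf-⊙ (Φ-sym g) (Φ-sym h) F)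
    where
    vgh : Valid as (g · h)
    vgh = good⇒valid (good-· g h (valid⇒good valid-g) (valid⇒good valid-h))
    eq : ∀ e → Facet e → π (Φ-sym (g · h)) e ≡ π (Φ-sym g) (π (Φ-sym h) e)
    eq e fe = trans (Φ-sym-valid (g · h) vgh e fe) (trans (hom g h (valid⇒good valid-g) (valid⇒good valid-h) (valid⇒good vgh) fe)
      (sym (trans (Φ-sym-valid g valid-g _ (π-F (Φ-sym h) fe)) (cong (π (symOf g (valid⇒good valid-g))) (Φ-sym-valid h valid-h e fe)))))

  Φ-inj : ∀ g h → Valid as g → Valid as h → (∀ F → FaceEq as (to (Φ g) F) (to (Φ h) F)) → g ≡ h
  Φ-inj g h valid-g valid-h eq = injective g h (valid⇒good valid-g) (valid⇒good valid-h) λ e fe →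
    trans (sym (Φ-sym-valid g valid-g e fe)) (trans (autOf-injective (Φ-sym g) (Φ-sym h) eq e fe) (Φ-sym-valid h valid-h e fe))

  Φ-surj : ∀ (α : Aut as) → Σ GElt λ g → Valid as g × (∀ F → FaceEq as (to α F) (to (Φ g) F))
  Φ-surj α = g , v , λ F → FaceEq-trans (to α F) (move (symOfAut α) F) (to (Φ g) F) (symOfAut-to α F)
      (autOf-cong (symOfAut α) (Φ-sym g) (λ e fe → trans (proj₂ (proj₂ found) e fe)
        (trans (symOf-irr g ok (valid⇒good v) fe) (sym (Φ-sym-valid g v e fe)))) F)
    where
    found = surjective (symOfAut α)
    g : GElt
    g = proj₁ found
    ok : Good g
    ok = proj₁ (proj₂ found)
    v : Valid as g
    v = good⇒valid ok

theorem1p3 : (as : List ℕ) → 3 ≤ length as → All (1 ≤_) as →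
    Σ (GElt → Aut as) λ Φ →
    (∀ g h → Valid as g → Valid as h → ∀ F →
    FaceEq as (to (Φ (g · h)) F) (to (Φ g) (to (Φ h) F))) ×
    (∀ g h → Valid as g → Valid as h →
    (∀ F → FaceEq as (to (Φ g) F) (to (Φ h) F)) → g ≡ h) ×
    (∀ (α : Aut as) → Σ GElt λ g → Valid as g × (∀ F → FaceEq as (to α F) (to (Φ g) F)))
theorem1p3 as 3≤m pos = Φ , Φ-hom , Φ-inj , Φ-surj
  where open Transport as 3≤m pos
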